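{- Let $\Sigma\subseteq\mathrm{PG}(4,q^5)$ be a canonical $\mathbb F_q$-subgeometry and $\Gamma$ a plane such that $\mathbb L=\wp_\Gamma(\Sigma)$ is a maximum scattered linear set of $\mathrm{PG}(1,q^5)$ not of pseudoregulus type. Let $1\neq\sigma\in\mathbb G$, let $A$ and $B$ be the points $\Gamma\cap\Gamma^{\sigma^4}$ and $\Gamma\cap\Gamma^{\sigma^3}$, and let $E=\langle A,B\rangle\cap\langle A_1,B_2\rangle$ and $F=\langle A,B_2\rangle\cap\langle A_1,B\rangle$. Then $\mathbb L$ is of LP type if and only if $E\in\langle A_2,A_4\rangle$ or $F\in\langle B_3,B_4\rangle$.
   Context: $q$ is a prime power; $\mathrm N_{q^5/q}(x)=x^{1+q+q^2+q^3+q^4}$. An $\mathbb F_q$-linear set of rank 5 in $\mathrm{PG}(1,q^5)$ is $L_U=\{\langle v\rangle_{\mathbb F_{q^5}}:v\in U\setminus\{0\}\}$ for a 5-dimensional $\mathbb F_q$-subspace $U\subseteq\mathbb F_{q^5}^2$; maximum scattered means having $(q^5-1)/(q-1)$ points. Pseudoregulus type: $\mathrm{P\Gamma L}(2,q^5)$-equivalent to $\{\langle(x,x^{q^s})\rangle_{\mathbb F_{q^5}}:x\neq0\}$, $\gcd(s,5)=1$; LP type: equivalent to $\{\langle(x,x^{q^s}+\delta x^{q^{5-s}})\rangle_{\mathbb F_{q^5}}:x\neq0\}$, $\gcd(s,5)=1$, $\mathrm N_{q^5/q}(\delta)\notin\{0,1\}$. A canonical $\mathbb F_q$-subgeometry of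 $\mathrm{PG}(4,q^5)$ is the image under a projectivity of the set of points with coordinates in $\mathbb F_q$; $\Gamma\cap\Sigma=\emptyset$ and $\wp_\Gamma(\Sigma)$ is the projection of $\Sigma$ from $\Gamma$ onto a line disjoint from $\Gamma$. $\mathbb G$ is the subgroup of $\mathrm{P\Gamma L}(5,q^5)$ fixing $\Sigma$ pointwise (cyclic of order 5). Under the hypotheses $\Gamma\cap\Gamma^{\sigma^4}$ and $\Gamma\cap\Gamma^{\sigma^3}$ are single points and $A,A_1,B,B_2$ are four points of $\Gamma$, no three collinear. For a point $X$, $X_i=X^{\sigma^i}$; $\langle\ \rangle$ denotes projective span. -}

module Defs where

open import Data.Nat as ℕ using (ℕ; zero; suc; _≤_; _<_; _∸_)
open import Data.Nat.Primality using (Prime)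
open import Data.Nat.GCD using (gcd)
open import Data.Fin using (Fin; zero; suc)
open import Data.List using (List; length)
open import Data.List.Membership.Propositional using (_∈_)
open import Data.List.Relation.Unary.All using (All)
open import Data.List.Relation.Unary.Any using (Any)
open import Data.List.Relation.Unary.AllPairs using (AllPairs)
open import Data.List.Relation.Unary.Unique.Propositional using (Unique)
open import Data.Product using (Σ; ∃; ∃₂; _×_; _,_)
open import Relation.Binary.PropositionalEquality using (_≡_; _≢_)
open import Relation.Nullary using (¬_)
open import Relation.Binary.Definitions using (DecidableEquality)
open import Algebra.Structures using (IsCommutativeRing)

IsPrimePower : ℕ → Set
IsPrimePower q = ∃₂ λ p k → Prime p × 1 ≤ k × q ≡ p ℕ.^ k

record FiniteField : Set₁ where
  infixl 6 _+_
  infixl 7 _*_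
  field
    K : Set
    _+_ _*_ : K → K → K
    -_ : K → K
    0# 1# : K
    isCommutativeRing : IsCommutativeRing _≡_ _+_ _*_ -_ 0# 1#
    0≢1 : 0# ≢ 1#
    inverse : ∀ x → x ≢ 0# → ∃ λ y → x * y ≡ 1#
    _≟_ : DecidableEquality K
    elements : List K
    elements-complete : ∀ x → x ∈ elements
    elements-unique : Unique elements

  order : ℕ
  order = length elements

-- Projective geometry over the field 𝔽 (intended order q^5).
module Geometry (𝔽 : FiniteField) (q : ℕ) where
  open FiniteField 𝔽

  _^_ : K → ℕ → K
  x ^ zero = 1#
  x ^ suc n = x * (x ^ n)

  InFq : K → Set
  InFq x = x ^ q ≡ x

  Norm : K → K
  Norm x = x ^ (1 ℕ.+ q ℕ.+ q ℕ.^ 2 ℕ.+ q ℕ.^ 3 ℕ.+ q ℕ.^ 4)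

  record Automorphism : Set where
    field
      f g : K → K
      f-+ : ∀ x y → f (x + y) ≡ f x + f y
      f-* : ∀ x y → f (x * y) ≡ f x * f y
      f-1 : f 1# ≡ 1#
      fg : ∀ x → f (g x) ≡ x
      gf : ∀ x → g (f x) ≡ x

  -- vectors of K^n, homogeneous coordinates of PG(n-1, K)
  Vec : ℕ → Set
  Vec n = Fin n → K

  sumF : (k : ℕ) → (Fin k → K) → K
  sumF zero a = 0#
  sumF (suc k) a = a zero + sumF k (λ j → a (suc j))

  NonZero : ∀ {n} → Vec n → Set
  NonZero v = ¬ (∀ i → v i ≡ 0#)

  -- v and w represent the same projective point (for nonzero v, w)
  Proportional : ∀ {n} → Vec n → Vec n → Set
  Proportional v w = ∃ λ c → c ≢ 0# × (∀ i → v i ≡ c * w i)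

  comb : ∀ {n k} → (Fin k → K) → (Fin k → Vec n) → Vec n
  comb {k = k} c ws i = sumF k (λ j → c j * ws j i)

  InSpan : ∀ {n k} → (Fin k → Vec n) → Vec n → Set
  InSpan ws v = ∃ λ c → ∀ i → v i ≡ comb c ws i

  LinIndep : ∀ {n k} → (Fin k → Vec n) → Set
  LinIndep ws = ∀ c → (∀ i → comb c ws i ≡ 0#) → ∀ j → c j ≡ 0#

  fam2 : ∀ {n} → Vec n → Vec n → Fin 2 → Vec n
  fam2 P Q zero = P
  fam2 P Q (suc _) = Q

  fam3 : ∀ {n} → Vec n → Vec n → Vec n → Fin 3 → Vec n
  fam3 P Q R zero = P
  fam3 P Q R (suc zero) = Q
  fam3 P Q R (suc (suc _)) = R

  extend : ∀ {n k} → (Fin k → Vec n) → Vec n → Fin (suc k) → Vec n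
  extend g P zero = P
  extend g P (suc j) = g j

  OnLine : ∀ {n} → Vec n → Vec n → Vec n → Set
  OnLine P Q X = NonZero X × InSpan (fam2 P Q) X

  NonCollinear : ∀ {n} → Vec n → Vec n → Vec n → Set
  NonCollinear P Q R = LinIndep (fam3 P Q R)

  NoThreeCollinear : ∀ {n} → Vec n → Vec n → Vec n → Vec n → Set
  NoThreeCollinear P Q R S =
    NonCollinear P Q R × NonCollinear P Q S × NonCollinear P R S × NonCollinear Q R S

  Mat : ℕ → Set
  Mat n = Fin n → Fin n → K

  mulMV : ∀ {n} → Mat n → Vec n → Vec n
  mulMV {n} M v i = sumF n (λ j → M i j * v j)

  Invertible : ∀ {n} → Mat n → Set
  Invertible {n} M = ∃ λ (N : Mat n) →
    (∀ v i → mulMV M (mulMV N v) i ≡ v i) × (∀ v i → mulMV N (mulMV M v) i ≡ v i)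

  -- semilinear maps v ↦ M v^τ, representing elements of PΓL(n, K)
  record Semilinear (n : ℕ) : Set where
    field
      mat : Mat n
      mat-inv : Invertible mat
      aut : Automorphism

  apply : ∀ {n} → Semilinear n → Vec n → Vec n
  apply φ v = mulMV (Semilinear.mat φ) (λ i → Automorphism.f (Semilinear.aut φ) (v i))

  iter : ∀ {n} → ℕ → Semilinear n → Vec n → Vec n
  iter zero σ X = X
  iter (suc i) σ X = apply σ (iter i σ X)

  -- points of the canonical 𝔽_q-subgeometry Σ = image of PG(4,q) under
  -- the projectivity with (invertible) matrix M
  SubgeomPoint : Mat 5 → Vec 5 → Set
  SubgeomPoint M X = NonZero X × ∃ λ u → (∀ i → InFq (u i)) × NonZero u × Proportional X (mulMV M u)

  -- plane Γ spanned by three independent vectors g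
  InPlane : (Fin 3 → Vec 5) → Vec 5 → Set
  InPlane g X = NonZero X × InSpan g X

  InImagePlane : ℕ → Semilinear 5 → (Fin 3 → Vec 5) → Vec 5 → Set
  InImagePlane i σ g Y = NonZero Y × ∃ λ X → InPlane g X × Proportional Y (iter i σ X)

  MeetIsPoint : (Fin 3 → Vec 5) → ℕ → Semilinear 5 → Vec 5 → Set
  MeetIsPoint g i σ A =
    InPlane g A × InImagePlane i σ g A ×
    (∀ Y → InPlane g Y → InImagePlane i σ g Y → Proportional Y A)

  LineDisjointPlane : (Fin 3 → Vec 5) → (Fin 2 → Vec 5) → Set
  LineDisjointPlane g l = ¬ (∃ λ X → NonZero X × InSpan g X × InSpan l X)

  -- ℘_Γ(Σ) ⊆ ℓ, written in the coordinates (a, b) ↦ a l₀ + b l₁ of ℓ ≅ PG(1, K):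
  -- w is in it iff the point w₀ l₀ + w₁ l₁ of ℓ lies in ⟨Γ, P⟩ for some P ∈ Σ
  Projection : Mat 5 → (Fin 3 → Vec 5) → (Fin 2 → Vec 5) → Vec 2 → Set
  Projection M g l w = NonZero w × ∃ λ P → SubgeomPoint M P × InSpan (extend g P) (comb w l)

  HasNPoints : (Vec 2 → Set) → ℕ → Set
  HasNPoints S N = ∃ λ (ps : List (Vec 2)) →
    length ps ≡ N × All S ps × AllPairs (λ v w → ¬ Proportional v w) ps ×
    (∀ v → S v → Any (Proportional v) ps)

  -- maximum scattered (rank 5): (q^5 - 1)/(q - 1) = 1+q+q^2+q^3+q^4 points
  MaxScattered : (Vec 2 → Set) → Set
  MaxScattered S = HasNPoints S (1 ℕ.+ q ℕ.+ q ℕ.^ 2 ℕ.+ q ℕ.^ 3 ℕ.+ q ℕ.^ 4)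

  PΓLEquivalent : (Vec 2 → Set) → (Vec 2 → Set) → Set
  PΓLEquivalent S T = ∃ λ (φ : Semilinear 2) →
    (∀ v → S v → T (apply φ v)) × (∀ w → T w → ∃ λ v → S v × Proportional w (apply φ v))

  ValidS : ℕ → Set
  ValidS s = s < 5 × gcd s 5 ≡ 1

  PseudoregulusSet : ℕ → Vec 2 → Set
  PseudoregulusSet s w = NonZero w × ∃ λ x → x ≢ 0# × Proportional w (fam2' x (x ^ (q ℕ.^ s)))
    where
      fam2' : K → K → Vec 2
      fam2' a b zero = a
      fam2' a b (suc _) = b

  LPSet : ℕ → K → Vec 2 → Set
  LPSet s δ w = NonZero w × ∃ λ x → x ≢ 0# ×
    Proportional w (fam2' x (x ^ (q ℕ.^ s) + δ * (x ^ (q ℕ.^ (5 ∸ s)))))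
    where
      fam2' : K → K → Vec 2
      fam2' a b zero = a
      fam2' a b (suc _) = b

  IsPseudoregulusType : (Vec 2 → Set) → Set
  IsPseudoregulusType S = ∃ λ s → ValidS s × PΓLEquivalent S (PseudoregulusSet s)

  IsLPType : (Vec 2 → Set) → Set
  IsLPType S = ∃₂ λ s δ → ValidS s × Norm δ ≢ 0# × Norm δ ≢ 1# × PΓLEquivalent S (LPSet s δ)

  InG : Mat 5 → Semilinear 5 → Set
  InG M σ = ∀ X → SubgeomPoint M X → Proportional (apply σ X) X

  NotIdentity : Semilinear 5 → Set
  NotIdentity σ = ¬ (∀ X → NonZero X → Proportional (apply σ X) X)

{-# OPTIONS --safe #-}
-- Choose coordinates in which Σ is the set of points with coordinates in 𝔽_q; then σ is the coordinatewise map
-- τ = x^(q^t). Let f : K⁵ → K² be the linear map with kernel Γ, so that 𝕃 = { ⟨f(u)⟩ : 0 ≠ u ∈ 𝔽_q⁵ }. The point A is the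
-- only one with f(A) = f(A₁) = 0, and B the only one with f(B) = f(B₂) = 0; replacing σ by σ² exchanges A, A₁, B, B₂, E
-- with B, B₂, A₁, A, F, hence the two conditions.
-- If E = α A₂ + β A₄, then A, …, A₄ is a basis in which f(u) is, up to a matrix, (x, x^τ + δ x^(τ⁴)) with δ = -β/α; were
-- N(δ) = 1, Hilbert 90 would give two preimages of a point, and the q⁴+…+1 points would come from q⁴+…+2 roots of
-- X^(q⁴+…+1) - 1.
-- Conversely, let 𝕃 be { ⟨(x, g(x))⟩ } and { ⟨(x, x^(q^s) + δ x^(q^(5-s)))⟩ } for a q-polynomial g. The determinant of the
-- Dickson matrix of g minus diag(m, m^q, …, m^(q⁴)) is a polynomial in m of degree q⁴+…+1 vanishing at the q⁴+…+1 slopes of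
-- 𝕃, so it only depends on 𝕃. Its coefficients are the principal minors of the Dickson matrix, and those of order at most
-- three force g to be a combination of x^(q^s) and x^(q^(5-s)); the incidence is then read off in the coordinates
-- ξ, ξ^τ, …, ξ^(τ⁴) given by the form ξ of x.
module Submission where

open import Defs
open import Algebra.Bundles using (CommutativeMonoid; CommutativeRing)
import Algebra.Properties.CommutativeSemiring.Binomial as Binomial
import Algebra.Properties.Semiring.Exp as Exp
import Algebra.Properties.Semiring.Mult as Mult
import Algebra.Properties.Semiring.Sum as Sum
import Algebra.Solver.Ring as RingSolver
open import Algebra.Solver.Ring.AlmostCommutativeRing using (AlmostCommutativeRing; fromCommutativeRing; _-Raw-AlmostCommutative⟶_)
open import Data.Bool using (Bool; true; false)
open import Data.Empty using (⊥-elim)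
open import Data.Fin as Fin using (Fin; zero; suc; punchIn)
open import Data.Fin.Patterns using (0F; 1F; 2F; 3F; 4F)
import Data.Fin.Properties as Fin
open import Data.Integer as ℤ using (ℤ; -[1+_]; _⊖_; _◃_)
import Data.Integer.Properties as ℤ
open import Data.List as List using (List; []; _∷_; _++_; length; map; foldr; replicate)
import Data.List.Properties as List
import Data.List.Membership.DecPropositional as DecMembership
open import Data.List.Membership.Propositional using (_∈_; find)
open import Data.List.Membership.Propositional.Properties using (∈-∃++; ∈-map⁺)
open import Data.List.Membership.Propositional.Properties.WithK using (unique∧set⇒bag)
open import Data.List.Relation.Binary.BagAndSetEquality using (∼bag⇒↭)
open import Data.List.Relation.Binary.Permutation.Propositional using (_↭_; ↭-sym; ↭-trans; ↭-reflexive; ↭⇒↭ₛ)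
open import Data.List.Relation.Binary.Permutation.Propositional.Properties using (shift; drop-∷; map⁺; ↭-length)
import Data.List.Relation.Binary.Permutation.Setoid.Properties as Permutation
open import Data.List.Relation.Unary.All as All using (All; []; _∷_)
import Data.List.Relation.Unary.All.Properties as All
open import Data.List.Relation.Unary.AllPairs as AllPairs using (AllPairs; []; _∷_)
open import Data.List.Relation.Unary.Any as Any using (here; there)
open import Data.List.Relation.Unary.Unique.Propositional using (Unique)
import Data.List.Relation.Unary.Unique.Propositional.Properties as Unique
import Data.Maybe as Maybe
open import Data.Nat as ℕ using (ℕ; zero; suc; z≤n; s≤s; _!)
open import Data.Nat.Combinatorics using (nCk≡n!/k![n-k]!; k![n∸k]!∣n!; nCn≡1) renaming (_C_ to _choose_)
open import Data.Nat.Divisibility using (_∣_; divides; ∣⇒≤; m∣m*n)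
open import Data.Nat.DivMod using (_mod_; m/n*n≡m)
open import Data.Nat.Primality using (Prime; euclidsLemma; prime⇒nonZero; prime⇒nonTrivial; ¬prime[1])
import Data.Nat.Properties as ℕ
open import Data.Nat.Tactic.RingSolver using (solve-∀)
open import Data.Product using (_,_; proj₁; proj₂; ∃; ∃₂; _×_)
open import Data.Sign as Sign using (Sign)
open import Data.Sum using (_⊎_; inj₁; inj₂; [_,_]′)
open import Data.Unit using (⊤; tt)
open import Data.Vec using (_∷_; [])
import Data.Vec.Functional as Vector
open import Data.Vec.Functional.Properties using (insertAt-lookup; insertAt-punchIn)
open import Function using (_∘_; id)
open import Function.Bundles using (_⇔_; mk⇔)
open import Level using (0ℓ)
open import Relation.Binary.PropositionalEquality
open import Relation.Nullary using (yes; no; ¬_; ¬?)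
open import Relation.Nullary.Decidable using (dec⇒maybe; decidable-stable)

-- The residues modulo 5 explain why there are two conditions. The coordinatewise map is x^(q^t)
-- with 1 ≤ t ≤ 4, while LP type supplies an unrelated s. The two monomials x^(q^s) and x^(q^(5-s))
-- depend only on the pair {s, 5 - s}, and the nonzero residues are ±t and ±2t: the first pair leads
-- to E, the second, which belongs to σ², to F. An equivalence in PΓL(2, q⁵) twists everything by a
-- field automorphism α. Composed with α⁻¹ it becomes a linear change of coordinates, at the price
-- of replacing δ by α⁻¹(δ). The count of slopes is tight: both determinants have degree N =
-- q⁴+q³+q²+q+1 and just N common roots are known. The top coefficient is -1 for every g, so it
-- cancels and the difference has degree below N. The q-polynomial g exists because the first
-- coordinate ξ vanishes at no nonzero vector of 𝔽_q⁵: then ξ and its conjugates vanish together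
-- only at 0, hence form a basis of the linear forms on K⁵, in which the second coordinate can be
-- expanded.

-- Field arithmetic and a ring solver with integer coefficients

module FieldTheory (𝔽 : FiniteField) where
  open FiniteField 𝔽 public
  open ≡-Reasoning

  commutativeRing : CommutativeRing 0ℓ 0ℓ
  commutativeRing = record { isCommutativeRing = isCommutativeRing }

  open CommutativeRing commutativeRing public
    using (ring; commutativeSemiring; semiring; *-commutativeMonoid; +-commutativeMonoid
          ; +-assoc; +-comm; +-identityˡ; +-identityʳ; -‿inverseˡ; -‿inverseʳ
          ; *-assoc; *-comm; *-identityˡ; *-identityʳ; zeroˡ; zeroʳ; distribˡ; distribʳ)
  open import Algebra.Properties.Ring ring public
    using (-‿distribˡ-*; -‿distribʳ-*; -0#≈0#; -‿involutive; -‿+-comm)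

  -- The case 1 is separate so that the solver constant 1 denotes 1# on the nose.
  ⟦_⟧ℕ : ℕ → K
  ⟦ zero ⟧ℕ = 0#
  ⟦ suc zero ⟧ℕ = 1#
  ⟦ suc (suc n) ⟧ℕ = 1# + ⟦ suc n ⟧ℕ

  ⟦suc⟧ : ∀ n → ⟦ suc n ⟧ℕ ≡ 1# + ⟦ n ⟧ℕ
  ⟦suc⟧ zero = sym (+-identityʳ 1#)
  ⟦suc⟧ (suc n) = refl

  ⟦+⟧ : ∀ m n → ⟦ m ℕ.+ n ⟧ℕ ≡ ⟦ m ⟧ℕ + ⟦ n ⟧ℕ
  ⟦+⟧ zero n = sym (+-identityˡ _)
  ⟦+⟧ (suc m) n = begin
    ⟦ suc (m ℕ.+ n) ⟧ℕ      ≡⟨ ⟦suc⟧ (m ℕ.+ n) ⟩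
    1# + ⟦ m ℕ.+ n ⟧ℕ       ≡⟨ cong (1# +_) (⟦+⟧ m n) ⟩
    1# + (⟦ m ⟧ℕ + ⟦ n ⟧ℕ)  ≡⟨ +-assoc _ _ _ ⟨
    1# + ⟦ m ⟧ℕ + ⟦ n ⟧ℕ    ≡⟨ cong (_+ ⟦ n ⟧ℕ) (⟦suc⟧ m) ⟨
    ⟦ suc m ⟧ℕ + ⟦ n ⟧ℕ     ∎

  ⟦*⟧ : ∀ m n → ⟦ m ℕ.* n ⟧ℕ ≡ ⟦ m ⟧ℕ * ⟦ n ⟧ℕ
  ⟦*⟧ zero n = sym (zeroˡ _)
  ⟦*⟧ (suc m) n = begin
    ⟦ n ℕ.+ m ℕ.* n ⟧ℕ               ≡⟨ ⟦+⟧ n (m ℕ.* n) ⟩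
    ⟦ n ⟧ℕ + ⟦ m ℕ.* n ⟧ℕ            ≡⟨ cong (⟦ n ⟧ℕ +_) (⟦*⟧ m n) ⟩
    ⟦ n ⟧ℕ + ⟦ m ⟧ℕ * ⟦ n ⟧ℕ         ≡⟨ cong (_+ ⟦ m ⟧ℕ * ⟦ n ⟧ℕ) (*-identityˡ _) ⟨
    1# * ⟦ n ⟧ℕ + ⟦ m ⟧ℕ * ⟦ n ⟧ℕ    ≡⟨ distribʳ _ _ _ ⟨
    (1# + ⟦ m ⟧ℕ) * ⟦ n ⟧ℕ           ≡⟨ cong (_* ⟦ n ⟧ℕ) (⟦suc⟧ m) ⟨
    ⟦ suc m ⟧ℕ * ⟦ n ⟧ℕ              ∎

  ⟦_⟧ℤ : ℤ → K
  ⟦ ℤ.+ n ⟧ℤ = ⟦ n ⟧ℕ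
  ⟦ -[1+ n ] ⟧ℤ = - ⟦ suc n ⟧ℕ

  private
    cancel-1 : ∀ a b → (1# + a) + - (1# + b) ≡ a + - b
    cancel-1 a b = begin
      (1# + a) + - (1# + b)      ≡⟨ cong ((1# + a) +_) (-‿+-comm 1# b) ⟨
      (1# + a) + (- 1# + - b)    ≡⟨ cong (_+ (- 1# + - b)) (+-comm 1# a) ⟩
      (a + 1#) + (- 1# + - b)    ≡⟨ +-assoc _ _ _ ⟩
      a + (1# + (- 1# + - b))    ≡⟨ cong (a +_) (+-assoc _ _ _) ⟨
      a + ((1# + - 1#) + - b)    ≡⟨ cong (λ z → a + (z + - b)) (-‿inverseʳ 1#) ⟩
      a + (0# + - b)             ≡⟨ cong (a +_) (+-identityˡ _) ⟩
      a + - b                    ∎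

    ⟦⊖⟧ : ∀ m n → ⟦ m ⊖ n ⟧ℤ ≡ ⟦ m ⟧ℕ + - ⟦ n ⟧ℕ
    ⟦⊖⟧ m zero = sym (trans (cong (⟦ m ⟧ℕ +_) -0#≈0#) (+-identityʳ _))
    ⟦⊖⟧ zero (suc n) = sym (+-identityˡ _)
    ⟦⊖⟧ (suc m) (suc n) = begin
      ⟦ suc m ⊖ suc n ⟧ℤ               ≡⟨ cong ⟦_⟧ℤ (ℤ.[1+m]⊖[1+n]≡m⊖n m n) ⟩
      ⟦ m ⊖ n ⟧ℤ                       ≡⟨ ⟦⊖⟧ m n ⟩
      ⟦ m ⟧ℕ + - ⟦ n ⟧ℕ                ≡⟨ cancel-1 _ _ ⟨
      (1# + ⟦ m ⟧ℕ) + - (1# + ⟦ n ⟧ℕ)  ≡⟨ cong₂ (λ a b → a + - b) (⟦suc⟧ m) (⟦suc⟧ n) ⟨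
      ⟦ suc m ⟧ℕ + - ⟦ suc n ⟧ℕ        ∎

    ⟦-⟧ : ∀ i → ⟦ ℤ.- i ⟧ℤ ≡ - ⟦ i ⟧ℤ
    ⟦-⟧ (ℤ.+ zero) = sym -0#≈0#
    ⟦-⟧ (ℤ.+ suc n) = refl
    ⟦-⟧ -[1+ n ] = sym (-‿involutive _)

    ⟦+⟧ℤ : ∀ i j → ⟦ i ℤ.+ j ⟧ℤ ≡ ⟦ i ⟧ℤ + ⟦ j ⟧ℤ
    ⟦+⟧ℤ (ℤ.+ m) (ℤ.+ n) = ⟦+⟧ m n
    ⟦+⟧ℤ (ℤ.+ m) -[1+ n ] = ⟦⊖⟧ m (suc n)
    ⟦+⟧ℤ -[1+ m ] (ℤ.+ n) = trans (⟦⊖⟧ n (suc m)) (+-comm _ _)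
    ⟦+⟧ℤ -[1+ m ] -[1+ n ] = begin
      - (1# + ⟦ suc (m ℕ.+ n) ⟧ℕ)          ≡⟨ cong (λ z → - (1# + z)) (⟦+⟧ (suc m) n) ⟩
      - (1# + (⟦ suc m ⟧ℕ + ⟦ n ⟧ℕ))       ≡⟨ cong -_ (+-assoc _ _ _) ⟨
      - (1# + ⟦ suc m ⟧ℕ + ⟦ n ⟧ℕ)         ≡⟨ cong (λ z → - (z + ⟦ n ⟧ℕ)) (+-comm _ _) ⟩
      - (⟦ suc m ⟧ℕ + 1# + ⟦ n ⟧ℕ)         ≡⟨ cong -_ (+-assoc _ _ _) ⟩
      - (⟦ suc m ⟧ℕ + (1# + ⟦ n ⟧ℕ))       ≡⟨ cong (λ z → - (⟦ suc m ⟧ℕ + z)) (⟦suc⟧ n) ⟨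
      - (⟦ suc m ⟧ℕ + ⟦ suc n ⟧ℕ)          ≡⟨ -‿+-comm _ _ ⟨
      - ⟦ suc m ⟧ℕ + - ⟦ suc n ⟧ℕ          ∎

    ⟦-◃⟧ : ∀ n → ⟦ Sign.- ◃ n ⟧ℤ ≡ - ⟦ n ⟧ℕ
    ⟦-◃⟧ zero = sym -0#≈0#
    ⟦-◃⟧ (suc n) = refl

    ⟦+◃⟧ : ∀ n → ⟦ Sign.+ ◃ n ⟧ℤ ≡ ⟦ n ⟧ℕ
    ⟦+◃⟧ zero = refl
    ⟦+◃⟧ (suc n) = refl

    ⟦*⟧ℤ : ∀ i j → ⟦ i ℤ.* j ⟧ℤ ≡ ⟦ i ⟧ℤ * ⟦ j ⟧ℤ
    ⟦*⟧ℤ (ℤ.+ m) (ℤ.+ n) = trans (⟦+◃⟧ (m ℕ.* n)) (⟦*⟧ m n)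
    ⟦*⟧ℤ (ℤ.+ m) -[1+ n ] =
      trans (⟦-◃⟧ (m ℕ.* suc n)) (trans (cong -_ (⟦*⟧ m (suc n))) (-‿distribʳ-* _ _))
    ⟦*⟧ℤ -[1+ m ] (ℤ.+ n) =
      trans (⟦-◃⟧ (suc m ℕ.* n)) (trans (cong -_ (⟦*⟧ (suc m) n)) (-‿distribˡ-* _ _))
    ⟦*⟧ℤ -[1+ m ] -[1+ n ] = begin
      ⟦ suc m ℕ.* suc n ⟧ℕ           ≡⟨ ⟦*⟧ (suc m) (suc n) ⟩
      ⟦ suc m ⟧ℕ * ⟦ suc n ⟧ℕ        ≡⟨ -‿involutive _ ⟨
      - - (⟦ suc m ⟧ℕ * ⟦ suc n ⟧ℕ)  ≡⟨ cong -_ (-‿distribʳ-* _ _) ⟩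
      - (⟦ suc m ⟧ℕ * - ⟦ suc n ⟧ℕ)  ≡⟨ -‿distribˡ-* _ _ ⟩
      - ⟦ suc m ⟧ℕ * - ⟦ suc n ⟧ℕ    ∎

    almostCommutativeRing : AlmostCommutativeRing 0ℓ 0ℓ
    almostCommutativeRing = fromCommutativeRing commutativeRing

    -- Integer coefficients have decidable equality, so the solver can collect and cancel terms; the
    -- identities obtained hold in every characteristic.
    morphism : ℤ.+-*-rawRing -Raw-AlmostCommutative⟶ almostCommutativeRing
    morphism = record
      { ⟦_⟧ = ⟦_⟧ℤ ; +-homo = ⟦+⟧ℤ ; *-homo = ⟦*⟧ℤ ; -‿homo = ⟦-⟧ ; 0-homo = refl ; 1-homo = refl }

  open RingSolver ℤ.+-*-rawRing almostCommutativeRing morphism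
    (λ i j → Maybe.map (cong ⟦_⟧ℤ) (dec⇒maybe (i ℤ.≟ j))) public
    using (solve; prove; _:=_; _:+_; _:*_; :-_; con; var; Polynomial)

  :0 :1 : ∀ {n} → Polynomial n
  :0 = con (ℤ.+ 0)
  :1 = con (ℤ.+ 1)

  infix 8 _⁻¹
  -- Total, with value 0 at 0, so that a quotient can be written down before its denominator is
  -- known to be nonzero.
  _⁻¹ : K → K
  x ⁻¹ with x ≟ 0#
  ... | yes _ = 0#
  ... | no x≢0 = proj₁ (inverse x x≢0)

  ⁻¹-inverseʳ : ∀ {x} → x ≢ 0# → x * x ⁻¹ ≡ 1#
  ⁻¹-inverseʳ {x} x≢0 with x ≟ 0#
  ... | yes x≡0 = ⊥-elim (x≢0 x≡0)
  ... | no x≢0′ = proj₂ (inverse x x≢0′)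

  ⁻¹-inverseˡ : ∀ {x} → x ≢ 0# → x ⁻¹ * x ≡ 1#
  ⁻¹-inverseˡ x≢0 = trans (*-comm _ _) (⁻¹-inverseʳ x≢0)

  *-cancelˡ : ∀ {x y z} → x ≢ 0# → x * y ≡ x * z → y ≡ z
  *-cancelˡ {x} {y} {z} x≢0 e = begin
    y               ≡⟨ lemma y ⟩
    x ⁻¹ * (x * y)  ≡⟨ cong (x ⁻¹ *_) e ⟩
    x ⁻¹ * (x * z)  ≡⟨ lemma z ⟨
    z               ∎
    where
    lemma : ∀ w → w ≡ x ⁻¹ * (x * w)
    lemma w = sym (trans (sym (*-assoc _ _ _)) (trans (cong (_* w) (⁻¹-inverseˡ x≢0)) (*-identityˡ w)))

  xy≡0⇒y≡0 : ∀ {x y} → x ≢ 0# → x * y ≡ 0# → y ≡ 0#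
  xy≡0⇒y≡0 x≢0 e = *-cancelˡ x≢0 (trans e (sym (zeroʳ _)))

  xy≡0⇒x≡0 : ∀ {x y} → y ≢ 0# → x * y ≡ 0# → x ≡ 0#
  xy≡0⇒x≡0 y≢0 e = xy≡0⇒y≡0 y≢0 (trans (*-comm _ _) e)

  integral : ∀ {x y} → x * y ≡ 0# → x ≡ 0# ⊎ y ≡ 0#
  integral {x} e with x ≟ 0#
  ... | yes x≡0 = inj₁ x≡0
  ... | no x≢0 = inj₂ (xy≡0⇒y≡0 x≢0 e)

  *-≢0 : ∀ {x y} → x ≢ 0# → y ≢ 0# → x * y ≢ 0#
  *-≢0 x≢0 y≢0 e = y≢0 (xy≡0⇒y≡0 x≢0 e)

  ≢0-factorˡ : ∀ {x y} → x * y ≢ 0# → x ≢ 0#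
  ≢0-factorˡ xy≢0 refl = xy≢0 (zeroˡ _)

  ≢0-factorʳ : ∀ {x y} → x * y ≢ 0# → y ≢ 0#
  ≢0-factorʳ xy≢0 refl = xy≢0 (zeroʳ _)

  ⁻¹-≢0 : ∀ {x} → x ≢ 0# → x ⁻¹ ≢ 0#
  ⁻¹-≢0 x≢0 e = 0≢1 (trans (sym (zeroʳ _)) (trans (cong (_ *_) (sym e)) (⁻¹-inverseʳ x≢0)))

  1≢0 : 1# ≢ 0#
  1≢0 e = 0≢1 (sym e)

  x-y≡0⇒x≡y : ∀ {x y} → x + - y ≡ 0# → x ≡ y
  x-y≡0⇒x≡y {x} {y} e = begin
    x              ≡⟨ solve 2 (λ x y → x := (x :+ :- y) :+ y) refl x y ⟩
    x + - y + y    ≡⟨ cong (_+ y) e ⟩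
    0# + y         ≡⟨ +-identityˡ y ⟩
    y              ∎

  -≢0 : ∀ {x} → x ≢ 0# → - x ≢ 0#
  -≢0 {x} x≢0 e = x≢0 (trans (sym (-‿involutive x)) (trans (cong -_ e) -0#≈0#))

  sum≡0 : ∀ {x y} → x ≡ 0# → y ≡ 0# → x + y ≡ 0#
  sum≡0 refl refl = +-identityˡ 0#

  scale≡0 : ∀ k {x} → x ≡ 0# → k * x ≡ 0#
  scale≡0 k refl = zeroʳ k

-- Binomial coefficients modulo a prime

prime∣k!⇒≤ : ∀ {p} → Prime p → ∀ k → p ∣ k ! → p ℕ.≤ k
prime∣k!⇒≤ {p} pr zero p∣1 = ⊥-elim (¬prime[1] (subst Prime (ℕ.≤-antisym (∣⇒≤ p∣1) (ℕ.>-nonZero⁻¹ p {{prime⇒nonZero pr}})) pr))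
prime∣k!⇒≤ pr (suc k) p∣ with euclidsLemma (suc k) (k !) pr p∣
... | inj₁ p∣suc = ∣⇒≤ p∣suc
... | inj₂ p∣k! = ℕ.m≤n⇒m≤1+n (prime∣k!⇒≤ pr k p∣k!)

-- In p! = C(p,k) k! (p-k)! the prime p divides the left-hand side, but not the factorial of a
-- number below p.
prime∣pCk : ∀ {p} → Prime p → ∀ k → k ≢ 0 → k ℕ.< p → p ∣ p choose k
prime∣pCk {p} pr k k≢0 k<p with euclidsLemma (p choose k) (k ! ℕ.* (p ℕ.∸ k) !) pr p∣prod
  where
  instance _ = ℕ.m*n≢0 (k !) ((p ℕ.∸ k) !) {{k ℕ.!≢0}} {{(p ℕ.∸ k) ℕ.!≢0}}
  instance _ = prime⇒nonZero pr
  p! : (p choose k) ℕ.* (k ! ℕ.* (p ℕ.∸ k) !) ≡ p !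
  p! = trans (cong (ℕ._* (k ! ℕ.* (p ℕ.∸ k) !)) (nCk≡n!/k![n-k]! (ℕ.<⇒≤ k<p)))
             (m/n*n≡m (k![n∸k]!∣n! (ℕ.<⇒≤ k<p)))
  p∣prod : p ∣ (p choose k) ℕ.* (k ! ℕ.* (p ℕ.∸ k) !)
  p∣prod = subst (p ∣_) (sym (trans p! (cong _! (sym (ℕ.suc-pred p)))))
             (subst (_∣ suc (ℕ.pred p) !) (ℕ.suc-pred p) (m∣m*n (ℕ.pred p !)))
... | inj₁ p∣C = p∣C
... | inj₂ p∣kk with euclidsLemma (k !) ((p ℕ.∸ k) !) pr p∣kk
...   | inj₁ p∣k! = ⊥-elim (ℕ.<⇒≱ k<p (prime∣k!⇒≤ pr k p∣k!))
...   | inj₂ p∣ = ⊥-elim (ℕ.<⇒≱ (ℕ.∸-monoʳ-< (ℕ.n≢0⇒n>0 k≢0) (ℕ.<⇒≤ k<p)) (prime∣k!⇒≤ pr (p ℕ.∸ k) p∣))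

-- Powers, additivity of the p-th power, and x^order = x

module Powers (𝔽 : FiniteField) (q : ℕ) where
  open FieldTheory 𝔽
  open Geometry 𝔽 q using (_^_)
  open ≡-Reasoning

  ^-+ : ∀ x m n → x ^ (m ℕ.+ n) ≡ x ^ m * x ^ n
  ^-+ x zero n = sym (*-identityˡ _)
  ^-+ x (suc m) n = trans (cong (x *_) (^-+ x m n)) (sym (*-assoc _ _ _))

  ^-distrib-* : ∀ x y n → (x * y) ^ n ≡ x ^ n * y ^ n
  ^-distrib-* x y zero = sym (*-identityˡ _)
  ^-distrib-* x y (suc n) = trans (cong ((x * y) *_) (^-distrib-* x y n))
    (solve 4 (λ x y a b → x :* y :* (a :* b) := x :* a :* (y :* b)) refl x y (x ^ n) (y ^ n))

  1^n≡1 : ∀ n → 1# ^ n ≡ 1#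
  1^n≡1 zero = refl
  1^n≡1 (suc n) = trans (*-identityˡ _) (1^n≡1 n)

  ^-* : ∀ x m n → x ^ (m ℕ.* n) ≡ (x ^ m) ^ n
  ^-* x zero n = sym (1^n≡1 n)
  ^-* x (suc m) n = trans (^-+ x n (m ℕ.* n))
    (trans (cong (x ^ n *_) (^-* x m n)) (sym (^-distrib-* x (x ^ m) n)))

  x^1≡x : ∀ x → x ^ 1 ≡ x
  x^1≡x = *-identityʳ

  0^n≡0 : ∀ n → .{{ℕ.NonZero n}} → 0# ^ n ≡ 0#
  0^n≡0 (suc n) = zeroˡ _

  x^n≡0⇒x≡0 : ∀ {x} n → x ^ n ≡ 0# → x ≡ 0#
  x^n≡0⇒x≡0 zero e = ⊥-elim (1≢0 e)
  x^n≡0⇒x≡0 (suc n) e with integral e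
  ... | inj₁ x≡0 = x≡0
  ... | inj₂ x^n≡0 = x^n≡0⇒x≡0 n x^n≡0

  open Exp semiring using () renaming (_^_ to _^ₛ_)
  open Mult semiring using () renaming (_×_ to _×ₛ_)
  open Sum semiring using (sum; sum-init-last; sum-cong-≗; sum-replicate-zero)

  private
    ^≡^ₛ : ∀ x n → x ^ n ≡ x ^ₛ n
    ^≡^ₛ x zero = refl
    ^≡^ₛ x (suc n) = cong (x *_) (^≡^ₛ x n)

    ×ₛ≡⟦⟧* : ∀ n x → n ×ₛ x ≡ ⟦ n ⟧ℕ * x
    ×ₛ≡⟦⟧* zero x = sym (zeroˡ x)
    ×ₛ≡⟦⟧* (suc n) x = begin
      x + n ×ₛ x              ≡⟨ cong₂ _+_ (sym (*-identityˡ x)) (×ₛ≡⟦⟧* n x) ⟩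
      1# * x + ⟦ n ⟧ℕ * x     ≡⟨ distribʳ _ _ _ ⟨
      (1# + ⟦ n ⟧ℕ) * x       ≡⟨ cong (_* x) (⟦suc⟧ n) ⟨
      ⟦ suc n ⟧ℕ * x          ∎

    ∣-vanish : ∀ {p n} → ⟦ p ⟧ℕ ≡ 0# → p ∣ n → ∀ x → n ×ₛ x ≡ 0#
    ∣-vanish {p} {n} p≡0 (divides k refl) x = begin
      (k ℕ.* p) ×ₛ x       ≡⟨ ×ₛ≡⟦⟧* (k ℕ.* p) x ⟩
      ⟦ k ℕ.* p ⟧ℕ * x     ≡⟨ cong (_* x) (trans (⟦*⟧ k p) (trans (cong (⟦ k ⟧ℕ *_) p≡0) (zeroʳ _))) ⟩
      0# * x               ≡⟨ zeroˡ x ⟩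
      0#                   ∎

  -- The binomial sum is cut into its first term y^p, its last term x^p and the terms between them,
  -- whose coefficients are multiples of p and vanish in K.
  freshman : ∀ {p} → Prime p → ⟦ p ⟧ℕ ≡ 0# → ∀ x y → (x + y) ^ p ≡ x ^ p + y ^ p
  freshman {p@(suc p′)} pr p≡0 x y = begin
    (x + y) ^ p                                          ≡⟨ ^≡^ₛ (x + y) p ⟩
    (x + y) ^ₛ p                                         ≡⟨ theorem p x y ⟩
    t Fin.zero + sum (λ i → t (Fin.suc i))               ≡⟨ cong₂ _+_ first (sum-init-last (λ i → t (Fin.suc i))) ⟩
    y ^ p + (sum (λ i → t (Fin.suc (Fin.inject₁ i))) + t (Fin.suc (Fin.fromℕ p′)))
      ≡⟨ cong (λ z → y ^ p + (z + t (Fin.suc (Fin.fromℕ p′)))) (trans (sum-cong-≗ middle) (sum-replicate-zero p′)) ⟩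
    y ^ p + (0# + t (Fin.suc (Fin.fromℕ p′)))            ≡⟨ cong (y ^ p +_) (trans (+-identityˡ _) last) ⟩
    y ^ p + x ^ p                                        ≡⟨ +-comm _ _ ⟩
    x ^ p + y ^ p                                        ∎
    where
    open Binomial commutativeSemiring using (binomialTerm; theorem)
    t : Fin.Fin (suc p) → K
    t = binomialTerm x y p
    first : t Fin.zero ≡ y ^ p
    first = trans (×ₛ≡⟦⟧* 1 _) (trans (*-identityˡ _) (trans (*-identityˡ _) (sym (^≡^ₛ y p))))
    middle : ∀ (i : Fin.Fin p′) → t (Fin.suc (Fin.inject₁ i)) ≡ 0#
    middle i = ∣-vanish p≡0 (prime∣pCk pr _ (λ ()) (ℕ.s<s (subst (ℕ._< p′) (sym (Fin.toℕ-inject₁ i)) (Fin.toℕ<n i)))) _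
    -- The index of the last term equals p only propositionally, so it is generalised to a variable
    -- before matching on the equation.
    top : ∀ k → k ≡ p → (p choose k) ×ₛ (x ^ₛ k * y ^ₛ (p ℕ.∸ k)) ≡ x ^ p
    top k refl = begin
      (p choose p) ×ₛ (x ^ₛ p * y ^ₛ (p ℕ.∸ p))   ≡⟨ cong₂ (λ m n → m ×ₛ (x ^ₛ p * y ^ₛ n)) (nCn≡1 p) (ℕ.n∸n≡0 p) ⟩
      1 ×ₛ (x ^ₛ p * 1#)                     ≡⟨ trans (×ₛ≡⟦⟧* 1 _) (*-identityˡ _) ⟩
      x ^ₛ p * 1#                            ≡⟨ trans (*-identityʳ _) (sym (^≡^ₛ x p)) ⟩
      x ^ p                                  ∎
    last : t (Fin.suc (Fin.fromℕ p′)) ≡ x ^ p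
    last = top _ (cong suc (Fin.toℕ-fromℕ p′))

  private
    sumL prodL : List K → K
    sumL = foldr _+_ 0#
    prodL = foldr _*_ 1#

    sumL-↭ : ∀ {xs ys} → xs ↭ ys → sumL xs ≡ sumL ys
    sumL-↭ p = Permutation.foldr-commMonoid (setoid K) (+-isCommutativeMonoid) (↭⇒↭ₛ p)
      where open CommutativeMonoid +-commutativeMonoid using () renaming (isCommutativeMonoid to +-isCommutativeMonoid)

    prodL-↭ : ∀ {xs ys} → xs ↭ ys → prodL xs ≡ prodL ys
    prodL-↭ p = Permutation.foldr-commMonoid (setoid K) (*-isCommutativeMonoid) (↭⇒↭ₛ p)
      where open CommutativeMonoid *-commutativeMonoid using () renaming (isCommutativeMonoid to *-isCommutativeMonoid)

    -- Two lists without repetitions and with the same members are permutations of each other, and a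
    -- bijection preserves both properties of `elements`.
    map-elements-↭ : (f g : K → K) → (∀ {x y} → f x ≡ f y → x ≡ y) → (∀ x → f (g x) ≡ x) →
                     map f elements ↭ elements
    map-elements-↭ f g inj fg = ∼bag⇒↭ (unique∧set⇒bag (Unique.map⁺ inj elements-unique) elements-unique
      (mk⇔ (λ _ → elements-complete _) (λ _ → subst (_∈ map f elements) (fg _) (∈-map⁺ f (elements-complete (g _))))))

    sumL-shift : ∀ xs → sumL (map (1# +_) xs) ≡ ⟦ length xs ⟧ℕ + sumL xs
    sumL-shift [] = sym (+-identityˡ _)
    sumL-shift (x ∷ xs) = begin
      1# + x + sumL (map (1# +_) xs)             ≡⟨ cong (1# + x +_) (sumL-shift xs) ⟩
      1# + x + (⟦ length xs ⟧ℕ + sumL xs)        ≡⟨ solve 4 (λ i x n s → i :+ x :+ (n :+ s) := i :+ n :+ (x :+ s)) refl 1# x _ _ ⟩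
      1# + ⟦ length xs ⟧ℕ + (x + sumL xs)        ≡⟨ cong (_+ (x + sumL xs)) (⟦suc⟧ (length xs)) ⟨
      ⟦ suc (length xs) ⟧ℕ + (x + sumL xs)       ∎

    prodL-scale : ∀ a xs → prodL (map (a *_) xs) ≡ a ^ length xs * prodL xs
    prodL-scale a [] = sym (*-identityˡ _)
    prodL-scale a (x ∷ xs) = trans (cong (a * x *_) (prodL-scale a xs))
      (solve 4 (λ a x n s → a :* x :* (n :* s) := a :* n :* (x :* s)) refl a x _ _)

    prodL-≢0 : ∀ {xs} → All (_≢ 0#) xs → prodL xs ≢ 0#
    prodL-≢0 [] = 1≢0
    prodL-≢0 (x≢0 ∷ xs≢0) = *-≢0 x≢0 (prodL-≢0 xs≢0)

  -- Translation by 1 permutes the field, so the sum of all elements equals itself plus `order`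
  -- copies of 1. This is the source of the characteristic.
  ⟦order⟧≡0 : ⟦ order ⟧ℕ ≡ 0#
  ⟦order⟧≡0 = begin
    ⟦ order ⟧ℕ                                            ≡⟨ solve 2 (λ n s → n := n :+ s :+ :- s) refl _ (sumL elements) ⟩
    ⟦ order ⟧ℕ + sumL elements + - sumL elements          ≡⟨ cong (_+ - sumL elements) (sumL-shift elements) ⟨
    sumL (map (1# +_) elements) + - sumL elements         ≡⟨ cong (_+ - sumL elements) (sumL-↭ shift↭) ⟩
    sumL elements + - sumL elements                       ≡⟨ -‿inverseʳ _ ⟩
    0#                                                    ∎
    where
    shift↭ : map (1# +_) elements ↭ elements
    shift↭ = map-elements-↭ (1# +_) (- 1# +_)
      (λ {x} {y} e → trans (solve 2 (λ i x → x := :- i :+ (i :+ x)) refl 1# x)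
        (trans (cong (- 1# +_) e) (solve 2 (λ i y → :- i :+ (i :+ y) := y) refl 1# y)))
      (λ x → solve 2 (λ i x → i :+ (:- i :+ x) := x) refl 1# x)

  -- Multiplication by x permutes the nonzero elements, so x^(order-1) fixes their product.
  x^order≡x : ∀ x → x ^ order ≡ x
  x^order≡x x with x ≟ 0#
  ... | yes refl = 0^n≡0 order {{nz elements (elements-complete 0#)}}
    where
    nz : ∀ (xs : List K) → 0# ∈ xs → ℕ.NonZero (length xs)
    nz (_ ∷ _) _ = _
  ... | no x≢0 with ∈-∃++ (elements-complete 0#)
  ...   | ys , zs , split = begin
    x ^ order             ≡⟨ cong (x ^_) order≡ ⟩
    x * x ^ length rest   ≡⟨ cong (x *_) (*-cancelˡ (prodL-≢0 rest≢0) step) ⟩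
    x * 1#                ≡⟨ *-identityʳ x ⟩
    x                     ∎
    where
    rest = ys ++ zs
    elements↭ : elements ↭ 0# ∷ rest
    elements↭ = ↭-trans (↭-reflexive split) (shift 0# ys zs)
    order≡ : order ≡ suc (length rest)
    order≡ = ↭-length elements↭
    unique-split : Unique (0# ∷ rest)
    unique-split = Permutation.Unique-resp-↭ (setoid K) (↭⇒↭ₛ elements↭) elements-unique
    rest≢0 : All (_≢ 0#) rest
    rest≢0 = All.map (λ 0≢x x≡0 → 0≢x (sym x≡0)) (AllPairs.head unique-split)
    scale↭ : map (x *_) elements ↭ elements
    scale↭ = map-elements-↭ (x *_) (x ⁻¹ *_) (*-cancelˡ x≢0)
      (λ y → trans (sym (*-assoc _ _ _)) (trans (cong (_* y) (⁻¹-inverseʳ x≢0)) (*-identityˡ y)))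
    -- Since x * 0 = 0, the element 0 heads both lists and can be struck out.
    rest↭ : map (x *_) rest ↭ rest
    rest↭ = drop-∷ (↭-trans (↭-reflexive (cong (_∷ map (x *_) rest) (sym (zeroʳ x))))
      (↭-trans (↭-sym (map⁺ (x *_) elements↭)) (↭-trans scale↭ elements↭)))
    step : prodL rest * x ^ length rest ≡ prodL rest * 1#
    step = begin
      prodL rest * x ^ length rest   ≡⟨ *-comm _ _ ⟩
      x ^ length rest * prodL rest   ≡⟨ prodL-scale x rest ⟨
      prodL (map (x *_) rest)        ≡⟨ prodL-↭ rest↭ ⟩
      prodL rest                     ≡⟨ *-identityʳ _ ⟨
      prodL rest * 1#                ∎

-- Counting roots; multilinear polynomials in conjugate powers

module Polynomials (𝔽 : FiniteField) (q : ℕ) where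
  open FieldTheory 𝔽
  open Geometry 𝔽 q using (_^_)
  open Powers 𝔽 q
  open ≡-Reasoning

  eval : List K → K → K
  eval [] x = 0#
  eval (c ∷ cs) x = c + x * eval cs x

  -- Synthetic division by x - a: the coefficients of the quotient are the intermediate values of
  -- Horner's scheme at a.
  quot : K → List K → List K
  quot a [] = []
  quot a (c ∷ []) = []
  quot a (c ∷ cs@(_ ∷ _)) = eval cs a ∷ quot a cs

  LeadingZero : List K → Set
  LeadingZero [] = ⊤
  LeadingZero (c ∷ []) = c ≡ 0#
  LeadingZero (c ∷ cs@(_ ∷ _)) = LeadingZero cs

  private
    eval-quot : ∀ a cs x → eval cs x ≡ eval cs a + (x + - a) * eval (quot a cs) x
    eval-quot a [] x = sym (trans (+-identityˡ _) (zeroʳ _))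
    eval-quot a (c ∷ []) x =
      solve 3 (λ a c x → c :+ x :* :0 := c :+ a :* :0 :+ (x :+ :- a) :* :0) refl a c x
    eval-quot a (c ∷ cs@(_ ∷ _)) x = begin
      c + x * eval cs x                                           ≡⟨ cong (λ z → c + x * z) (eval-quot a cs x) ⟩
      c + x * (eval cs a + (x + - a) * eval (quot a cs) x)
        ≡⟨ solve 5 (λ a c x e f → c :+ x :* (e :+ (x :+ :- a) :* f)
                    := c :+ a :* e :+ (x :+ :- a) :* (e :+ x :* f)) refl a c x _ _ ⟩
      c + a * eval cs a + (x + - a) * (eval cs a + x * eval (quot a cs) x)   ∎

    length-quot : ∀ a c cs → length (quot a (c ∷ cs)) ≡ length cs
    length-quot a c [] = refl
    length-quot a c (d ∷ cs) = cong suc (length-quot a d cs)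

    leading-quot : ∀ a cs → LeadingZero cs → LeadingZero (quot a cs)
    leading-quot a [] l = tt
    leading-quot a (c ∷ []) l = tt
    leading-quot a (c ∷ d ∷ []) l = trans (cong (_+ a * 0#) l) (trans (+-identityˡ _) (zeroʳ a))
    leading-quot a (c ∷ cs@(_ ∷ _ ∷ _)) l = leading-quot a cs l

    vanish : ∀ {a} cs → All (_≡ 0#) cs → eval cs a ≡ 0#
    vanish [] _ = refl
    vanish {a} (c ∷ cs) (c≡0 ∷ cs≡0) =
      trans (cong₂ (λ u v → u + a * v) c≡0 (vanish cs cs≡0)) (trans (+-identityˡ _) (zeroʳ a))

    quot-zero : ∀ a c cs → All (_≡ 0#) (quot a (c ∷ cs)) → All (_≡ 0#) cs
    quot-zero a c [] z = []
    quot-zero a c (d ∷ cs) (e≡0 ∷ z) with quot-zero a d cs z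
    ... | cs≡0 = trans (sym (trans (cong (λ w → d + a * w) (vanish cs cs≡0))
                   (trans (cong (d +_) (zeroʳ a)) (+-identityʳ d)))) e≡0 ∷ cs≡0

  -- The leading coefficient is allowed to be zero, which saves one root.
  roots-leading : ∀ cs xs → LeadingZero cs → length cs ℕ.≤ suc (length xs) → Unique xs →
                  All (λ x → eval cs x ≡ 0#) xs → All (_≡ 0#) cs
  roots-leading [] xs _ _ _ _ = []
  roots-leading (c ∷ []) xs c≡0 _ _ _ = c≡0 ∷ []
  roots-leading (c ∷ d ∷ cs) [] _ (s≤s ()) _ _
  roots-leading cs@(c ∷ cs′@(_ ∷ _)) (a ∷ xs) l (s≤s le) (a∉xs ∷ uniq) (ra ∷ rs) = c≡0 ∷ cs′≡0
    where
    quotient-root : ∀ {x} → a ≢ x → eval cs x ≡ 0# → eval (quot a cs) x ≡ 0#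
    quotient-root {x} a≢x e = xy≡0⇒y≡0 (λ z → a≢x (sym (x-y≡0⇒x≡y z)))
      (trans (sym (+-identityˡ _)) (trans (cong (_+ (x + - a) * eval (quot a cs) x) (sym ra)) (trans (sym (eval-quot a cs x)) e)))
    cs′≡0 : All (_≡ 0#) cs′
    cs′≡0 = quot-zero a c cs′ (roots-leading (quot a cs) xs (leading-quot a cs l)
      (subst (ℕ._≤ suc (length xs)) (sym (length-quot a c cs′)) le) uniq
      (All.zipWith (λ (a≢x , e) → quotient-root a≢x e) (a∉xs , rs)))
    c≡0 : c ≡ 0#
    c≡0 = trans (solve 2 (λ c a → c := c :+ a :* :0) refl c a)
      (trans (cong (λ z → c + a * z) (sym (vanish cs′ cs′≡0))) ra)

  eval-++ : ∀ cs ds x → eval (cs ++ ds) x ≡ eval cs x + x ^ length cs * eval ds x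
  eval-++ [] ds x = sym (trans (+-identityˡ _) (*-identityˡ _))
  eval-++ (c ∷ cs) ds x = trans (cong (λ z → c + x * z) (eval-++ cs ds x))
    (solve 5 (λ c x e p d → c :+ x :* (e :+ p :* d) := c :+ x :* e :+ x :* p :* d) refl c x _ _ _)

  eval-replicate-0 : ∀ n x → eval (replicate n 0#) x ≡ 0#
  eval-replicate-0 zero x = refl
  eval-replicate-0 (suc n) x = trans (+-identityˡ _) (trans (cong (x *_) (eval-replicate-0 n x)) (zeroʳ x))

  leadingZero-++0 : ∀ cs → LeadingZero (cs ++ 0# ∷ [])
  leadingZero-++0 [] = refl
  leadingZero-++0 (c ∷ []) = refl
  leadingZero-++0 (c ∷ cs@(_ ∷ _)) = leadingZero-++0 cs

  -- Appending a coefficient 0 meets the condition of `roots-leading` and costs exactly the root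
  -- that is saved there.
  roots : ∀ cs xs → length cs ℕ.≤ length xs → Unique xs → All (λ x → eval cs x ≡ 0#) xs → All (_≡ 0#) cs
  roots cs xs le uniq rs = All.++⁻ˡ cs (roots-leading (cs ++ 0# ∷ []) xs (leadingZero-++0 cs)
    (subst (ℕ._≤ suc (length xs)) (sym (trans (List.length-++ cs) (ℕ.+-comm (length cs) 1))) (s≤s le)) uniq
    (All.map (λ {x} e → trans (eval-++ cs (0# ∷ []) x)
      (trans (cong₂ (λ u v → u + x ^ length cs * v) e (trans (+-identityˡ _) (zeroʳ x))) (trans (+-identityˡ _) (zeroʳ _)))) rs))

  -- More than n roots would annihilate all coefficients of X^n - 1, among them the constant term
  -- -1.
  x^n≡1-roots : ∀ n → .{{ℕ.NonZero n}} → ∀ xs → Unique xs → All (λ x → x ^ n ≡ 1#) xs → length xs ℕ.≤ n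
  x^n≡1-roots n@(suc n′) xs uniq rs with length xs ℕ.≤? n
  ... | yes le = le
  ... | no ¬le = ⊥-elim (-≢0 1≢0 (All.head (roots cs xs
      (subst (ℕ._≤ length xs) (sym length-cs) (ℕ.≰⇒> ¬le)) uniq
      (All.map (λ {x} e → trans (eval-cs x) (trans (cong (- 1# +_) e) (-‿inverseˡ 1#))) rs))))
    where
    cs = - 1# ∷ replicate n′ 0# ++ 1# ∷ []
    length-cs : length cs ≡ suc n
    length-cs = cong suc (trans (List.length-++ (replicate n′ 0#))
      (trans (cong (ℕ._+ 1) (List.length-replicate n′)) (ℕ.+-comm n′ 1)))
    eval-cs : ∀ x → eval cs x ≡ - 1# + x ^ n
    eval-cs x = cong (λ z → - 1# + x * z) (begin
      eval (replicate n′ 0# ++ 1# ∷ []) x                            ≡⟨ eval-++ (replicate n′ 0#) _ x ⟩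
      eval (replicate n′ 0#) x + x ^ length (replicate n′ 0#) * (1# + x * 0#)
        ≡⟨ cong₂ (λ u v → u + x ^ v * (1# + x * 0#)) (eval-replicate-0 n′ x) (List.length-replicate n′) ⟩
      0# + x ^ n′ * (1# + x * 0#)   ≡⟨ solve 2 (λ p x → :0 :+ p :* (:1 :+ x :* :0) := p) refl (x ^ n′) x ⟩
      x ^ n′                        ∎)

  -- A multilinear polynomial in m 0, …, m (n - 1); the first Boolean belongs to m (n - 1).
  multilinear : ∀ (n : ℕ) → (List Bool → K) → (ℕ → K) → K
  multilinear zero c m = c []
  multilinear (suc i) c m = multilinear i (c ∘ (false ∷_)) m + m i * multilinear i (c ∘ (true ∷_)) m

  multilinear-- : ∀ (n : ℕ) (c d : List Bool → K) (m : ℕ → K) → multilinear n (λ bs → c bs + - d bs) m ≡ multilinear n c m + - multilinear n d m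
  multilinear-- zero c d m = refl
  multilinear-- (suc i) c d m = trans (cong₂ (λ u v → u + m i * v) (multilinear-- i _ _ m) (multilinear-- i _ _ m))
    (solve 5 (λ m a b c d → a :+ :- b :+ m :* (c :+ :- d) := a :+ m :* c :+ :- (b :+ m :* d)) refl (m i) _ _ _ _)

  module Multilinear (2≤q : 2 ℕ.≤ q) where

    private
      pad : ℕ → List K → List K
      pad n cs = cs ++ replicate (n ℕ.∸ length cs) 0#

      length-pad : ∀ n cs → length cs ℕ.≤ n → length (pad n cs) ≡ n
      length-pad n cs le = trans (List.length-++ cs) (trans (cong (length cs ℕ.+_) (List.length-replicate _)) (ℕ.m+[n∸m]≡n le))

      eval-pad : ∀ n cs x → eval (pad n cs) x ≡ eval cs x
      eval-pad n cs x = trans (eval-++ cs _ x) (trans (cong (λ z → eval cs x + x ^ length cs * z) (eval-replicate-0 (n ℕ.∸ length cs) x))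
        (solve 2 (λ e p → e :+ p :* :0 := e) refl _ _))

    -- Substituting x^(q^i) for m i sends a monomial to a power of x whose exponent has base-q
    -- digits 0 and 1. As q ≥ 2, different monomials get different exponents, so every coefficient
    -- survives in its own place. Padding to length q^i moves the half multiplied by m i up to
    -- degree q^i.
    dense : ∀ (n : ℕ) → (List Bool → K) → List K
    dense zero c = c [] ∷ []
    dense (suc i) c = pad (q ℕ.^ i) (dense i (c ∘ (false ∷_))) ++ dense i (c ∘ (true ∷_))

    -- One more than the degree q^(n-1) + ... + q + 1, that is, the number of coefficients.
    size : ℕ → ℕ
    size zero = 1
    size (suc i) = q ℕ.^ i ℕ.+ size i

    -- This makes the lower half fit below degree q^i; the induction rests on 2 q^i ≤ q^(i+1).
    size-≤ : ∀ i → size i ℕ.≤ q ℕ.^ i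
    size-≤ zero = ℕ.≤-refl
    size-≤ (suc i) = ℕ.≤-trans (ℕ.+-monoʳ-≤ (q ℕ.^ i) (size-≤ i))
      (subst (ℕ._≤ q ℕ.* q ℕ.^ i) (cong (q ℕ.^ i ℕ.+_) (ℕ.+-identityʳ (q ℕ.^ i))) (ℕ.*-monoˡ-≤ (q ℕ.^ i) 2≤q))

    length-dense : ∀ (n : ℕ) (c : List Bool → K) → length (dense n c) ≡ size n
    length-dense zero c = refl
    length-dense (suc i) c = trans (List.length-++ (pad (q ℕ.^ i) (dense i (c ∘ (false ∷_)))))
      (cong₂ ℕ._+_ (length-pad _ (dense i (c ∘ (false ∷_))) (subst (ℕ._≤ q ℕ.^ i) (sym (length-dense i _)) (size-≤ i))) (length-dense i _))

    eval-dense : ∀ (n : ℕ) (c : List Bool → K) x → eval (dense n c) x ≡ multilinear n c (λ i → x ^ (q ℕ.^ i))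
    eval-dense zero c x = trans (cong (c [] +_) (zeroʳ x)) (+-identityʳ _)
    eval-dense (suc i) c x = trans (eval-++ (pad (q ℕ.^ i) (dense i (c ∘ (false ∷_)))) _ x)
      (cong₂ _+_ (trans (eval-pad (q ℕ.^ i) (dense i _) x) (eval-dense i _ x))
        (cong₂ (λ n z → x ^ n * z) (length-pad _ (dense i _) (subst (ℕ._≤ q ℕ.^ i) (sym (length-dense i _)) (size-≤ i))) (eval-dense i _ x)))

    dense-zero : ∀ (n : ℕ) (c : List Bool → K) → All (_≡ 0#) (dense n c) → ∀ bs → length bs ≡ n → c bs ≡ 0#
    dense-zero zero c (z ∷ []) [] _ = z
    dense-zero (suc i) c z (false ∷ bs) refl = dense-zero i _ (All.++⁻ˡ (dense i _) (All.++⁻ˡ (pad _ (dense i _)) z)) bs refl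
    dense-zero (suc i) c z (true ∷ bs) refl = dense-zero i _ (All.++⁻ʳ (pad _ (dense i _)) z) bs refl

    leadingZero-++ : ∀ cs ds → LeadingZero ds → ds ≢ [] → LeadingZero (cs ++ ds)
    leadingZero-++ [] ds l _ = l
    leadingZero-++ (c ∷ []) [] l ne = ⊥-elim (ne refl)
    leadingZero-++ (c ∷ []) (_ ∷ _) l _ = l
    leadingZero-++ (c ∷ cs@(_ ∷ _)) ds l ne = leadingZero-++ cs ds l ne

    dense-leading : ∀ (n : ℕ) (c : List Bool → K) → c (replicate n true) ≡ 0# → LeadingZero (dense n c)
    dense-leading zero c z = z
    dense-leading (suc i) c z = leadingZero-++ (pad _ (dense i _)) _ (dense-leading i (c ∘ (true ∷_)) z) (nonempty i _)
      where
      nonempty : ∀ (n : ℕ) (c : List Bool → K) → dense n c ≢ []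
      nonempty n c e = ℕ.<⇒≢ (positive n) (sym (trans (sym (length-dense n c)) (cong length e)))
        where
        positive : ∀ n → 0 ℕ.< size n
        positive zero = s≤s z≤n
        positive (suc n) = ℕ.<-≤-trans (positive n) (ℕ.m≤n+m (size n) _)

    -- With the top coefficients equal, the difference has degree at most `size n` - 2, so `size n`
    -- - 1 common values force all coefficients to agree.
    multilinear-unique : ∀ (n : ℕ) (c d : List Bool → K) → c (replicate n true) ≡ d (replicate n true) →
      ∀ xs → Unique xs → size n ℕ.≤ suc (length xs) →
      All (λ x → multilinear n c (λ i → x ^ (q ℕ.^ i)) ≡ multilinear n d (λ i → x ^ (q ℕ.^ i))) xs →
      ∀ bs → length bs ≡ n → c bs ≡ d bs
    multilinear-unique n c d top xs uniq le eqs bs len = x-y≡0⇒x≡y (dense-zero n e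
      (roots-leading (dense n e) xs (dense-leading n e (trans (cong (_+ - d (replicate n true)) top) (-‿inverseʳ _)))
        (subst (ℕ._≤ suc (length xs)) (sym (length-dense n e)) le) uniq
        (All.map (λ {x} eq → trans (eval-dense n e x) (trans (multilinear-- n c d _)
          (trans (cong (_+ - multilinear n d (λ i → x ^ (q ℕ.^ i))) eq) (-‿inverseʳ _)))) eqs)) bs len)
      where
      e : List Bool → K
      e bs = c bs + - d bs

-- Linear independence of characters

module Characters (𝔽 : FiniteField) where
  open FieldTheory 𝔽
  open ≡-Reasoning

  Multiplicative : (K → K) → Set
  Multiplicative χ = ∀ x y → χ (x * y) ≡ χ x * χ y

  combination : ∀ {χs : List (K → K)} → All (λ _ → K) χs → K → K
  combination [] y = 0#
  combination {χ ∷ _} (c ∷ cs) y = c * χ y + combination cs y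

  -- Artin's argument: multiplying the argument by z and subtracting χ z times the relation removes χ.
  artin : ∀ {χ₀} → Multiplicative χ₀ → χ₀ 1# ≡ 1# → ∀ {χs} →
    All (λ χ → Multiplicative χ × ∃ λ z → χ₀ z ≢ χ z) χs →
    ∀ c₀ cs → (∀ y → c₀ * χ₀ y + combination {χs} cs y ≡ 0#) → c₀ ≡ 0#
  artin {χ₀} mult χ₀1 [] c₀ [] rel = begin
    c₀                    ≡⟨ solve 1 (λ c → c := c :* :1 :+ :0) refl c₀ ⟩
    c₀ * 1# + 0#          ≡⟨ cong (λ z → c₀ * z + 0#) χ₀1 ⟨
    c₀ * χ₀ 1# + 0#       ≡⟨ rel 1# ⟩
    0#                    ∎
  artin {χ₀} mult χ₀1 {χ ∷ χs} ((χ-mult , z , χ₀z≢χz) ∷ ps) c₀ (c ∷ cs) rel =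
    xy≡0⇒x≡0 (λ e → χ₀z≢χz (x-y≡0⇒x≡y e))
      (artin mult χ₀1 ps (c₀ * (χ₀ z + - χ z)) (twist cs) relation)
    where
    twist : ∀ {χs} → All (λ _ → K) χs → All (λ _ → K) χs
    twist {[]} [] = []
    twist {ψ ∷ _} (d ∷ ds) = d * (ψ z + - χ z) ∷ twist ds
    twisted : ∀ {χs} (ds : All (λ _ → K) χs) → All (λ χ → Multiplicative χ × ∃ λ z → χ₀ z ≢ χ z) χs → ∀ y →
      combination (twist ds) y ≡ combination ds (z * y) + - (χ z * combination ds y)
    twisted [] _ y = solve 1 (λ a → :0 := :0 :+ :- (a :* :0)) refl (χ z)
    twisted {ψ ∷ _} (d ∷ ds) ((ψ-mult , _) ∷ ms) y = begin
      d * (ψ z + - χ z) * ψ y + combination (twist ds) y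
        ≡⟨ cong (d * (ψ z + - χ z) * ψ y +_) (twisted ds ms y) ⟩
      d * (ψ z + - χ z) * ψ y + (combination ds (z * y) + - (χ z * combination ds y))
        ≡⟨ solve 6 (λ d a b u s t → d :* (a :+ :- b) :* u :+ (s :+ :- (b :* t))
              := d :* (a :* u) :+ s :+ :- (b :* (d :* u :+ t))) refl d (ψ z) (χ z) (ψ y) _ _ ⟩
      d * (ψ z * ψ y) + combination ds (z * y) + - (χ z * (d * ψ y + combination ds y))
        ≡⟨ cong (λ a → d * a + combination ds (z * y) + - (χ z * (d * ψ y + combination ds y))) (ψ-mult z y) ⟨
      d * ψ (z * y) + combination ds (z * y) + - (χ z * (d * ψ y + combination ds y)) ∎
    relation : ∀ y → c₀ * (χ₀ z + - χ z) * χ₀ y + combination (twist cs) y ≡ 0#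
    relation y = begin
      c₀ * (χ₀ z + - χ z) * χ₀ y + combination (twist cs) y
        ≡⟨ cong (c₀ * (χ₀ z + - χ z) * χ₀ y +_) (twisted cs ps y) ⟩
      c₀ * (χ₀ z + - χ z) * χ₀ y + (combination cs (z * y) + - (χ z * combination cs y))
        ≡⟨ solve 8 (λ c₀ a b u c w s t → c₀ :* (a :+ :- b) :* u :+ (s :+ :- (b :* t))
              := (c₀ :* (a :* u) :+ (c :* (b :* w) :+ s)) :+ :- (b :* (c₀ :* u :+ (c :* w :+ t))))
              refl c₀ (χ₀ z) (χ z) (χ₀ y) c (χ y) (combination cs (z * y)) (combination cs y) ⟩
      (c₀ * (χ₀ z * χ₀ y) + (c * (χ z * χ y) + combination cs (z * y))) + - (χ z * (c₀ * χ₀ y + (c * χ y + combination cs y)))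
        ≡⟨ cong₂ (λ a b → (c₀ * a + (c * b + combination cs (z * y))) + - (χ z * (c₀ * χ₀ y + (c * χ y + combination cs y))))
             (mult z y) (χ-mult z y) ⟨
      (c₀ * χ₀ (z * y) + (c * χ (z * y) + combination cs (z * y))) + - (χ z * (c₀ * χ₀ y + (c * χ y + combination cs y)))
        ≡⟨ cong₂ (λ a b → a + - (χ z * b)) (rel (z * y)) (rel y) ⟩
      0# + - (χ z * 0#)
        ≡⟨ solve 1 (λ a → :0 :+ :- (a :* :0) := :0) refl (χ z) ⟩
      0# ∎

-- Powers of the Frobenius map and the Galois group over 𝔽_q

module Frobenius (𝔽 : FiniteField) (q : ℕ) (q-pp : IsPrimePower q) (order≡ : FiniteField.order 𝔽 ≡ q ℕ.^ 5) where
  open FieldTheory 𝔽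
  open Geometry 𝔽 q using (_^_; InFq)
  open Powers 𝔽 q
  open Characters 𝔽
  open ≡-Reasoning

  private
    p k : ℕ
    p = proj₁ q-pp
    k = proj₁ (proj₂ q-pp)
    p-prime : Prime p
    p-prime = proj₁ (proj₂ (proj₂ q-pp))
    1≤k : 1 ℕ.≤ k
    1≤k = proj₁ (proj₂ (proj₂ (proj₂ q-pp)))
    q≡p^k : q ≡ p ℕ.^ k
    q≡p^k = proj₂ (proj₂ (proj₂ (proj₂ q-pp)))

  2≤q : 2 ℕ.≤ q
  2≤q = subst (2 ℕ.≤_) (sym q≡p^k) (ℕ.≤-trans (ℕ.nonTrivial⇒n>1 p {{prime⇒nonTrivial p-prime}})
    (subst (ℕ._≤ p ℕ.^ k) (ℕ.^-identityʳ p) (ℕ.^-monoʳ-≤ p {{prime⇒nonZero p-prime}} 1≤k)))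

  q≢0 : ℕ.NonZero q
  q≢0 = ℕ.>-nonZero (ℕ.<-≤-trans (s≤s z≤n) 2≤q)

  private
    ⟦^⟧ : ∀ m n → ⟦ m ℕ.^ n ⟧ℕ ≡ ⟦ m ⟧ℕ ^ n
    ⟦^⟧ m zero = refl
    ⟦^⟧ m (suc n) = trans (⟦*⟧ m (m ℕ.^ n)) (cong (⟦ m ⟧ℕ *_) (⟦^⟧ m n))

    -- The order q⁵ is a power of p and vanishes in K, which has no zero divisors.
    ⟦p⟧≡0 : ⟦ p ⟧ℕ ≡ 0#
    ⟦p⟧≡0 = x^n≡0⇒x≡0 k (trans (sym (⟦^⟧ p k)) (trans (cong ⟦_⟧ℕ (sym q≡p^k))
      (x^n≡0⇒x≡0 5 (trans (sym (⟦^⟧ q 5)) (trans (cong ⟦_⟧ℕ (sym order≡)) ⟦order⟧≡0)))))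

    p-power-additive : ∀ n x y → (x + y) ^ (p ℕ.^ n) ≡ x ^ (p ℕ.^ n) + y ^ (p ℕ.^ n)
    p-power-additive zero x y = solve 2 (λ x y → (x :+ y) :* :1 := x :* :1 :+ y :* :1) refl x y
    p-power-additive (suc n) x y = begin
      (x + y) ^ (p ℕ.* p ℕ.^ n)                     ≡⟨ ^-* (x + y) p (p ℕ.^ n) ⟩
      ((x + y) ^ p) ^ (p ℕ.^ n)                     ≡⟨ cong (_^ (p ℕ.^ n)) (freshman p-prime ⟦p⟧≡0 x y) ⟩
      (x ^ p + y ^ p) ^ (p ℕ.^ n)                   ≡⟨ p-power-additive n (x ^ p) (y ^ p) ⟩
      (x ^ p) ^ (p ℕ.^ n) + (y ^ p) ^ (p ℕ.^ n)     ≡⟨ cong₂ _+_ (^-* x p _) (^-* y p _) ⟨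
      x ^ (p ℕ.* p ℕ.^ n) + y ^ (p ℕ.* p ℕ.^ n)     ∎

  Fr : ℕ → K → K
  Fr i x = x ^ (q ℕ.^ i)

  Fr-+ : ∀ i x y → Fr i (x + y) ≡ Fr i x + Fr i y
  Fr-+ i x y = subst (λ n → (x + y) ^ n ≡ x ^ n + y ^ n)
    (trans (sym (ℕ.^-*-assoc p k i)) (cong (ℕ._^ i) (sym q≡p^k))) (p-power-additive (k ℕ.* i) x y)

  Fr-* : ∀ i x y → Fr i (x * y) ≡ Fr i x * Fr i y
  Fr-* i x y = ^-distrib-* x y (q ℕ.^ i)

  Fr-1 : ∀ i → Fr i 1# ≡ 1#
  Fr-1 i = 1^n≡1 (q ℕ.^ i)

  Fr-0 : ∀ i → Fr i 0# ≡ 0#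
  Fr-0 i = 0^n≡0 (q ℕ.^ i) {{ℕ.m^n≢0 q i {{q≢0}}}}

  Fr≡0⇒≡0 : ∀ i {x} → Fr i x ≡ 0# → x ≡ 0#
  Fr≡0⇒≡0 i = x^n≡0⇒x≡0 (q ℕ.^ i)

  Fr-id : ∀ x → Fr 0 x ≡ x
  Fr-id = x^1≡x

  Fr-∘ : ∀ i j x → Fr i (Fr j x) ≡ Fr (i ℕ.+ j) x
  Fr-∘ i j x = trans (sym (^-* x (q ℕ.^ j) (q ℕ.^ i)))
    (cong (x ^_) (trans (ℕ.*-comm (q ℕ.^ j) (q ℕ.^ i)) (sym (ℕ.^-distribˡ-+-* q i j))))

  Fr-5 : ∀ x → Fr 5 x ≡ x
  Fr-5 x = trans (cong (x ^_) (sym order≡)) (x^order≡x x)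

  Fr-+5n : ∀ i n x → Fr (i ℕ.+ 5 ℕ.* n) x ≡ Fr i x
  Fr-+5n i zero x = cong (λ m → Fr m x) (ℕ.+-identityʳ i)
  Fr-+5n i (suc n) x = trans (cong (λ m → Fr m x) (arith i n))
    (trans (sym (Fr-∘ (i ℕ.+ 5 ℕ.* n) 5 x)) (trans (cong (Fr (i ℕ.+ 5 ℕ.* n)) (Fr-5 x)) (Fr-+5n i n x)))
    where
    arith : ∀ i n → i ℕ.+ 5 ℕ.* suc n ≡ (i ℕ.+ 5 ℕ.* n) ℕ.+ 5
    arith = solve-∀

  InFq⇒Fr-fixed : ∀ {x} → InFq x → ∀ i → Fr i x ≡ x
  InFq⇒Fr-fixed {x} x∈Fq zero = x^1≡x x
  InFq⇒Fr-fixed {x} x∈Fq (suc i) =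
    trans (^-* x q (q ℕ.^ i)) (trans (cong (_^ (q ℕ.^ i)) x∈Fq) (InFq⇒Fr-fixed x∈Fq i))

  Fr-1-fixed⇒InFq : ∀ {x} → Fr 1 x ≡ x → InFq x
  Fr-1-fixed⇒InFq {x} e = trans (cong (x ^_) (sym (ℕ.^-identityʳ q))) e

  -- An inverse k of t modulo 5; its existence makes x^(q^t) a generator of the cyclic group of the
  -- maps `Fr i`.
  Generator : ℕ → Set
  Generator t = ∃₂ λ k n → k ℕ.* t ≡ 1 ℕ.+ 5 ℕ.* n

  module Galois (t : ℕ) (t-gen : Generator t) where

    -- The k-th power of τ, where τ is x^(q^t).
    T : ℕ → K → K
    T k x = Fr (k ℕ.* t) x

    T-+ : ∀ k x y → T k (x + y) ≡ T k x + T k y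
    T-+ k = Fr-+ (k ℕ.* t)

    T-* : ∀ k x y → T k (x * y) ≡ T k x * T k y
    T-* k = Fr-* (k ℕ.* t)

    T-1 : ∀ k → T k 1# ≡ 1#
    T-1 k = Fr-1 (k ℕ.* t)

    T-id : ∀ x → T 0 x ≡ x
    T-id = Fr-id

    T-0 : ∀ k → T k 0# ≡ 0#
    T-0 k = Fr-0 (k ℕ.* t)

    T-neg : ∀ k x → T k (- x) ≡ - T k x
    T-neg k x = begin
      T k (- x)                         ≡⟨ solve 2 (λ a b → a := a :+ b :+ :- b) refl (T k (- x)) (T k x) ⟩
      T k (- x) + T k x + - T k x       ≡⟨ cong (_+ - T k x) (trans (sym (T-+ k (- x) x)) (trans (cong (T k) (-‿inverseˡ x)) (T-0 k))) ⟩
      0# + - T k x                      ≡⟨ +-identityˡ _ ⟩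
      - T k x                           ∎

    T-∘ : ∀ j k x → T j (T k x) ≡ T (j ℕ.+ k) x
    T-∘ j k x = trans (Fr-∘ (j ℕ.* t) (k ℕ.* t) x) (cong (λ m → Fr m x) (sym (ℕ.*-distribʳ-+ t j k)))

    T-5+ : ∀ k x → T (5 ℕ.+ k) x ≡ T k x
    T-5+ k x = trans (cong (λ m → Fr m x) (arith k t)) (Fr-+5n (k ℕ.* t) t x)
      where
      arith : ∀ k t → (5 ℕ.+ k) ℕ.* t ≡ k ℕ.* t ℕ.+ 5 ℕ.* t
      arith = solve-∀

    T-cancel : ∀ j k → j ℕ.+ k ≡ 5 → ∀ x → T j (T k x) ≡ x
    T-cancel j k e x = trans (T-∘ j k x) (trans (cong (λ m → T m x) e) (trans (T-5+ 0 x) (T-id x)))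

    T≡0⇒≡0 : ∀ k {x} → T k x ≡ 0# → x ≡ 0#
    T≡0⇒≡0 k = Fr≡0⇒≡0 (k ℕ.* t)

    InFq⇒T-fixed : ∀ {x} → InFq x → ∀ k → T k x ≡ x
    InFq⇒T-fixed x∈Fq k = InFq⇒Fr-fixed x∈Fq (k ℕ.* t)

    T-iterate : ∀ j {x} → T j x ≡ x → ∀ n → T (n ℕ.* j) x ≡ x
    T-iterate j {x} e zero = T-id x
    T-iterate j {x} e (suc n) = trans (sym (T-∘ j (n ℕ.* j) x)) (trans (cong (T j) (T-iterate j e n)) e)

    -- Iterating τ as often as the inverse of t modulo 5 prescribes gives the q-th power map.
    T-1-fixed⇒InFq : ∀ {x} → T 1 x ≡ x → InFq x
    T-1-fixed⇒InFq {x} e = Fr-1-fixed⇒InFq (begin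
      Fr 1 x                ≡⟨ Fr-+5n 1 n x ⟨
      Fr (1 ℕ.+ 5 ℕ.* n) x  ≡⟨ cong (λ m → Fr m x) kt≡ ⟨
      T k′ x                ≡⟨ cong (λ m → T m x) (ℕ.*-identityʳ k′) ⟨
      T (k′ ℕ.* 1) x        ≡⟨ T-iterate 1 e k′ ⟩
      x                     ∎)
      where
      k′ = proj₁ t-gen
      n = proj₁ (proj₂ t-gen)
      kt≡ = proj₂ (proj₂ t-gen)

    -- Here i is an inverse of j modulo 5: i iterations of τ^j give back τ, because τ⁵ = 1.
    T-fixed⇒InFq : ∀ j i n → i ℕ.* j ≡ 1 ℕ.+ n ℕ.* 5 → ∀ {x} → T j x ≡ x → InFq x
    T-fixed⇒InFq j i n e {x} fixed = T-1-fixed⇒InFq (begin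
      T 1 x                   ≡⟨ cong (T 1) (T-iterate 5 (trans (T-5+ 0 x) (T-id x)) n) ⟨
      T 1 (T (n ℕ.* 5) x)     ≡⟨ T-∘ 1 (n ℕ.* 5) x ⟩
      T (1 ℕ.+ n ℕ.* 5) x     ≡⟨ cong (λ m → T m x) e ⟨
      T (i ℕ.* j) x           ≡⟨ T-iterate j fixed i ⟩
      x                       ∎)

    -- As 5 is prime, a single element outside 𝔽_q separates τ⁰ from each of the four other powers,
    -- and this is all that `artin` asks for.
    T-independent : ∀ {a} → ¬ InFq a → ∀ c₀ c₁ c₂ c₃ c₄ →
      (∀ y → c₀ * T 0 y + (c₁ * T 1 y + (c₂ * T 2 y + (c₃ * T 3 y + (c₄ * T 4 y + 0#)))) ≡ 0#) → c₀ ≡ 0#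
    T-independent {a} a∉Fq c₀ c₁ c₂ c₃ c₄ =
      artin (T-* 0) (T-1 0) (moved 1 1 0 refl ∷ moved 2 3 1 refl ∷ moved 3 2 1 refl ∷ moved 4 4 3 refl ∷ [])
        c₀ (c₁ ∷ c₂ ∷ c₃ ∷ c₄ ∷ [])
      where
      moved : ∀ j i n → i ℕ.* j ≡ 1 ℕ.+ n ℕ.* 5 → Multiplicative (T j) × ∃ λ z → T 0 z ≢ T j z
      moved j i n e = T-* j , a , λ fixed → a∉Fq (T-fixed⇒InFq j i n e (trans (sym fixed) (T-id a)))

  -- The field is given as a finite list, so comparing two functions either succeeds everywhere or
  -- yields an explicit witness.
  agree? : (f g : K → K) → (∀ x → f x ≡ g x) ⊎ ∃ λ z → f z ≢ g z
  agree? f g with Any.any? (λ x → ¬? (f x ≟ g x)) elements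
  ... | yes differ = inj₂ (let z , _ , d = find differ in z , d)
  ... | no ¬differ = inj₁ (λ x → decidable-stable (f x ≟ g x) (All.lookup (All.¬Any⇒All¬ _ ¬differ) (elements-complete x)))

  -- Otherwise the ten characters Fr i, Fr i ∘ α would satisfy the relation Tr = Tr ∘ α,
  -- in which Fr 0 differs from all the others.
  automorphism-is-Frobenius : (α : K → K) → (∀ x y → α (x + y) ≡ α x + α y) → (∀ x y → α (x * y) ≡ α x * α y) →
    α 1# ≡ 1# → (∀ x → InFq x → α x ≡ x) → ∀ {a} → α a ≢ a →
    ∃ λ t → 1 ℕ.≤ t × t ℕ.≤ 4 × ∀ x → α x ≡ Fr t x
  automorphism-is-Frobenius α α-+ α-* α-1 α-fix {a} αa≢a = result
    where
    module F = Galois 1 (1 , 0 , refl)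
    a∉Fq : ¬ InFq a
    a∉Fq a∈Fq = αa≢a (α-fix a a∈Fq)
    α-^ : ∀ n x → α (x ^ n) ≡ α x ^ n
    α-^ zero x = α-1
    α-^ (suc n) x = trans (α-* x (x ^ n)) (cong (α x *_) (α-^ n x))
    Tr : K → K
    Tr x = F.T 0 x + (F.T 1 x + (F.T 2 x + (F.T 3 x + F.T 4 x)))
    Tr∈Fq : ∀ x → InFq (Tr x)
    Tr∈Fq x = F.T-1-fixed⇒InFq (begin
      F.T 1 (Tr x)
        ≡⟨ trans (F.T-+ 1 _ _) (cong (F.T 1 (F.T 0 x) +_) (trans (F.T-+ 1 _ _) (cong (F.T 1 (F.T 1 x) +_)
             (trans (F.T-+ 1 _ _) (cong (F.T 1 (F.T 2 x) +_) (F.T-+ 1 _ _)))))) ⟩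
      F.T 1 (F.T 0 x) + (F.T 1 (F.T 1 x) + (F.T 1 (F.T 2 x) + (F.T 1 (F.T 3 x) + F.T 1 (F.T 4 x))))
        ≡⟨ cong₂ _+_ (F.T-∘ 1 0 x) (cong₂ _+_ (F.T-∘ 1 1 x) (cong₂ _+_ (F.T-∘ 1 2 x) (cong₂ _+_ (F.T-∘ 1 3 x) (trans (F.T-∘ 1 4 x) (F.T-5+ 0 x))))) ⟩
      F.T 1 x + (F.T 2 x + (F.T 3 x + (F.T 4 x + F.T 0 x)))
        ≡⟨ solve 5 (λ a b c d e → b :+ (c :+ (d :+ (e :+ a))) := a :+ (b :+ (c :+ (d :+ e)))) refl (F.T 0 x) (F.T 1 x) (F.T 2 x) (F.T 3 x) (F.T 4 x) ⟩
      Tr x ∎)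
    -- The map α commutes with powers, and it fixes `Tr x` because the trace lies in 𝔽_q.
    Tr-α : ∀ x → Tr (α x) ≡ Tr x
    Tr-α x = trans (sym (begin
      α (Tr x)
        ≡⟨ trans (α-+ _ _) (cong (α (F.T 0 x) +_) (trans (α-+ _ _) (cong (α (F.T 1 x) +_)
             (trans (α-+ _ _) (cong (α (F.T 2 x) +_) (α-+ _ _)))))) ⟩
      α (F.T 0 x) + (α (F.T 1 x) + (α (F.T 2 x) + (α (F.T 3 x) + α (F.T 4 x))))
        ≡⟨ cong₂ _+_ (α-Fr 0) (cong₂ _+_ (α-Fr 1) (cong₂ _+_ (α-Fr 2) (cong₂ _+_ (α-Fr 3) (α-Fr 4)))) ⟩
      Tr (α x) ∎)) (α-fix (Tr x) (Tr∈Fq x))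
      where
      α-Fr : ∀ i → α (F.T i x) ≡ F.T i (α x)
      α-Fr i = α-^ (q ℕ.^ (i ℕ.* 1)) x
    relation : ∀ y → 1# * F.T 0 y + (1# * F.T 1 y + (1# * F.T 2 y + (1# * F.T 3 y + (1# * F.T 4 y +
      (- 1# * F.T 0 (α y) + (- 1# * F.T 1 (α y) + (- 1# * F.T 2 (α y) + (- 1# * F.T 3 (α y) + (- 1# * F.T 4 (α y) + 0#))))))))) ≡ 0#
    relation y = trans (solve 10 (λ a b c d e a′ b′ c′ d′ e′ →
        :1 :* a :+ (:1 :* b :+ (:1 :* c :+ (:1 :* d :+ (:1 :* e :+ (:- :1 :* a′ :+ (:- :1 :* b′ :+ (:- :1 :* c′ :+ (:- :1 :* d′ :+ (:- :1 :* e′ :+ :0)))))))))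
        := a :+ (b :+ (c :+ (d :+ e))) :+ :- (a′ :+ (b′ :+ (c′ :+ (d′ :+ e′))))) refl
        (F.T 0 y) (F.T 1 y) (F.T 2 y) (F.T 3 y) (F.T 4 y) (F.T 0 (α y)) (F.T 1 (α y)) (F.T 2 (α y)) (F.T 3 (α y)) (F.T 4 (α y)))
      (trans (cong (λ z → Tr y + - z) (Tr-α y)) (-‿inverseʳ _))
    moved : ∀ j i n → i ℕ.* j ≡ 1 ℕ.+ n ℕ.* 5 → Multiplicative (F.T j) × ∃ λ z → F.T 0 z ≢ F.T j z
    moved j i n e = F.T-* j , a , λ fixed → a∉Fq (F.T-fixed⇒InFq j i n e (trans (sym fixed) (F.T-id a)))
    mult : ∀ j → Multiplicative (λ y → F.T j (α y))
    mult j x y = trans (cong (F.T j) (α-* x y)) (F.T-* j _ _)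
    -- Agreement of `Fr 0` with `Fr i ∘ α` makes α the inverse of `Fr i`, which is `Fr j` with j = 5
    -- - i.
    solution : ∀ i j → j ℕ.+ i ≡ 5 → (∀ y → F.T 0 y ≡ F.T i (α y)) → ∀ x → α x ≡ Fr j x
    solution i j e same x = begin
      α x                   ≡⟨ F.T-cancel j i e (α x) ⟨
      F.T j (F.T i (α x))   ≡⟨ cong (F.T j) (trans (sym (same x)) (F.T-id x)) ⟩
      F.T j x               ≡⟨ cong (λ m → Fr m x) (ℕ.*-identityʳ j) ⟩
      Fr j x                ∎
    result : ∃ λ t → 1 ℕ.≤ t × t ℕ.≤ 4 × ∀ x → α x ≡ Fr t x
    result with agree? (F.T 0) (λ y → F.T 0 (α y)) | agree? (F.T 0) (λ y → F.T 1 (α y)) | agree? (F.T 0) (λ y → F.T 2 (α y))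
              | agree? (F.T 0) (λ y → F.T 3 (α y)) | agree? (F.T 0) (λ y → F.T 4 (α y))
    ... | inj₁ same | _ | _ | _ | _ = ⊥-elim (αa≢a (trans (sym (F.T-id (α a))) (trans (sym (same a)) (F.T-id a))))
    ... | _ | inj₁ same | _ | _ | _ = 4 , s≤s z≤n , ℕ.≤-refl , solution 1 4 refl same
    ... | _ | _ | inj₁ same | _ | _ = 3 , s≤s z≤n , s≤s (s≤s (s≤s z≤n)) , solution 2 3 refl same
    ... | _ | _ | _ | inj₁ same | _ = 2 , s≤s z≤n , s≤s (s≤s z≤n) , solution 3 2 refl same
    ... | _ | _ | _ | _ | inj₁ same = 1 , s≤s z≤n , s≤s z≤n , solution 4 1 refl same
    ... | inj₂ z₀ | inj₂ z₁ | inj₂ z₂ | inj₂ z₃ | inj₂ z₄ = ⊥-elim (1≢0 (artin (F.T-* 0) (F.T-1 0)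
      (moved 1 1 0 refl ∷ moved 2 3 1 refl ∷ moved 3 2 1 refl ∷ moved 4 4 3 refl ∷
       (mult 0 , z₀) ∷ (mult 1 , z₁) ∷ (mult 2 , z₂) ∷ (mult 3 , z₃) ∷ (mult 4 , z₄) ∷ [])
      1# (1# ∷ 1# ∷ 1# ∷ 1# ∷ - 1# ∷ - 1# ∷ - 1# ∷ - 1# ∷ - 1# ∷ []) relation))

-- Linear forms, dependence and spanning in K^n

module LinearAlgebra (𝔽 : FiniteField) (q : ℕ) where
  open FieldTheory 𝔽
  open Geometry 𝔽 q
  open ≡-Reasoning
  open Sum semiring using (sum; sum-remove)

  sumF-cong : ∀ {k} {a b : Fin k → K} → (∀ j → a j ≡ b j) → sumF k a ≡ sumF k b
  sumF-cong {zero} e = refl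
  sumF-cong {suc k} e = cong₂ _+_ (e zero) (sumF-cong (e ∘ suc))

  sumF-+ : ∀ {k} (a b : Fin k → K) → sumF k (λ j → a j + b j) ≡ sumF k a + sumF k b
  sumF-+ {zero} a b = sym (+-identityˡ _)
  sumF-+ {suc k} a b = trans (cong (a zero + b zero +_) (sumF-+ (a ∘ suc) (b ∘ suc)))
    (solve 4 (λ a b c d → a :+ b :+ (c :+ d) := a :+ c :+ (b :+ d)) refl _ _ _ _)

  sumF-*ˡ : ∀ {k} c (a : Fin k → K) → sumF k (λ j → c * a j) ≡ c * sumF k a
  sumF-*ˡ {zero} c a = sym (zeroʳ c)
  sumF-*ˡ {suc k} c a = trans (cong (c * a zero +_) (sumF-*ˡ c (a ∘ suc))) (sym (distribˡ _ _ _))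

  sumF-*ʳ : ∀ {k} c (a : Fin k → K) → sumF k (λ j → a j * c) ≡ sumF k a * c
  sumF-*ʳ c a = trans (sumF-cong (λ j → *-comm (a j) c)) (trans (sumF-*ˡ c a) (*-comm _ _))

  sumF-0 : ∀ {k} {a : Fin k → K} → (∀ j → a j ≡ 0#) → sumF k a ≡ 0#
  sumF-0 {zero} e = refl
  sumF-0 {suc k} e = trans (cong₂ _+_ (e zero) (sumF-0 (e ∘ suc))) (+-identityˡ _)

  sumF-remove : ∀ {k} (i : Fin (suc k)) (a : Fin (suc k) → K) → sumF (suc k) a ≡ a i + sumF k (a ∘ punchIn i)
  sumF-remove i a = trans (sumF≡sum a) (trans (sum-remove {i = i} a) (cong (a i +_) (sym (sumF≡sum (a ∘ punchIn i)))))
    where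
    sumF≡sum : ∀ {k} (a : Fin k → K) → sumF k a ≡ sum a
    sumF≡sum {zero} a = refl
    sumF≡sum {suc k} a = cong (a zero +_) (sumF≡sum (a ∘ suc))

  comb-+ : ∀ {n k} (c d : Fin k → K) (ws : Fin k → Vec n) i → comb (λ j → c j + d j) ws i ≡ comb c ws i + comb d ws i
  comb-+ c d ws i = trans (sumF-cong (λ j → distribʳ (ws j i) (c j) (d j))) (sumF-+ (λ j → c j * ws j i) (λ j → d j * ws j i))

  comb-* : ∀ {n k} x (c : Fin k → K) (ws : Fin k → Vec n) i → comb (λ j → x * c j) ws i ≡ x * comb c ws i
  comb-* x c ws i = trans (sumF-cong (λ j → *-assoc x (c j) (ws j i))) (sumF-*ˡ x (λ j → c j * ws j i))

  comb-cong : ∀ {n k} {c d : Fin k → K} → (∀ j → c j ≡ d j) → (ws : Fin k → Vec n) → ∀ i → comb c ws i ≡ comb d ws i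
  comb-cong e ws i = sumF-cong (λ j → cong (_* ws j i) (e j))

  infix 4 _≐_
  _≐_ : ∀ {n} → Vec n → Vec n → Set
  v ≐ w = ∀ i → v i ≡ w i

  infixl 6 _⊕_
  infixl 7 _⊙_
  _⊕_ : ∀ {n} → Vec n → Vec n → Vec n
  (v ⊕ w) i = v i + w i

  _⊙_ : ∀ {n} → K → Vec n → Vec n
  (c ⊙ v) i = c * v i

  zeroV : ∀ {n} → Vec n
  zeroV _ = 0#

  -- The field `respects` is there because vectors are functions: pointwise equal vectors are not
  -- identified.
  record IsLinear {n} (φ : Vec n → K) : Set where
    field
      respects : ∀ {v w} → v ≐ w → φ v ≡ φ w
      additive : ∀ v w → φ (v ⊕ w) ≡ φ v + φ w
      homogeneous : ∀ c v → φ (c ⊙ v) ≡ c * φ v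

    at-0 : ∀ {v} → v ≐ zeroV → φ v ≡ 0#
    at-0 {v} v≐0 = trans (respects (λ i → trans (v≐0 i) (sym (zeroˡ (v i))))) (trans (homogeneous 0# v) (zeroˡ _))

    at-comb : ∀ {k} (c : Fin k → K) (ws : Fin k → Vec n) → φ (comb c ws) ≡ sumF k (λ j → c j * φ (ws j))
    at-comb {zero} c ws = at-0 (λ _ → refl)
    at-comb {suc k} c ws = trans (additive (c zero ⊙ ws zero) (comb (c ∘ suc) (ws ∘ suc)))
      (cong₂ _+_ (homogeneous (c zero) (ws zero)) (at-comb (c ∘ suc) (ws ∘ suc)))

  -- The Kronecker symbol; `δ j` also serves as the j-th unit vector.
  δ : ∀ {n} → Fin n → Fin n → K
  δ zero zero = 1#
  δ zero (suc _) = 0#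
  δ (suc _) zero = 0#
  δ (suc j) (suc i) = δ j i

  sumF-δ : ∀ {n} (a : Fin n → K) i → sumF n (λ j → a j * δ j i) ≡ a i
  sumF-δ {suc n} a zero = trans (cong₂ _+_ (*-identityʳ _) (sumF-0 (λ j → zeroʳ (a (suc j))))) (+-identityʳ _)
  sumF-δ {suc n} a (suc i) = trans (cong₂ _+_ (zeroʳ _) (sumF-δ (a ∘ suc) i)) (+-identityˡ _)

  δ-sym : ∀ {n} (i j : Fin n) → δ i j ≡ δ j i
  δ-sym zero zero = refl
  δ-sym zero (suc j) = refl
  δ-sym (suc i) zero = refl
  δ-sym (suc i) (suc j) = δ-sym i j

  zero? : ∀ {n} (v : Vec n) → (v ≐ zeroV) ⊎ NonZero v
  zero? v with Fin.all? (λ i → v i ≟ 0#)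
  ... | yes z = inj₁ z
  ... | no nz = inj₂ nz

  -- Gaussian elimination: a vector with nonzero first coordinate clears that coordinate in the
  -- others, and induction applies to the n vectors left. Without such a vector one vector is set
  -- aside with coefficient 0.
  dependent : ∀ n (ws : Fin (suc n) → Vec n) → ∃ λ c → NonZero c × comb c ws ≐ zeroV
  dependent zero ws = (λ _ → 1#) , (λ z → 1≢0 (z zero)) , λ ()
  dependent (suc n) ws with Fin.any? (λ j → ¬? (ws j zero ≟ 0#))
  ... | no none = c′ , (λ z → c≢0 (z ∘ suc)) , c′-dep
    where
    first≡0 : ∀ j → ws j zero ≡ 0#
    first≡0 j = decidable-stable (ws j zero ≟ 0#) (λ nz → none (j , nz))
    ih = dependent n (λ j i → ws (suc j) (suc i))
    c = proj₁ ih
    c≢0 = proj₁ (proj₂ ih)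
    c′ : Fin (suc (suc n)) → K
    c′ zero = 0#
    c′ (suc j) = c j
    c′-dep : comb c′ ws ≐ zeroV
    c′-dep zero = sumF-0 (λ j → trans (cong (c′ j *_) (first≡0 j)) (zeroʳ _))
    c′-dep (suc i) = trans (cong₂ _+_ (zeroˡ _) (proj₂ (proj₂ ih) i)) (+-identityˡ _)
  ... | yes (j , π≢0) = c′ , c′≢0 , c′-dep
    where
    π = ws j zero
    r : Fin (suc n) → K
    r i = ws (punchIn j i) zero * π ⁻¹
    reduced : Fin (suc n) → Vec (suc n)
    reduced i = ws (punchIn j i) ⊕ - r i ⊙ ws j
    ih = dependent n (λ i k → reduced i (suc k))
    c = proj₁ ih
    -- The coefficient of the pivot vector collects all multiples of it that were subtracted.
    x = sumF (suc n) (λ i → c i * - r i)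
    c′ = Vector.insertAt c j x
    c′≢0 : NonZero c′
    c′≢0 z = proj₁ (proj₂ ih) (λ i → trans (sym (insertAt-punchIn c j x i)) (z (punchIn j i)))
    pivoted : ∀ i → reduced i zero ≡ 0#
    pivoted i = trans (solve 3 (λ a b p → a :+ :- (a :* b) :* p := a :* (:1 :+ :- (b :* p))) refl (ws (punchIn j i) zero) (π ⁻¹) π)
      (trans (cong (λ z → ws (punchIn j i) zero * (1# + - z)) (⁻¹-inverseˡ π≢0)) (trans (cong (_ *_) (-‿inverseʳ 1#)) (zeroʳ _)))
    expand : ∀ k → comb c′ ws k ≡ comb c reduced k
    expand k = begin
      sumF (suc (suc n)) (λ i → c′ i * ws i k)                                   ≡⟨ sumF-remove j (λ i → c′ i * ws i k) ⟩
      c′ j * ws j k + sumF (suc n) (λ i → c′ (punchIn j i) * ws (punchIn j i) k)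
        ≡⟨ cong₂ (λ a b → a * ws j k + b) (insertAt-lookup c j x)
             (sumF-cong {suc n} (λ i → cong (_* ws (punchIn j i) k) (insertAt-punchIn c j x i))) ⟩
      x * ws j k + sumF (suc n) (λ i → c i * ws (punchIn j i) k)                 ≡⟨ cong (_+ sumF (suc n) (λ i → c i * ws (punchIn j i) k)) (sumF-*ʳ (ws j k) (λ i → c i * - r i)) ⟨
      sumF (suc n) (λ i → c i * - r i * ws j k) + sumF (suc n) (λ i → c i * ws (punchIn j i) k)
        ≡⟨ sumF-+ (λ i → c i * - r i * ws j k) (λ i → c i * ws (punchIn j i) k) ⟨
      sumF (suc n) (λ i → c i * - r i * ws j k + c i * ws (punchIn j i) k)
        ≡⟨ sumF-cong {suc n} (λ i → solve 4 (λ c r w v → c :* r :* w :+ c :* v := c :* (v :+ r :* w)) refl (c i) (- r i) (ws j k) (ws (punchIn j i) k)) ⟩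
      comb c reduced k ∎
    c′-dep : comb c′ ws ≐ zeroV
    c′-dep zero = trans (expand zero) (sumF-0 (λ i → trans (cong (c i *_) (pivoted i)) (zeroʳ _)))
    c′-dep (suc k) = trans (expand (suc k)) (proj₂ (proj₂ ih) k)

  -- Adding v gives one vector too many; in the resulting relation the coefficient of v is nonzero,
  -- since otherwise the family itself would be dependent.
  independent⇒spanning : ∀ {n} (ws : Fin n → Vec n) → LinIndep ws → ∀ v → InSpan ws v
  independent⇒spanning {n} ws indep v with dependent n (extend ws v)
  ... | c , c≢0 , dep with c zero ≟ 0#
  ...   | yes c₀≡0 = ⊥-elim (c≢0 all≡0)
    where
    all≡0 : ∀ j → c j ≡ 0#
    all≡0 zero = c₀≡0
    all≡0 (suc j) = indep (c ∘ suc) (λ i → trans (sym (+-identityˡ _))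
      (trans (cong (_+ comb (c ∘ suc) ws i) (sym (trans (cong (_* v i) c₀≡0) (zeroˡ _)))) (dep i))) j
  ...   | no c₀≢0 = (λ j → - (c zero ⁻¹) * c (suc j)) , λ i → begin
    v i                                                   ≡⟨ *-identityˡ (v i) ⟨
    1# * v i                                              ≡⟨ cong (_* v i) (⁻¹-inverseˡ c₀≢0) ⟨
    c zero ⁻¹ * c zero * v i
      ≡⟨ solve 4 (λ d c v s → d :* c :* v := d :* (c :* v :+ s) :+ :- d :* s) refl (c zero ⁻¹) (c zero) (v i) (comb (c ∘ suc) ws i) ⟩
    c zero ⁻¹ * (c zero * v i + comb (c ∘ suc) ws i) + - (c zero ⁻¹) * comb (c ∘ suc) ws i
      ≡⟨ cong₂ _+_ (trans (cong (c zero ⁻¹ *_) (dep i)) (zeroʳ _)) (sym (comb-* (- (c zero ⁻¹)) (c ∘ suc) ws i)) ⟩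
    0# + comb (λ j → - (c zero ⁻¹) * c (suc j)) ws i      ≡⟨ +-identityˡ _ ⟩
    comb (λ j → - (c zero ⁻¹) * c (suc j)) ws i           ∎

  -- The trivial common kernel makes the values of the forms at the unit vectors an invertible
  -- matrix, whose inverse supplies a basis e dual to the forms. The coefficients of ψ are then its
  -- values at e.
  forms-spanning : ∀ {n} (φ : Fin n → Vec n → K) → (∀ i → IsLinear (φ i)) →
    (∀ v → (∀ i → φ i v ≡ 0#) → v ≐ zeroV) →
    ∀ {ψ} → IsLinear ψ → ∃ λ (b : Fin n → K) → ∀ v → ψ v ≡ sumF n (λ k → b k * φ k v)
  forms-spanning {n} φ φ-lin φ-inj {ψ} ψ-lin = (λ k → ψ (e k)) , λ v → begin
    ψ v                                      ≡⟨ IsLinear.respects ψ-lin (expand v) ⟩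
    ψ (comb (λ k → φ k v) e)                 ≡⟨ IsLinear.at-comb ψ-lin _ e ⟩
    sumF n (λ k → φ k v * ψ (e k))           ≡⟨ sumF-cong {n} (λ k → *-comm (φ k v) (ψ (e k))) ⟩
    sumF n (λ k → ψ (e k) * φ k v)           ∎
    where
    ws : Fin n → Vec n
    ws j i = φ i (δ j)
    at-vector : ∀ i c → φ i c ≡ comb c ws i
    at-vector i c = trans (IsLinear.respects (φ-lin i) (λ k → sym (sumF-δ c k))) (IsLinear.at-comb (φ-lin i) c δ)
    span : ∀ k → InSpan ws (δ k)
    span k = independent⇒spanning ws (λ c z → φ-inj c (λ i → trans (at-vector i c) (z i))) (δ k)
    e : Fin n → Vec n
    e k = proj₁ (span k)
    dual : ∀ i k → φ i (e k) ≡ δ k i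
    dual i k = trans (at-vector i (e k)) (sym (proj₂ (span k) i))
    expand : ∀ v → v ≐ comb (λ k → φ k v) e
    expand v i = x-y≡0⇒x≡y (trans (cong (v i +_) (solve 1 (λ a → :- a := :- :1 :* a) refl _)) (φ-inj (v ⊕ - 1# ⊙ w) kernel i))
      where
      w = comb (λ k → φ k v) e
      kernel : ∀ i → φ i (v ⊕ - 1# ⊙ w) ≡ 0#
      kernel i = begin
        φ i (v ⊕ - 1# ⊙ w)            ≡⟨ trans (additive v (- 1# ⊙ w)) (cong (φ i v +_) (homogeneous (- 1#) w)) ⟩
        φ i v + - 1# * φ i w
          ≡⟨ cong (λ z → φ i v + - 1# * z) (trans (at-comb _ e) (trans (sumF-cong {n} (λ k → cong (φ k v *_) (dual i k))) (sumF-δ (λ k → φ k v) i))) ⟩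
        φ i v + - 1# * φ i v          ≡⟨ solve 1 (λ a → a :+ :- :1 :* a := :0) refl (φ i v) ⟩
        0#                            ∎
        where open IsLinear (φ-lin i)

  mulMV-cong : ∀ {n} (M : Mat n) {v w} → v ≐ w → mulMV M v ≐ mulMV M w
  mulMV-cong M e i = sumF-cong (λ j → cong (M i j *_) (e j))

  mulMV-linear : ∀ {n} (M : Mat n) i → IsLinear (λ v → mulMV M v i)
  mulMV-linear M i = record
    { respects = λ e → mulMV-cong M e i
    ; additive = λ v w → trans (sumF-cong (λ j → distribˡ (M i j) (v j) (w j))) (sumF-+ (λ j → M i j * v j) (λ j → M i j * w j))
    ; homogeneous = λ c v → trans (sumF-cong (λ j → solve 3 (λ m c v → m :* (c :* v) := c :* (m :* v)) refl (M i j) c (v j))) (sumF-*ˡ c (λ j → M i j * v j)) }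

  -- The linear set written without Σ and Γ: Σ has become the standard subgeometry, and Γ is the
  -- kernel of f.
  LinearSet : (Vec 5 → Vec 2) → Vec 2 → Set
  LinearSet f w = NonZero w × ∃ λ u → (∀ i → InFq (u i)) × NonZero u × Proportional w (f u)

-- Determinants by Laplace expansion

-- Laplace expansion over arbitrary operations, so that it also applies to the polynomials of the ring solver.
module Laplace {A : Set} (_+_ _*_ : A → A → A) (-_ : A → A) (0# 1# : A) where

  -- A signed sum over the choice of one column: φ receives the chosen column and the others in
  -- their original order, and the nested negations produce the alternating signs.
  expand : {C : Set} → (C → List C → A) → List C → A
  expand φ [] = 0#
  expand φ (c ∷ cs) = φ c cs + (- expand (λ d ds → φ d (c ∷ ds)) cs)

  det : {R C : Set} → (R → C → A) → List R → List C → A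
  det e [] [] = 1#
  det e [] (_ ∷ _) = 0#
  det e (r ∷ rs) cs = expand (λ c ds → e r c * det e rs ds) cs

module Determinant (𝔽 : FiniteField) where
  open FieldTheory 𝔽
  open ≡-Reasoning
  open Laplace _+_ _*_ -_ 0# 1# public

  module _ {C : Set} where

    expand-cong : {φ ψ : C → List C → K} → (∀ c ds → φ c ds ≡ ψ c ds) → ∀ cs → expand φ cs ≡ expand ψ cs
    expand-cong e [] = refl
    expand-cong e (c ∷ cs) = cong₂ (λ a b → a + - b) (e c cs) (expand-cong (λ d ds → e d (c ∷ ds)) cs)

    expand-linear : ∀ a (φ ψ : C → List C → K) cs → expand (λ c ds → φ c ds + a * ψ c ds) cs ≡ expand φ cs + a * expand ψ cs
    expand-linear a φ ψ [] = solve 1 (λ a → :0 := :0 :+ a :* :0) refl a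
    expand-linear a φ ψ (c ∷ cs) = trans
      (cong (λ z → φ c cs + a * ψ c cs + - z) (expand-linear a (λ d ds → φ d (c ∷ ds)) (λ d ds → ψ d (c ∷ ds)) cs))
      (solve 5 (λ a p q s t → p :+ a :* q :+ :- (s :+ a :* t) := p :+ :- s :+ a :* (q :+ :- t)) refl a _ _ _ _)

    expand-0 : {φ : C → List C → K} → (∀ c ds → φ c ds ≡ 0#) → ∀ cs → expand φ cs ≡ 0#
    expand-0 e [] = refl
    expand-0 e (c ∷ cs) = trans (cong₂ (λ a b → a + - b) (e c cs) (expand-0 (λ d ds → e d (c ∷ ds)) cs)) (-‿inverseʳ 0#)

    expand-neg : (φ : C → List C → K) → ∀ cs → expand (λ c ds → - φ c ds) cs ≡ - expand φ cs
    expand-neg φ [] = sym -0#≈0#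
    expand-neg φ (c ∷ cs) = trans (cong (- φ c cs +_) (cong -_ (expand-neg (λ d ds → φ d (c ∷ ds)) cs))) (-‿+-comm _ _)

    -- Both are carried along, since in characteristic 2 a change of sign does not imply vanishing
    -- at a repeated column.
    Antisymmetric Alternating : (List C → K) → Set
    Antisymmetric Φ = ∀ xs a b ys → Φ (xs ++ a ∷ b ∷ ys) ≡ - Φ (xs ++ b ∷ a ∷ ys)
    Alternating Φ = ∀ xs a ys → Φ (xs ++ a ∷ a ∷ ys) ≡ 0#

    expand-antisymmetric : {φ : C → List C → K} → (∀ c → Antisymmetric (φ c)) → Antisymmetric (expand φ)
    expand-antisymmetric {φ} anti [] a b ys = trans
      (cong (λ z → φ a (b ∷ ys) + - (φ b (a ∷ ys) + - z))
        (trans (expand-cong (λ d ds → anti d [] a b ds) ys) (expand-neg (λ d ds → φ d (b ∷ a ∷ ds)) ys)))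
      (solve 3 (λ p r s → p :+ :- (r :+ :- :- s) := :- (r :+ :- (p :+ :- s))) refl (φ a (b ∷ ys)) (φ b (a ∷ ys)) _)
    expand-antisymmetric {φ} anti (x ∷ xs) a b ys = trans
      (cong₂ (λ p r → p + - r) (anti x xs a b ys) (expand-antisymmetric (λ c zs → anti c (x ∷ zs)) xs a b ys))
      (-‿+-comm _ _)

    expand-alternating : {φ : C → List C → K} → (∀ c → Alternating (φ c)) → Alternating (expand φ)
    expand-alternating {φ} alt [] a ys = trans
      (cong (λ z → φ a (a ∷ ys) + - (φ a (a ∷ ys) + - z)) (expand-0 (λ d ds → alt d [] a ds) ys))
      (solve 1 (λ p → p :+ :- (p :+ :- :0) := :0) refl (φ a (a ∷ ys)))
    expand-alternating {φ} alt (x ∷ xs) a ys = trans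
      (cong₂ (λ p r → p + - r) (alt x xs a ys) (expand-alternating (λ c zs → alt c (x ∷ zs)) xs a ys)) (-‿inverseʳ 0#)

    module _ {R : Set} (e : R → C → K) where

      det-antisymmetric : ∀ rs → Antisymmetric (det e rs)
      det-antisymmetric [] [] a b ys = sym -0#≈0#
      det-antisymmetric [] (_ ∷ _) a b ys = sym -0#≈0#
      det-antisymmetric (r ∷ rs) = expand-antisymmetric
        (λ c xs a b ys → trans (cong (e r c *_) (det-antisymmetric rs xs a b ys)) (sym (-‿distribʳ-* _ _)))

      det-alternating : ∀ rs → Alternating (det e rs)
      det-alternating [] [] a ys = refl
      det-alternating [] (_ ∷ _) a ys = refl
      det-alternating (r ∷ rs) = expand-alternating
        (λ c xs a ys → trans (cong (e r c *_) (det-alternating rs xs a ys)) (zeroʳ _))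

      det-0-column : ∀ {z} {rs} → All (λ r → e r z ≡ 0#) rs → ∀ cs → det e rs (z ∷ cs) ≡ 0#
      det-0-column [] cs = refl
      det-0-column {z} {r ∷ rs} (e≡0 ∷ es) cs = trans
        (cong₂ (λ p s → p * det e rs cs + - s) e≡0
          (expand-0 (λ d ds → trans (cong (e r d *_) (det-0-column es ds)) (zeroʳ _)) cs))
        (solve 1 (λ d → :0 :* d :+ :- :0 := :0) refl (det e rs cs))

      det-linear-column : ∀ {a z c d} {rs} → All (λ r → e r z ≡ e r d + a * e r c) rs →
        ∀ cs → det e rs (z ∷ cs) ≡ det e rs (d ∷ cs) + a * det e rs (c ∷ cs)
      det-linear-column {a} [] cs = solve 1 (λ a → :0 := :0 :+ a :* :0) refl a
      det-linear-column {a} {z} {c} {d} {r ∷ rs} (eq ∷ eqs) cs = trans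
        (cong₂ (λ p s → p * det e rs cs + - s) eq
          (trans (expand-cong (λ f fs → trans (cong (e r f *_) (det-linear-column eqs fs))
                    (solve 4 (λ p s a t → p :* (s :+ a :* t) := p :* s :+ a :* (p :* t)) refl (e r f) _ a _)) cs)
                 (expand-linear a (λ f fs → e r f * det e rs (d ∷ fs)) (λ f fs → e r f * det e rs (c ∷ fs)) cs)))
        (solve 6 (λ a p s d t u → (p :+ a :* s) :* d :+ :- (t :+ a :* u) := p :* d :+ :- t :+ a :* (s :* d :+ :- u)) refl
          a (e r d) (e r c) (det e rs cs) _ _)

      -- The relation v₀ c₀ + ... + v₄ c₄ = 0 between columns is given by its partial sums, because
      -- linearity adds one multiple at a time. Put in the first place, every column but c₀ meets a
      -- second copy of itself, so only v₀ times the determinant survives.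
      det-singular : ∀ {rs c₀ c₁ c₂ c₃ c₄ z₀ z₁ z₂ z₃ z₄ z₅ v₀ v₁ v₂ v₃ v₄} →
        All (λ r → e r z₀ ≡ 0#) rs → All (λ r → e r z₀ ≡ e r z₁ + v₀ * e r c₀) rs →
        All (λ r → e r z₁ ≡ e r z₂ + v₁ * e r c₁) rs → All (λ r → e r z₂ ≡ e r z₃ + v₂ * e r c₂) rs →
        All (λ r → e r z₃ ≡ e r z₄ + v₃ * e r c₃) rs → All (λ r → e r z₄ ≡ e r z₅ + v₄ * e r c₄) rs →
        All (λ r → e r z₅ ≡ 0#) rs → v₀ * det e rs (c₀ ∷ c₁ ∷ c₂ ∷ c₃ ∷ c₄ ∷ []) ≡ 0#
      det-singular {rs} {c₀} {c₁} {c₂} {c₃} {c₄} {z₀} {z₁} {z₂} {z₃} {z₄} {z₅} {v₀} {v₁} {v₂} {v₃} {v₄} e₀≡0 e₀ e₁ e₂ e₃ e₄ e₅≡0 = begin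
        v₀ * D c₀
          ≡⟨ solve 6 (λ v₀ v₁ v₂ v₃ v₄ d₀ → v₀ :* d₀ := :0 :+ v₄ :* :0 :+ v₃ :* :0 :+ v₂ :* :0 :+ v₁ :* :0 :+ v₀ :* d₀) refl
               v₀ v₁ v₂ v₃ v₄ (D c₀) ⟩
        0# + v₄ * 0# + v₃ * 0# + v₂ * 0# + v₁ * 0# + v₀ * D c₀
          ≡⟨ cong (λ d → d + v₀ * D c₀) (cong₂ (λ s d → s + v₁ * d) (cong₂ (λ s d → s + v₂ * d) (cong₂ (λ s d → s + v₃ * d)
               (cong₂ (λ s d → s + v₄ * d) (det-0-column e₅≡0 cs) D₄) D₃) D₂) D₁) ⟨
        D z₅ + v₄ * D c₄ + v₃ * D c₃ + v₂ * D c₂ + v₁ * D c₁ + v₀ * D c₀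
          ≡⟨ cong (_+ v₀ * D c₀) (trans (det-linear-column e₁ cs) (cong (_+ v₁ * D c₁) (trans (det-linear-column e₂ cs)
               (cong (_+ v₂ * D c₂) (trans (det-linear-column e₃ cs) (cong (_+ v₃ * D c₃) (det-linear-column e₄ cs))))))) ⟨
        D z₁ + v₀ * D c₀     ≡⟨ det-linear-column e₀ cs ⟨
        D z₀                 ≡⟨ det-0-column e₀≡0 cs ⟩
        0#                   ∎
        where
        cs = c₁ ∷ c₂ ∷ c₃ ∷ c₄ ∷ []
        D : C → K
        D c = det e rs (c ∷ cs)
        flip : ∀ {x y} → x ≡ - y → y ≡ 0# → x ≡ 0#
        flip p refl = trans p -0#≈0#
        D₁ : D c₁ ≡ 0#
        D₁ = det-alternating rs [] c₁ (c₂ ∷ c₃ ∷ c₄ ∷ [])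
        -- From here on, transpositions of neighbours carry the first column to its second copy.
        D₂ : D c₂ ≡ 0#
        D₂ = flip (det-antisymmetric rs [] c₂ c₁ (c₂ ∷ c₃ ∷ c₄ ∷ [])) (det-alternating rs (c₁ ∷ []) c₂ (c₃ ∷ c₄ ∷ []))
        D₃ : D c₃ ≡ 0#
        D₃ = flip (det-antisymmetric rs [] c₃ c₁ (c₂ ∷ c₃ ∷ c₄ ∷ [])) (flip (det-antisymmetric rs (c₁ ∷ []) c₃ c₂ (c₃ ∷ c₄ ∷ []))
               (det-alternating rs (c₁ ∷ c₂ ∷ []) c₃ (c₄ ∷ [])))
        D₄ : D c₄ ≡ 0#
        D₄ = flip (det-antisymmetric rs [] c₄ c₁ (c₂ ∷ c₃ ∷ c₄ ∷ [])) (flip (det-antisymmetric rs (c₁ ∷ []) c₄ c₂ (c₃ ∷ c₄ ∷ []))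
               (flip (det-antisymmetric rs (c₁ ∷ c₂ ∷ []) c₄ c₃ (c₄ ∷ [])) (det-alternating rs (c₁ ∷ c₂ ∷ c₃ ∷ []) c₄ [])))

  expand-map : ∀ {C D : Set} (f : C → D) (φ : D → List D → K) cs →
    expand φ (map f cs) ≡ expand (λ c ds → φ (f c) (map f ds)) cs
  expand-map f φ [] = refl
  expand-map f φ (c ∷ cs) = cong (λ z → φ (f c) (map f cs) + - z) (expand-map f (λ d ds → φ d (f c ∷ ds)) cs)

  det-map : ∀ {R C D : Set} (e : R → D → K) (f : C → D) rs cs → det e rs (map f cs) ≡ det (λ r c → e r (f c)) rs cs
  det-map e f [] [] = refl
  det-map e f [] (_ ∷ _) = refl
  det-map e f (r ∷ rs) cs = trans (expand-map f _ cs) (expand-cong (λ c ds → cong (e r (f c) *_) (det-map e f rs ds)) cs)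

-- Determinants with one variable in each row

module MultilinearDeterminant (𝔽 : FiniteField) (q : ℕ) where
  open FieldTheory 𝔽
  open Determinant 𝔽
  open Polynomials 𝔽 q using (multilinear)
  open ≡-Reasoning

  multilinear-cong : ∀ n {c d : List Bool → K} {m : ℕ → K} → (∀ bs → c bs ≡ d bs) → multilinear n c m ≡ multilinear n d m
  multilinear-cong zero e = e []
  multilinear-cong (suc n) {m = m} e =
    cong₂ (λ a b → a + m n * b) (multilinear-cong n (λ bs → e (false ∷ bs))) (multilinear-cong n (λ bs → e (true ∷ bs)))

  multilinear-* : ∀ n (c : List Bool → K) (m : ℕ → K) s → s * multilinear n c m ≡ multilinear n (λ bs → s * c bs) m
  multilinear-* zero c m s = refl
  multilinear-* (suc n) c m s = trans (solve 4 (λ s a m b → s :* (a :+ m :* b) := s :* a :+ m :* (s :* b)) refl s _ (m n) _)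
    (cong₂ (λ a b → a + m n * b) (multilinear-* n _ m s) (multilinear-* n _ m s))

  multilinear-expand : ∀ n {C : Set} (H : C → List C → List Bool → K) (m : ℕ → K) cs →
    expand (λ c ds → multilinear n (H c ds) m) cs ≡ multilinear n (λ bs → expand (λ c ds → H c ds bs) cs) m
  multilinear-expand zero H m cs = refl
  multilinear-expand (suc n) H m cs = trans
    (expand-linear (m n) (λ c ds → multilinear n (H c ds ∘ (false ∷_)) m) (λ c ds → multilinear n (H c ds ∘ (true ∷_)) m) cs)
    (cong₂ (λ a b → a + m n * b) (multilinear-expand n _ m cs) (multilinear-expand n _ m cs))

  -- Descending, to match `multilinear`, where the first Boolean belongs to the variable with the
  -- largest index.
  rows : ℕ → List ℕ
  rows zero = []
  rows (suc i) = i ∷ rows i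

  tag : ℕ → List Bool → List (ℕ × Bool)
  tag (suc i) (b ∷ bs) = (i , b) ∷ tag i bs
  tag _ _ = []

  -- The variable m r occurs in row r only, so splitting every row yields one determinant for each
  -- choice, with `true` selecting the part multiplied by m r.
  det-multilinear : ∀ {C : Set} (e : ℕ × Bool → C → K) (m : ℕ → K) n cs →
    det (λ r c → e (r , false) c + m r * e (r , true) c) (rows n) cs ≡ multilinear n (λ bs → det e (tag n bs) cs) m
  det-multilinear e m zero [] = refl
  det-multilinear e m zero (_ ∷ _) = refl
  det-multilinear e m (suc i) cs = begin
    expand (λ c ds → (e (i , false) c + m i * e (i , true) c) * det _ (rows i) ds) cs
      ≡⟨ expand-cong (λ c ds → trans (cong ((e (i , false) c + m i * e (i , true) c) *_) (det-multilinear e m i ds))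
           (trans (solve 4 (λ a m b s → (a :+ m :* b) :* s := a :* s :+ m :* (b :* s)) refl (e (i , false) c) (m i) (e (i , true) c) _)
             (cong₂ (λ a b → a + m i * b) (multilinear-* i _ m _) (multilinear-* i _ m _)))) cs ⟩
    expand (λ c ds → multilinear i (λ bs → e (i , false) c * det e (tag i bs) ds) m + m i * multilinear i (λ bs → e (i , true) c * det e (tag i bs) ds) m) cs
      ≡⟨ expand-linear (m i) _ _ cs ⟩
    expand (λ c ds → multilinear i (λ bs → e (i , false) c * det e (tag i bs) ds) m) cs
      + m i * expand (λ c ds → multilinear i (λ bs → e (i , true) c * det e (tag i bs) ds) m) cs
      ≡⟨ cong₂ (λ a b → a + m i * b) (multilinear-expand i _ m cs) (multilinear-expand i _ m cs) ⟩
    multilinear (suc i) (λ bs → det e (tag (suc i) bs) cs) m ∎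

-- The Dickson matrix of a q-polynomial and its slopes

module Dickson (𝔽 : FiniteField) (q : ℕ) (q-pp : IsPrimePower q) (order≡ : FiniteField.order 𝔽 ≡ q ℕ.^ 5) where
  open FieldTheory 𝔽
  open Geometry 𝔽 q using (_^_)
  open Frobenius 𝔽 q q-pp order≡
  open Determinant 𝔽
  open MultilinearDeterminant 𝔽 q
  open Polynomials 𝔽 q
  open Multilinear 2≤q
  open ≡-Reasoning

  qpoly : (Fin 5 → K) → K → K
  qpoly b x = b 0F * Fr 0 x + (b 1F * Fr 1 x + (b 2F * Fr 2 x + (b 3F * Fr 3 x + b 4F * Fr 4 x)))

  -- Minus the identity matrix; its rows carry the variables subtracted on the diagonal.
  -1δ : ℕ → ℕ → K
  -1δ zero zero = - 1#
  -1δ zero (suc _) = 0#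
  -1δ (suc _) zero = 0#
  -1δ (suc i) (suc j) = -1δ i j

  private
    -1δP : ∀ {n} → ℕ → ℕ → Polynomial n
    -1δP zero zero = :- :1
    -1δP zero (suc _) = :0
    -1δP (suc _) zero = :0
    -1δP (suc i) (suc j) = -1δP i j

  -- Row i lists the coefficients of the q^i-th power of `qpoly b` at x, x^q, ..., x^(q⁴); the index
  -- j + (5 ∸ i) stands for j - i modulo 5.
  dickson : (Fin 5 → K) → ℕ → ℕ → K
  dickson b i j = Fr i (b ((j ℕ.+ (5 ℕ.∸ i)) mod 5))

  entry : (Fin 5 → K) → ℕ × Bool → ℕ → K
  entry b (i , false) j = dickson b i j
  entry b (i , true) j = -1δ i j

  -- Up to sign, the principal minor of the Dickson matrix on the rows marked `false`.
  coefficient : (Fin 5 → K) → List Bool → K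
  coefficient b bs = det (entry b) (tag 5 bs) (0 ∷ 1 ∷ 2 ∷ 3 ∷ 4 ∷ [])

  private
    Fr-qpoly : ∀ i b x → Fr i (qpoly b x) ≡ Fr i (b 0F) * Fr (i ℕ.+ 0) x + (Fr i (b 1F) * Fr (i ℕ.+ 1) x
      + (Fr i (b 2F) * Fr (i ℕ.+ 2) x + (Fr i (b 3F) * Fr (i ℕ.+ 3) x + Fr i (b 4F) * Fr (i ℕ.+ 4) x)))
    Fr-qpoly i b x = trans (Fr-+ i _ _) (cong₂ _+_ (term 0F 0) (trans (Fr-+ i _ _) (cong₂ _+_ (term 1F 1)
      (trans (Fr-+ i _ _) (cong₂ _+_ (term 2F 2) (trans (Fr-+ i _ _) (cong₂ _+_ (term 3F 3) (term 4F 4))))))))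
      where
      term : ∀ j k → Fr i (b j * Fr k x) ≡ Fr i (b j) * Fr (i ℕ.+ k) x
      term j k = trans (Fr-* i _ _) (cong (Fr i (b j) *_) (Fr-∘ i k x))

    wrap : ∀ j x → Fr (j ℕ.+ 5) x ≡ Fr j x
    wrap j = Fr-+5n j 1

  module _ (b : Fin 5 → K) {m x : K} (x≢0 : x ≢ 0#) (eigen : qpoly b x ≡ m * x) where
    private
      column : ℕ → ℕ → K
      column j i = entry b (i , false) j + Fr i m * entry b (i , true) j

      X : ℕ → K
      X j = Fr j x

      -- The partial sums that `det-singular` expects; z₀ is the complete combination of the columns
      -- with the entries x^(q^j).
      z₅ z₄ z₃ z₂ z₁ z₀ : ℕ → K
      z₅ i = 0#
      z₄ i = z₅ i + X 4 * column 4 i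
      z₃ i = z₄ i + X 3 * column 3 i
      z₂ i = z₃ i + X 2 * column 2 i
      z₁ i = z₂ i + X 1 * column 1 i
      z₀ i = z₁ i + X 0 * column 0 i

      Fr-eigen : ∀ i → Fr i (qpoly b x) + - (Fr i m * X i) ≡ 0#
      Fr-eigen i = trans (cong (λ z → Fr i z + - (Fr i m * X i)) eigen) (trans (cong (_+ - (Fr i m * X i)) (Fr-* i m x)) (-‿inverseʳ _))

      -- Row i is the equation `qpoly b x ≡ m * x` raised to the power q^i, with Frobenius exponents
      -- reduced modulo 5.
      kernel : All (λ i → z₀ i ≡ 0#) (rows 5)
      kernel = (begin
          z₀ 4 ≡⟨ solve 11 (λ a₀ a₁ a₂ a₃ a₄ x₀ x₁ x₂ x₃ x₄ μ →
                  :0 :+ x₄ :* (a₀ :+ μ :* :- :1) :+ x₃ :* (a₄ :+ μ :* :0) :+ x₂ :* (a₃ :+ μ :* :0) :+ x₁ :* (a₂ :+ μ :* :0) :+ x₀ :* (a₁ :+ μ :* :0)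
                  := a₀ :* x₄ :+ (a₁ :* x₀ :+ (a₂ :* x₁ :+ (a₃ :* x₂ :+ a₄ :* x₃))) :+ :- (μ :* x₄)) refl
                  (a 4 0F) (a 4 1F) (a 4 2F) (a 4 3F) (a 4 4F) (X 0) (X 1) (X 2) (X 3) (X 4) (Fr 4 m) ⟩
          a 4 0F * X 4 + (a 4 1F * X 0 + (a 4 2F * X 1 + (a 4 3F * X 2 + a 4 4F * X 3))) + - (Fr 4 m * X 4)
            ≡⟨ cong (_+ - (Fr 4 m * X 4)) (trans (Fr-qpoly 4 b x) (cong₂ _+_ refl (cong₂ _+_ (w 4 1F 0) (cong₂ _+_ (w 4 2F 1) (cong₂ _+_ (w 4 3F 2) (w 4 4F 3)))))) ⟨
          Fr 4 (qpoly b x) + - (Fr 4 m * X 4) ≡⟨ Fr-eigen 4 ⟩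
          0# ∎) ∷ (begin
          z₀ 3 ≡⟨ solve 11 (λ a₀ a₁ a₂ a₃ a₄ x₀ x₁ x₂ x₃ x₄ μ →
                  :0 :+ x₄ :* (a₁ :+ μ :* :0) :+ x₃ :* (a₀ :+ μ :* :- :1) :+ x₂ :* (a₄ :+ μ :* :0) :+ x₁ :* (a₃ :+ μ :* :0) :+ x₀ :* (a₂ :+ μ :* :0)
                  := a₀ :* x₃ :+ (a₁ :* x₄ :+ (a₂ :* x₀ :+ (a₃ :* x₁ :+ a₄ :* x₂))) :+ :- (μ :* x₃)) refl
                  (a 3 0F) (a 3 1F) (a 3 2F) (a 3 3F) (a 3 4F) (X 0) (X 1) (X 2) (X 3) (X 4) (Fr 3 m) ⟩
          a 3 0F * X 3 + (a 3 1F * X 4 + (a 3 2F * X 0 + (a 3 3F * X 1 + a 3 4F * X 2))) + - (Fr 3 m * X 3)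
            ≡⟨ cong (_+ - (Fr 3 m * X 3)) (trans (Fr-qpoly 3 b x) (cong₂ _+_ refl (cong₂ _+_ refl (cong₂ _+_ (w 3 2F 0) (cong₂ _+_ (w 3 3F 1) (w 3 4F 2)))))) ⟨
          Fr 3 (qpoly b x) + - (Fr 3 m * X 3) ≡⟨ Fr-eigen 3 ⟩
          0# ∎) ∷ (begin
          z₀ 2 ≡⟨ solve 11 (λ a₀ a₁ a₂ a₃ a₄ x₀ x₁ x₂ x₃ x₄ μ →
                  :0 :+ x₄ :* (a₂ :+ μ :* :0) :+ x₃ :* (a₁ :+ μ :* :0) :+ x₂ :* (a₀ :+ μ :* :- :1) :+ x₁ :* (a₄ :+ μ :* :0) :+ x₀ :* (a₃ :+ μ :* :0)
                  := a₀ :* x₂ :+ (a₁ :* x₃ :+ (a₂ :* x₄ :+ (a₃ :* x₀ :+ a₄ :* x₁))) :+ :- (μ :* x₂)) refl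
                  (a 2 0F) (a 2 1F) (a 2 2F) (a 2 3F) (a 2 4F) (X 0) (X 1) (X 2) (X 3) (X 4) (Fr 2 m) ⟩
          a 2 0F * X 2 + (a 2 1F * X 3 + (a 2 2F * X 4 + (a 2 3F * X 0 + a 2 4F * X 1))) + - (Fr 2 m * X 2)
            ≡⟨ cong (_+ - (Fr 2 m * X 2)) (trans (Fr-qpoly 2 b x) (cong₂ _+_ refl (cong₂ _+_ refl (cong₂ _+_ refl (cong₂ _+_ (w 2 3F 0) (w 2 4F 1)))))) ⟨
          Fr 2 (qpoly b x) + - (Fr 2 m * X 2) ≡⟨ Fr-eigen 2 ⟩
          0# ∎) ∷ (begin
          z₀ 1 ≡⟨ solve 11 (λ a₀ a₁ a₂ a₃ a₄ x₀ x₁ x₂ x₃ x₄ μ →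
                  :0 :+ x₄ :* (a₃ :+ μ :* :0) :+ x₃ :* (a₂ :+ μ :* :0) :+ x₂ :* (a₁ :+ μ :* :0) :+ x₁ :* (a₀ :+ μ :* :- :1) :+ x₀ :* (a₄ :+ μ :* :0)
                  := a₀ :* x₁ :+ (a₁ :* x₂ :+ (a₂ :* x₃ :+ (a₃ :* x₄ :+ a₄ :* x₀))) :+ :- (μ :* x₁)) refl
                  (a 1 0F) (a 1 1F) (a 1 2F) (a 1 3F) (a 1 4F) (X 0) (X 1) (X 2) (X 3) (X 4) (Fr 1 m) ⟩
          a 1 0F * X 1 + (a 1 1F * X 2 + (a 1 2F * X 3 + (a 1 3F * X 4 + a 1 4F * X 0))) + - (Fr 1 m * X 1)
            ≡⟨ cong (_+ - (Fr 1 m * X 1)) (trans (Fr-qpoly 1 b x) (cong₂ _+_ refl (cong₂ _+_ refl (cong₂ _+_ refl (cong₂ _+_ refl (w 1 4F 0)))))) ⟨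
          Fr 1 (qpoly b x) + - (Fr 1 m * X 1) ≡⟨ Fr-eigen 1 ⟩
          0# ∎) ∷ (begin
          z₀ 0 ≡⟨ solve 11 (λ a₀ a₁ a₂ a₃ a₄ x₀ x₁ x₂ x₃ x₄ μ →
                  :0 :+ x₄ :* (a₄ :+ μ :* :0) :+ x₃ :* (a₃ :+ μ :* :0) :+ x₂ :* (a₂ :+ μ :* :0) :+ x₁ :* (a₁ :+ μ :* :0) :+ x₀ :* (a₀ :+ μ :* :- :1)
                  := a₀ :* x₀ :+ (a₁ :* x₁ :+ (a₂ :* x₂ :+ (a₃ :* x₃ :+ a₄ :* x₄))) :+ :- (μ :* x₀)) refl
                  (a 0 0F) (a 0 1F) (a 0 2F) (a 0 3F) (a 0 4F) (X 0) (X 1) (X 2) (X 3) (X 4) (Fr 0 m) ⟩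
          a 0 0F * X 0 + (a 0 1F * X 1 + (a 0 2F * X 2 + (a 0 3F * X 3 + a 0 4F * X 4))) + - (Fr 0 m * X 0)
            ≡⟨ cong (_+ - (Fr 0 m * X 0)) (Fr-qpoly 0 b x) ⟨
          Fr 0 (qpoly b x) + - (Fr 0 m * X 0) ≡⟨ Fr-eigen 0 ⟩
          0# ∎) ∷ []
        where
        a : ℕ → Fin 5 → K
        a i j = Fr i (b j)
        w : ∀ i k j → a i k * Fr (j ℕ.+ 5) x ≡ a i k * X j
        w i k j = cong (a i k *_) (wrap j x)

    -- The vector (x, x^q, ..., x^(q⁴)) lies in the kernel of the matrix and its first entry is
    -- nonzero, so the determinant vanishes.
    eigenvalue-root : multilinear 5 (coefficient b) (λ i → m ^ (q ℕ.^ i)) ≡ 0#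
    eigenvalue-root = begin
      multilinear 5 (coefficient b) (λ i → Fr i m)                                ≡⟨ det-multilinear (entry b) (λ i → Fr i m) 5 cs ⟨
      det (λ i j → column j i) (rows 5) cs                                        ≡⟨ det-map (λ i c → c i) column (rows 5) cs ⟨
      det (λ i c → c i) (rows 5) (column 0 ∷ column 1 ∷ column 2 ∷ column 3 ∷ column 4 ∷ [])
        ≡⟨ xy≡0⇒y≡0 (λ e → x≢0 (trans (sym (Fr-id x)) e))
             (det-singular (λ i c → c i) {rows 5} {z₀ = z₀} {z₁} {z₂} {z₃} {z₄} {z₅} {X 0} {X 1} {X 2} {X 3} {X 4}
               kernel triv triv triv triv triv triv) ⟩
      0# ∎
      where
      cs = 0 ∷ 1 ∷ 2 ∷ 3 ∷ 4 ∷ []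
      triv : ∀ {f : ℕ → K} → All (λ i → f i ≡ f i) (rows 5)
      triv = All.universal (λ _ → refl) (rows 5)

  -- The two top coefficients are the same determinant of minus the identity, so `refl` compares
  -- them and as many common roots as the degree are enough.
  coefficients-agree : ∀ b b′ ms → Unique ms → size 5 ℕ.≤ suc (length ms) →
    All (λ m → (∃ λ x → x ≢ 0# × qpoly b x ≡ m * x) × (∃ λ x → x ≢ 0# × qpoly b′ x ≡ m * x)) ms →
    ∀ bs → length bs ≡ 5 → coefficient b bs ≡ coefficient b′ bs
  coefficients-agree b b′ ms uniq le eigen = multilinear-unique 5 (coefficient b) (coefficient b′) refl ms uniq le
    (All.map (λ ((x , x≢0 , e) , (y , y≢0 , e′)) → trans (eigenvalue-root b x≢0 e) (sym (eigenvalue-root b′ y≢0 e′))) eigen)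

  private
    module P {n} = Laplace {Polynomial n} _:+_ _:*_ :-_ :0 :1

    -- The determinant of `coefficient` over the solver's polynomials; its value unfolds to
    -- `coefficient` itself, so extracting a minor becomes a normalisation.
    symbolic : ∀ {n} → (ℕ → ℕ → Polynomial n) → List Bool → Polynomial n
    symbolic a bs = P.det a′ (tag 5 bs) (0 ∷ 1 ∷ 2 ∷ 3 ∷ 4 ∷ [])
      where
      a′ : ℕ × Bool → ℕ → Polynomial _
      a′ (i , false) j = a i j
      a′ (i , true) j = -1δP i j

  -- S is the set of rows (in the order 4, 3, 2, 1, 0) that contribute a factor m; the name lists the other rows.
  S0 S01 S02 S012 S024 : List Bool
  S0 = true ∷ true ∷ true ∷ true ∷ false ∷ []
  S01 = true ∷ true ∷ true ∷ false ∷ false ∷ []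
  S02 = true ∷ true ∷ false ∷ true ∷ false ∷ []
  S012 = true ∷ true ∷ false ∷ false ∷ false ∷ []
  S024 = false ∷ true ∷ false ∷ true ∷ false ∷ []

  -- A minor carries the sign (-1)^k for the k rows taken from minus the identity: plus for orders
  -- one and three, minus for order two.
  coefficient-0 : ∀ b → coefficient b S0 ≡ dickson b 0 0
  coefficient-0 b = prove (d 0 ∷ d 1 ∷ d 2 ∷ d 3 ∷ d 4 ∷ [])
    (symbolic (λ _ j → var (j mod 5)) S0) (var 0F) refl
    where
    d = dickson b 0

  coefficient-01 : ∀ b → coefficient b S01 ≡
    - (dickson b 0 0 * dickson b 1 1 + - (dickson b 0 1 * dickson b 1 0))
  coefficient-01 b = prove (d 0 0 ∷ d 0 1 ∷ d 0 2 ∷ d 0 3 ∷ d 0 4 ∷ d 1 0 ∷ d 1 1 ∷ d 1 2 ∷ d 1 3 ∷ d 1 4 ∷ [])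
    (symbolic a S01) (:- (a 0 0 :* a 1 1 :+ :- (a 0 1 :* a 1 0))) refl
    where
    d = dickson b
    a : ℕ → ℕ → Polynomial 10
    -- Entry (i, j) is the variable number 5 i + j; the reduction modulo 10 only makes the index
    -- total in i and j.
    a i j = var ((5 ℕ.* i ℕ.+ j) mod 10)

  coefficient-02 : ∀ b → coefficient b S02 ≡
    - (dickson b 0 0 * dickson b 2 2 + - (dickson b 0 2 * dickson b 2 0))
  coefficient-02 b = prove (d 0 0 ∷ d 0 1 ∷ d 0 2 ∷ d 0 3 ∷ d 0 4 ∷ d 2 0 ∷ d 2 1 ∷ d 2 2 ∷ d 2 3 ∷ d 2 4 ∷ [])
    (symbolic a S02) (:- (a 0 0 :* a 2 2 :+ :- (a 0 2 :* a 2 0))) refl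
    where
    d = dickson b
    a : ℕ → ℕ → Polynomial 10
    a zero j = var (j mod 10)
    a _ j = var ((5 ℕ.+ j) mod 10)

  coefficient-012 : ∀ b → coefficient b S012 ≡
    dickson b 0 0 * (dickson b 1 1 * dickson b 2 2 + - (dickson b 1 2 * dickson b 2 1))
    + - (dickson b 0 1 * (dickson b 1 0 * dickson b 2 2 + - (dickson b 1 2 * dickson b 2 0)))
    + dickson b 0 2 * (dickson b 1 0 * dickson b 2 1 + - (dickson b 1 1 * dickson b 2 0))
  coefficient-012 b = prove (d 0 0 ∷ d 0 1 ∷ d 0 2 ∷ d 0 3 ∷ d 0 4 ∷ d 1 0 ∷ d 1 1 ∷ d 1 2 ∷ d 1 3 ∷ d 1 4 ∷
      d 2 0 ∷ d 2 1 ∷ d 2 2 ∷ d 2 3 ∷ d 2 4 ∷ [])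
    (symbolic a S012)
    (a 0 0 :* (a 1 1 :* a 2 2 :+ :- (a 1 2 :* a 2 1)) :+ :- (a 0 1 :* (a 1 0 :* a 2 2 :+ :- (a 1 2 :* a 2 0)))
      :+ a 0 2 :* (a 1 0 :* a 2 1 :+ :- (a 1 1 :* a 2 0))) refl
    where
    d = dickson b
    a : ℕ → ℕ → Polynomial 15
    a i j = var ((5 ℕ.* i ℕ.+ j) mod 15)

  coefficient-024 : ∀ b → coefficient b S024 ≡
    dickson b 0 0 * (dickson b 2 2 * dickson b 4 4 + - (dickson b 2 4 * dickson b 4 2))
    + - (dickson b 0 2 * (dickson b 2 0 * dickson b 4 4 + - (dickson b 2 4 * dickson b 4 0)))
    + dickson b 0 4 * (dickson b 2 0 * dickson b 4 2 + - (dickson b 2 2 * dickson b 4 0))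
  coefficient-024 b = prove (d 0 0 ∷ d 0 1 ∷ d 0 2 ∷ d 0 3 ∷ d 0 4 ∷ d 2 0 ∷ d 2 1 ∷ d 2 2 ∷ d 2 3 ∷ d 2 4 ∷
      d 4 0 ∷ d 4 1 ∷ d 4 2 ∷ d 4 3 ∷ d 4 4 ∷ [])
    (symbolic a S024)
    (a 0 0 :* (a 2 2 :* a 4 4 :+ :- (a 2 4 :* a 4 2)) :+ :- (a 0 2 :* (a 2 0 :* a 4 4 :+ :- (a 2 4 :* a 4 0)))
      :+ a 0 4 :* (a 2 0 :* a 4 2 :+ :- (a 2 2 :* a 4 0))) refl
    where
    d = dickson b
    a : ℕ → ℕ → Polynomial 15
    a zero j = var (j mod 15)
    a 2 j = var ((5 ℕ.+ j) mod 15)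
    a _ j = var ((10 ℕ.+ j) mod 15)

-- Vanishing coefficients read off from principal minors

module Shape (𝔽 : FiniteField) (q : ℕ) (q-pp : IsPrimePower q) (order≡ : FiniteField.order 𝔽 ≡ q ℕ.^ 5) where
  open FieldTheory 𝔽
  open Geometry 𝔽 q using (_^_)
  open Frobenius 𝔽 q q-pp order≡
  open Determinant 𝔽
  open MultilinearDeterminant 𝔽 q
  open Polynomials 𝔽 q
  open Multilinear 2≤q
  open Dickson 𝔽 q q-pp order≡
  open ≡-Reasoning

  private
    module Reduced {b : Fin 5 → K} (b₀≡0 : b 0F ≡ 0#) where
      Fr-b₀ : ∀ i → Fr i (b 0F) ≡ 0#
      Fr-b₀ i = trans (cong (Fr i) b₀≡0) (Fr-0 i)

      reduced-01 : coefficient b S01 ≡ Fr 0 (b 1F) * Fr 1 (b 4F)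
      reduced-01 = trans (coefficient-01 b) (trans (cong (λ z → - (z * Fr 1 (b 0F) + - (Fr 0 (b 1F) * Fr 1 (b 4F)))) (Fr-b₀ 0))
        (solve 2 (λ x y → :- (:0 :* x :+ :- y) := y) refl (Fr 1 (b 0F)) _))

      reduced-02 : coefficient b S02 ≡ Fr 0 (b 2F) * Fr 2 (b 3F)
      reduced-02 = trans (coefficient-02 b) (trans (cong (λ z → - (z * Fr 2 (b 0F) + - (Fr 0 (b 2F) * Fr 2 (b 3F)))) (Fr-b₀ 0))
        (solve 2 (λ x y → :- (:0 :* x :+ :- y) := y) refl (Fr 2 (b 0F)) _))

      simplify : ∀ {z₀ z₁ z₂} → z₀ ≡ 0# → z₁ ≡ 0# → z₂ ≡ 0# → ∀ u v w x y t →
        z₀ * (z₁ * z₂ + - (u * v)) + - (w * (x * z₂ + - (u * y))) + t * (x * v + - (z₁ * y)) ≡ w * (u * y) + t * (x * v)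
      simplify refl refl refl u v w x y t = solve 6 (λ u v w x y t →
        :0 :* (:0 :* :0 :+ :- (u :* v)) :+ :- (w :* (x :* :0 :+ :- (u :* y))) :+ t :* (x :* v :+ :- (:0 :* y))
        := w :* (u :* y) :+ t :* (x :* v)) refl u v w x y t

      reduced-012 : coefficient b S012 ≡
        Fr 0 (b 1F) * (Fr 1 (b 1F) * Fr 2 (b 3F)) + Fr 0 (b 2F) * (Fr 1 (b 4F) * Fr 2 (b 4F))
      reduced-012 = trans (coefficient-012 b) (simplify (Fr-b₀ 0) (Fr-b₀ 1) (Fr-b₀ 2) _ _ _ _ _ _)

      reduced-024 : coefficient b S024 ≡
        Fr 0 (b 2F) * (Fr 2 (b 2F) * Fr 4 (b 1F)) + Fr 0 (b 4F) * (Fr 2 (b 3F) * Fr 4 (b 3F))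
      reduced-024 = trans (coefficient-024 b) (simplify (Fr-b₀ 0) (Fr-b₀ 2) (Fr-b₀ 4) _ _ _ _ _ _)

    Fr-≢0 : ∀ i {x} → x ≢ 0# → Fr i x ≢ 0#
    Fr-≢0 i x≢0 e = x≢0 (Fr≡0⇒≡0 i e)

  module _ {b b′ : Fin 5 → K} (agree : ∀ bs → length bs ≡ 5 → coefficient b bs ≡ coefficient b′ bs) (b₀′≡0 : b′ 0F ≡ 0#) where

    b₀≡0 : b 0F ≡ 0#
    b₀≡0 = Fr≡0⇒≡0 0 (trans (sym (coefficient-0 b)) (trans (agree S0 refl) (trans (coefficient-0 b′) (trans (cong (Fr 0) b₀′≡0) (Fr-0 0)))))

    private
      module b = Reduced {b} b₀≡0
      module b′ = Reduced {b′} b₀′≡0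

      agree-01 : Fr 0 (b 1F) * Fr 1 (b 4F) ≡ Fr 0 (b′ 1F) * Fr 1 (b′ 4F)
      agree-01 = trans (sym b.reduced-01) (trans (agree S01 refl) b′.reduced-01)

      agree-02 : Fr 0 (b 2F) * Fr 2 (b 3F) ≡ Fr 0 (b′ 2F) * Fr 2 (b′ 3F)
      agree-02 = trans (sym b.reduced-02) (trans (agree S02 refl) b′.reduced-02)

      agree-012 : Fr 0 (b 1F) * (Fr 1 (b 1F) * Fr 2 (b 3F)) + Fr 0 (b 2F) * (Fr 1 (b 4F) * Fr 2 (b 4F)) ≡
        Fr 0 (b′ 1F) * (Fr 1 (b′ 1F) * Fr 2 (b′ 3F)) + Fr 0 (b′ 2F) * (Fr 1 (b′ 4F) * Fr 2 (b′ 4F))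
      agree-012 = trans (sym b.reduced-012) (trans (agree S012 refl) b′.reduced-012)

      agree-024 : Fr 0 (b 2F) * (Fr 2 (b 2F) * Fr 4 (b 1F)) + Fr 0 (b 4F) * (Fr 2 (b 3F) * Fr 4 (b 3F)) ≡
        Fr 0 (b′ 2F) * (Fr 2 (b′ 2F) * Fr 4 (b′ 1F)) + Fr 0 (b′ 4F) * (Fr 2 (b′ 3F) * Fr 4 (b′ 3F))
      agree-024 = trans (sym b.reduced-024) (trans (agree S024 refl) b′.reduced-024)

    -- The minor on rows 0, 1 shows b₁ and b₄ nonzero, and the one on rows 0, 2 shows that b₂ or b₃
    -- vanishes. The minor on rows 0, 1, 2, which is b₁^(1+q) b₃^(q²) + b₂ b₄^(q+q²), then
    -- eliminates the other.
    shape-14 : b′ 2F ≡ 0# → b′ 3F ≡ 0# → b′ 1F ≢ 0# → b′ 4F ≢ 0# →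
      (b 2F ≡ 0# × b 3F ≡ 0#) × b 1F ≢ 0# × b 4F ≢ 0#
    shape-14 b₂′ b₃′ b₁′ b₄′ = both-vanish , b₁≢0 , b₄≢0
      where
      product≢0 : Fr 0 (b 1F) * Fr 1 (b 4F) ≢ 0#
      product≢0 e = *-≢0 (Fr-≢0 0 b₁′) (Fr-≢0 1 b₄′) (trans (sym agree-01) e)
      b₁≢0 : b 1F ≢ 0#
      b₁≢0 e = ≢0-factorˡ product≢0 (trans (cong (Fr 0) e) (Fr-0 0))
      b₄≢0 : b 4F ≢ 0#
      b₄≢0 e = ≢0-factorʳ product≢0 (trans (cong (Fr 1) e) (Fr-0 1))
      relation : Fr 0 (b 1F) * (Fr 1 (b 1F) * Fr 2 (b 3F)) + Fr 0 (b 2F) * (Fr 1 (b 4F) * Fr 2 (b 4F)) ≡ 0#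
      relation = trans agree-012
        (trans (cong₂ (λ y z → Fr 0 (b′ 1F) * (Fr 1 (b′ 1F) * y) + z * (Fr 1 (b′ 4F) * Fr 2 (b′ 4F)))
                 (trans (cong (Fr 2) b₃′) (Fr-0 2)) (trans (cong (Fr 0) b₂′) (Fr-0 0)))
          (solve 3 (λ x y z → x :* (y :* :0) :+ :0 :* z := :0) refl (Fr 0 (b′ 1F)) (Fr 1 (b′ 1F)) (Fr 1 (b′ 4F) * Fr 2 (b′ 4F))))
      product≡0 : Fr 0 (b 2F) * Fr 2 (b 3F) ≡ 0#
      product≡0 = trans agree-02
          (trans (cong (λ z → Fr 0 z * Fr 2 (b′ 3F)) b₂′) (trans (cong (_* Fr 2 (b′ 3F)) (Fr-0 0)) (zeroˡ _)))
      both-vanish : b 2F ≡ 0# × b 3F ≡ 0#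
      both-vanish = [ case₁ ∘ Fr≡0⇒≡0 0 , case₂ ∘ Fr≡0⇒≡0 2 ]′ (integral product≡0)
        where
        case₁ : b 2F ≡ 0# → b 2F ≡ 0# × b 3F ≡ 0#
        case₁ b₂≡0 = b₂≡0 , Fr≡0⇒≡0 2 (xy≡0⇒y≡0 (Fr-≢0 1 b₁≢0) (xy≡0⇒y≡0 (Fr-≢0 0 b₁≢0)
          (trans (solve 2 (λ x z → x := x :+ :0 :* z) refl _ (Fr 1 (b 4F) * Fr 2 (b 4F)))
            (trans (cong (λ z → Fr 0 (b 1F) * (Fr 1 (b 1F) * Fr 2 (b 3F)) + z * (Fr 1 (b 4F) * Fr 2 (b 4F))) (sym (trans (cong (Fr 0) b₂≡0) (Fr-0 0)))) relation))))
        case₂ : b 3F ≡ 0# → b 2F ≡ 0# × b 3F ≡ 0#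
        case₂ b₃≡0 = Fr≡0⇒≡0 0 (xy≡0⇒x≡0 (*-≢0 (Fr-≢0 1 b₄≢0) (Fr-≢0 2 b₄≢0))
          (trans (solve 3 (λ x y z → z := x :* (y :* :0) :+ z) refl (Fr 0 (b 1F)) (Fr 1 (b 1F)) _)
            (trans (cong (λ z → Fr 0 (b 1F) * (Fr 1 (b 1F) * z) + Fr 0 (b 2F) * (Fr 1 (b 4F) * Fr 2 (b 4F))) (sym (trans (cong (Fr 2) b₃≡0) (Fr-0 2)))) relation))) , b₃≡0

    -- Doubling modulo 5 carries the indices 1, 4 to 2, 3 and the rows 0, 1, 2 to 0, 2, 4, whence
    -- the choice of the minor on the rows 0, 2, 4.
    shape-23 : b′ 1F ≡ 0# → b′ 4F ≡ 0# → b′ 2F ≢ 0# → b′ 3F ≢ 0# →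
      (b 1F ≡ 0# × b 4F ≡ 0#) × b 2F ≢ 0# × b 3F ≢ 0#
    shape-23 b₁′ b₄′ b₂′ b₃′ = both-vanish , b₂≢0 , b₃≢0
      where
      product≢0 : Fr 0 (b 2F) * Fr 2 (b 3F) ≢ 0#
      product≢0 e = *-≢0 (Fr-≢0 0 b₂′) (Fr-≢0 2 b₃′) (trans (sym agree-02) e)
      b₂≢0 : b 2F ≢ 0#
      b₂≢0 e = ≢0-factorˡ product≢0 (trans (cong (Fr 0) e) (Fr-0 0))
      b₃≢0 : b 3F ≢ 0#
      b₃≢0 e = ≢0-factorʳ product≢0 (trans (cong (Fr 2) e) (Fr-0 2))
      product≡0 : Fr 0 (b 1F) * Fr 1 (b 4F) ≡ 0#
      product≡0 = trans agree-01
          (trans (cong (λ z → Fr 0 z * Fr 1 (b′ 4F)) b₁′) (trans (cong (_* Fr 1 (b′ 4F)) (Fr-0 0)) (zeroˡ _)))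
      relation : Fr 0 (b 2F) * (Fr 2 (b 2F) * Fr 4 (b 1F)) + Fr 0 (b 4F) * (Fr 2 (b 3F) * Fr 4 (b 3F)) ≡ 0#
      relation = trans agree-024
        (trans (cong₂ (λ y z → Fr 0 (b′ 2F) * (Fr 2 (b′ 2F) * y) + z * (Fr 2 (b′ 3F) * Fr 4 (b′ 3F)))
                 (trans (cong (Fr 4) b₁′) (Fr-0 4)) (trans (cong (Fr 0) b₄′) (Fr-0 0)))
          (solve 3 (λ x y z → x :* (y :* :0) :+ :0 :* z := :0) refl (Fr 0 (b′ 2F)) (Fr 2 (b′ 2F)) (Fr 2 (b′ 3F) * Fr 4 (b′ 3F))))
      both-vanish : b 1F ≡ 0# × b 4F ≡ 0#
      both-vanish = [ case₁ ∘ Fr≡0⇒≡0 0 , case₂ ∘ Fr≡0⇒≡0 1 ]′ (integral product≡0)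
        where
        case₁ : b 1F ≡ 0# → b 1F ≡ 0# × b 4F ≡ 0#
        case₁ b₁≡0 = b₁≡0 , Fr≡0⇒≡0 0 (xy≡0⇒x≡0 (*-≢0 (Fr-≢0 2 b₃≢0) (Fr-≢0 4 b₃≢0))
          (trans (solve 3 (λ x y z → z := x :* (y :* :0) :+ z) refl (Fr 0 (b 2F)) (Fr 2 (b 2F)) _)
            (trans (cong (λ z → Fr 0 (b 2F) * (Fr 2 (b 2F) * z) + Fr 0 (b 4F) * (Fr 2 (b 3F) * Fr 4 (b 3F))) (sym (trans (cong (Fr 4) b₁≡0) (Fr-0 4)))) relation)))
        case₂ : b 4F ≡ 0# → b 1F ≡ 0# × b 4F ≡ 0#
        case₂ b₄≡0 = Fr≡0⇒≡0 4 (xy≡0⇒y≡0 (Fr-≢0 2 b₂≢0) (xy≡0⇒y≡0 (Fr-≢0 0 b₂≢0)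
          (trans (solve 2 (λ x z → x := x :+ :0 :* z) refl _ (Fr 2 (b 3F) * Fr 4 (b 3F)))
            (trans (cong (λ z → Fr 0 (b 2F) * (Fr 2 (b 2F) * Fr 4 (b 1F)) + z * (Fr 2 (b 3F) * Fr 4 (b 3F))) (sym (trans (cong (Fr 0) b₄≡0) (Fr-0 0)))) relation)))) , b₄≡0

-- Norms, Hilbert 90 and the exclusion of N(δ) = 1

module NormOne (𝔽 : FiniteField) (q : ℕ) (q-pp : IsPrimePower q) (order≡ : FiniteField.order 𝔽 ≡ q ℕ.^ 5) where
  open FieldTheory 𝔽
  open Geometry 𝔽 q using (_^_; InFq; Norm)
  open Powers 𝔽 q
  open Polynomials 𝔽 q using (x^n≡1-roots)
  open Frobenius 𝔽 q q-pp order≡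
  open ≡-Reasoning

  -- An enumeration in place of 1 ≤ t ≤ 4, so that arithmetic modulo 5 can be settled case by case
  -- through computation.
  data Exponent : ℕ → Set where
    one : Exponent 1
    two : Exponent 2
    three : Exponent 3
    four : Exponent 4

  exponent : ∀ {t} → 1 ℕ.≤ t → t ℕ.≤ 4 → Exponent t
  exponent {1} _ _ = one
  exponent {2} _ _ = two
  exponent {3} _ _ = three
  exponent {4} _ _ = four
  exponent {suc (suc (suc (suc (suc _))))} _ (s≤s (s≤s (s≤s (s≤s ()))))

  generator : ∀ {t} → Exponent t → Generator t
  generator one = 1 , 0 , refl
  generator two = 3 , 1 , refl
  generator three = 2 , 1 , refl
  generator four = 4 , 3 , refl

  Fr-t : ∀ {t} → Exponent t → ∀ x → Fr t x ≡ Fr (1 ℕ.* t) x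
  Fr-t {t} _ x = cong (λ n → Fr n x) (sym (ℕ.*-identityˡ t))

  Fr-5∸t : ∀ {t} → Exponent t → ∀ x → Fr (5 ℕ.∸ t) x ≡ Fr (4 ℕ.* t) x
  Fr-5∸t one x = refl
  Fr-5∸t two x = sym (Fr-+5n 3 1 x)
  Fr-5∸t three x = sym (Fr-+5n 2 2 x)
  Fr-5∸t four x = sym (Fr-+5n 1 3 x)

  N : ℕ
  N = 1 ℕ.+ q ℕ.+ q ℕ.^ 2 ℕ.+ q ℕ.^ 3 ℕ.+ q ℕ.^ 4

  private
    Norm-Fr : ∀ x → Norm x ≡ Fr 0 x * (Fr 1 x * (Fr 2 x * (Fr 3 x * Fr 4 x)))
    Norm-Fr x = begin
      Norm x
        ≡⟨ trans (^-+ x (1 ℕ.+ q ℕ.+ q ℕ.^ 2 ℕ.+ q ℕ.^ 3) (q ℕ.^ 4)) (cong (_* Fr 4 x)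
             (trans (^-+ x (1 ℕ.+ q ℕ.+ q ℕ.^ 2) (q ℕ.^ 3)) (cong (_* Fr 3 x)
               (trans (^-+ x (1 ℕ.+ q) (q ℕ.^ 2)) (cong (_* Fr 2 x) (^-+ x 1 q)))))) ⟩
      x ^ 1 * x ^ q * Fr 2 x * Fr 3 x * Fr 4 x
        ≡⟨ cong (λ n → x ^ 1 * x ^ n * Fr 2 x * Fr 3 x * Fr 4 x) (ℕ.^-identityʳ q) ⟨
      Fr 0 x * Fr 1 x * Fr 2 x * Fr 3 x * Fr 4 x
        ≡⟨ solve 5 (λ a b c d e → a :* b :* c :* d :* e := a :* (b :* (c :* (d :* e)))) refl (Fr 0 x) (Fr 1 x) (Fr 2 x) (Fr 3 x) (Fr 4 x) ⟩
      Fr 0 x * (Fr 1 x * (Fr 2 x * (Fr 3 x * Fr 4 x))) ∎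

  module Fixed {t} (t-exp : Exponent t) where
    open Galois t (generator t-exp)

    -- Multiplication by t permutes the residues modulo 5, so the five conjugates are the same up to
    -- order.
    Norm-T : ∀ x → Norm x ≡ T 0 x * (T 1 x * (T 2 x * (T 3 x * T 4 x)))
    Norm-T x = trans (Norm-Fr x) (permuted t-exp)
      where
      permuted : ∀ {t} → Exponent t → Fr 0 x * (Fr 1 x * (Fr 2 x * (Fr 3 x * Fr 4 x))) ≡
        Fr (0 ℕ.* t) x * (Fr (1 ℕ.* t) x * (Fr (2 ℕ.* t) x * (Fr (3 ℕ.* t) x * Fr (4 ℕ.* t) x)))
      permuted one = refl
      permuted two = trans (solve 5 (λ a b c d e → a :* (b :* (c :* (d :* e))) := a :* (c :* (e :* (b :* d)))) refl (Fr 0 x) (Fr 1 x) (Fr 2 x) (Fr 3 x) (Fr 4 x))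
        (cong₂ (λ u v → Fr 0 x * (Fr 2 x * (Fr 4 x * (u * v)))) (sym (Fr-+5n 1 1 x)) (sym (Fr-+5n 3 1 x)))
      permuted three = trans (solve 5 (λ a b c d e → a :* (b :* (c :* (d :* e))) := a :* (d :* (b :* (e :* c)))) refl (Fr 0 x) (Fr 1 x) (Fr 2 x) (Fr 3 x) (Fr 4 x))
        (cong (λ z → Fr 0 x * (Fr 3 x * z)) (cong₂ _*_ (sym (Fr-+5n 1 1 x)) (cong₂ _*_ (sym (Fr-+5n 4 1 x)) (sym (Fr-+5n 2 2 x)))))
      permuted four = trans (solve 5 (λ a b c d e → a :* (b :* (c :* (d :* e))) := a :* (e :* (d :* (c :* b)))) refl (Fr 0 x) (Fr 1 x) (Fr 2 x) (Fr 3 x) (Fr 4 x))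
        (cong (λ z → Fr 0 x * (Fr 4 x * z)) (cong₂ _*_ (sym (Fr-+5n 3 1 x)) (cong₂ _*_ (sym (Fr-+5n 2 2 x)) (sym (Fr-+5n 1 3 x)))))

    Norm-≢0 : ∀ {x} → x ≢ 0# → Norm x ≢ 0#
    Norm-≢0 x≢0 e = x≢0 (x^n≡0⇒x≡0 N e)

    Norm-T-invariant : ∀ k x → Norm (T k x) ≡ Norm x
    Norm-T-invariant zero x = cong Norm (T-id x)
    Norm-T-invariant (suc k) x = begin
      Norm (T (1 ℕ.+ k) x)     ≡⟨ cong Norm (T-∘ 1 k x) ⟨
      Norm (T 1 y)             ≡⟨ Norm-T (T 1 y) ⟩
      T 0 (T 1 y) * (T 1 (T 1 y) * (T 2 (T 1 y) * (T 3 (T 1 y) * T 4 (T 1 y))))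
        ≡⟨ cong₂ _*_ (T-∘ 0 1 y) (cong₂ _*_ (T-∘ 1 1 y) (cong₂ _*_ (T-∘ 2 1 y) (cong₂ _*_ (T-∘ 3 1 y) (trans (T-∘ 4 1 y) (T-5+ 0 y))))) ⟩
      T 1 y * (T 2 y * (T 3 y * (T 4 y * T 0 y)))
        ≡⟨ solve 5 (λ a b c d e → b :* (c :* (d :* (e :* a))) := a :* (b :* (c :* (d :* e)))) refl (T 0 y) (T 1 y) (T 2 y) (T 3 y) (T 4 y) ⟩
      T 0 y * (T 1 y * (T 2 y * (T 3 y * T 4 y)))   ≡⟨ Norm-T y ⟨
      Norm y                   ≡⟨ Norm-T-invariant k x ⟩
      Norm x                   ∎
      where
      y = T k x

    T-Norm : ∀ k x → T k (Norm x) ≡ Norm x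
    T-Norm k x = trans (T-^ N x) (Norm-T-invariant k x)
      where
      T-^ : ∀ n x → T k (x ^ n) ≡ T k x ^ n
      T-^ zero x = T-1 k
      T-^ (suc n) x = trans (T-* k x (x ^ n)) (cong (T k x *_) (T-^ n x))

    T-⁻¹ : ∀ k {x} → x ≢ 0# → T k (x ⁻¹) * T k x ≡ 1#
    T-⁻¹ k x≢0 = trans (sym (T-* k _ _)) (trans (cong (T k) (⁻¹-inverseˡ x≢0)) (T-1 k))

    -- D is a Lagrange resolvent. Its coefficients are products of conjugates of δ that are shifted
    -- by applying τ⁴ and multiplying by δ; the norm condition closes the cycle at coefficient 1.
    -- Independence of the powers of τ provides a y with `D y` nonzero.
    hilbert90 : ∀ {a} → ¬ InFq a → ∀ {δ} → Norm δ ≡ 1# → ∃ λ D → D ≢ 0# × D ≡ δ * T 4 D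
    hilbert90 a∉Fq {δ} Nδ≡1 = [ (λ vanishes → ⊥-elim (1≢0 (T-independent a∉Fq 1# _ _ _ _ (λ y → vanishes y)))) , found ]′ (agree? D (λ _ → 0#))
      where
      δ₁ = T 1 δ
      δ₂ = T 2 δ
      δ₃ = T 3 δ
      δ₄ = T 4 δ
      D : K → K
      D y = 1# * T 0 y + (δ * δ₄ * δ₃ * δ₂ * T 1 y + (δ * δ₄ * δ₃ * T 2 y + (δ * δ₄ * T 3 y + (δ * T 4 y + 0#))))
      T4 : ∀ k j y → 4 ℕ.+ k ≡ 5 ℕ.+ j → T 4 (T k y) ≡ T j y
      T4 k j y e = trans (T-∘ 4 k y) (trans (cong (λ n → T n y) e) (T-5+ j y))
      T4-D : ∀ y → T 4 (D y) ≡ 1# * T 4 y + (δ₄ * δ₃ * δ₂ * δ₁ * T 0 y + (δ₄ * δ₃ * δ₂ * T 1 y + (δ₄ * δ₃ * T 2 y + (δ₄ * T 3 y + 0#))))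
      T4-D y = mul (T-1 4) (T-∘ 4 0 y) ⟨+⟩ (mul δ₄₃₂₁ (T4 1 0 y refl) ⟨+⟩ (mul δ₄₃₂ (T4 2 1 y refl)
        ⟨+⟩ (mul δ₄₃ (T4 3 2 y refl) ⟨+⟩ (mul refl (T4 4 3 y refl) ⟨+⟩ T-0 4))))
        where
        mul : ∀ {u v u′ v′} → T 4 u ≡ u′ → T 4 v ≡ v′ → T 4 (u * v) ≡ u′ * v′
        mul p r = trans (T-* 4 _ _) (cong₂ _*_ p r)
        _⟨+⟩_ : ∀ {u v u′ v′} → T 4 u ≡ u′ → T 4 v ≡ v′ → T 4 (u + v) ≡ u′ + v′
        p ⟨+⟩ r = trans (T-+ 4 _ _) (cong₂ _+_ p r)
        δ₄₃ : T 4 (δ * δ₄) ≡ δ₄ * δ₃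
        δ₄₃ = mul refl (T4 4 3 δ refl)
        δ₄₃₂ : T 4 (δ * δ₄ * δ₃) ≡ δ₄ * δ₃ * δ₂
        δ₄₃₂ = mul δ₄₃ (T4 3 2 δ refl)
        δ₄₃₂₁ : T 4 (δ * δ₄ * δ₃ * δ₂) ≡ δ₄ * δ₃ * δ₂ * δ₁
        δ₄₃₂₁ = mul δ₄₃₂ (T4 2 1 δ refl)
      product : δ * (δ₁ * (δ₂ * (δ₃ * δ₄))) ≡ 1#
      product = trans (cong (_* (δ₁ * (δ₂ * (δ₃ * δ₄)))) (sym (T-id δ))) (trans (sym (Norm-T δ)) Nδ≡1)
      invariant : ∀ y → D y ≡ δ * T 4 (D y)
      invariant y = begin
        D y
          ≡⟨ cong (λ z → z * T 0 y + (δ * δ₄ * δ₃ * δ₂ * T 1 y + (δ * δ₄ * δ₃ * T 2 y + (δ * δ₄ * T 3 y + (δ * T 4 y + 0#))))) product ⟨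
        δ * (δ₁ * (δ₂ * (δ₃ * δ₄))) * T 0 y + (δ * δ₄ * δ₃ * δ₂ * T 1 y + (δ * δ₄ * δ₃ * T 2 y + (δ * δ₄ * T 3 y + (δ * T 4 y + 0#))))
          ≡⟨ solve 10 (λ d d₁ d₂ d₃ d₄ y₀ y₁ y₂ y₃ y₄ →
               d :* (d₁ :* (d₂ :* (d₃ :* d₄))) :* y₀ :+ (d :* d₄ :* d₃ :* d₂ :* y₁ :+ (d :* d₄ :* d₃ :* y₂ :+ (d :* d₄ :* y₃ :+ (d :* y₄ :+ :0))))
               := d :* (:1 :* y₄ :+ (d₄ :* d₃ :* d₂ :* d₁ :* y₀ :+ (d₄ :* d₃ :* d₂ :* y₁ :+ (d₄ :* d₃ :* y₂ :+ (d₄ :* y₃ :+ :0))))))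
               refl δ δ₁ δ₂ δ₃ δ₄ (T 0 y) (T 1 y) (T 2 y) (T 3 y) (T 4 y) ⟩
        δ * (1# * T 4 y + (δ₄ * δ₃ * δ₂ * δ₁ * T 0 y + (δ₄ * δ₃ * δ₂ * T 1 y + (δ₄ * δ₃ * T 2 y + (δ₄ * T 3 y + 0#)))))
          ≡⟨ cong (δ *_) (T4-D y) ⟨
        δ * T 4 (D y) ∎
      found : ∃ (λ y → D y ≢ 0#) → ∃ λ D → D ≢ 0# × D ≡ δ * T 4 D
      found (y , Dy≢0) = D y , Dy≢0 , invariant y

    h : K → K → K
    h δ x = T 1 x + δ * T 4 x

    -- x y^τ - x^τ y is made to equal, up to an element of 𝔽_q, the Hilbert 90 element of δ:
    -- with s = D / (a^τ - a), the norm of s is s z z^τ for z = s^τ s^(τ³).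
    two-preimages : ∀ {a} → ¬ InFq a → ∀ {δ} → Norm δ ≡ 1# → ∃ λ x → x ≢ 0# × h δ x * (a * x) ≡ h δ (a * x) * x
    two-preimages {a} a∉Fq {δ} Nδ≡1 = x , x≢0 , (begin
      (T 1 x + δ * T 4 x) * y
        ≡⟨ solve 7 (λ x x₁ x₄ y y₁ y₄ d → (x₁ :+ d :* x₄) :* y := (y₁ :+ d :* y₄) :* x :+ :- (x :* y₁ :+ :- (x₁ :* y)) :+ d :* (x₄ :* y :+ :- (x :* y₄)))
             refl x (T 1 x) (T 4 x) y (T 1 y) (T 4 y) δ ⟩
      (T 1 y + δ * T 4 y) * x + - D′ + δ * (T 4 x * y + - (x * T 4 y))
        ≡⟨ cong (λ z → (T 1 y + δ * T 4 y) * x + - D′ + δ * z) T4-D′ ⟨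
      (T 1 y + δ * T 4 y) * x + - D′ + δ * T 4 D′
        ≡⟨ cong (λ z → (T 1 y + δ * T 4 y) * x + - D′ + z) D′-invariant ⟨
      (T 1 y + δ * T 4 y) * x + - D′ + D′
        ≡⟨ solve 2 (λ a b → a :+ :- b :+ b := a) refl ((T 1 y + δ * T 4 y) * x) D′ ⟩
      (T 1 y + δ * T 4 y) * x ∎)
      where
      H = hilbert90 a∉Fq Nδ≡1
      D = proj₁ H
      D≢0 = proj₁ (proj₂ H)
      ε = T 1 a + - a
      ε≢0 : ε ≢ 0#
      ε≢0 e = a∉Fq (T-1-fixed⇒InFq (x-y≡0⇒x≡y e))
      s = D * ε ⁻¹
      s≢0 = *-≢0 D≢0 (⁻¹-≢0 ε≢0)
      z = T 1 s * T 3 s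
      z≢0 : z ≢ 0#
      z≢0 = *-≢0 (λ e → s≢0 (T≡0⇒≡0 1 e)) (λ e → s≢0 (T≡0⇒≡0 3 e))
      n = Norm s
      n≢0 = Norm-≢0 s≢0
      x = z ⁻¹
      x≢0 = ⁻¹-≢0 z≢0
      y = a * x
      -- This equals x x^τ ε, and the pairs (x, h δ x) and (y, h δ y) are proportional because D′ =
      -- δ * T 4 D′.
      D′ = x * T 1 y + - (T 1 x * y)
      n≡ : n ≡ s * (z * T 1 z)
      n≡ = begin
        n                                              ≡⟨ Norm-T s ⟩
        T 0 s * (T 1 s * (T 2 s * (T 3 s * T 4 s)))    ≡⟨ cong (_* (T 1 s * (T 2 s * (T 3 s * T 4 s)))) (T-id s) ⟩
        s * (T 1 s * (T 2 s * (T 3 s * T 4 s)))        ≡⟨ solve 5 (λ s a b c d → s :* (a :* (b :* (c :* d))) := s :* (a :* c :* (b :* d))) refl s (T 1 s) (T 2 s) (T 3 s) (T 4 s) ⟩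
        s * (z * (T 2 s * T 4 s))                      ≡⟨ cong (λ w → s * (z * w)) (trans (T-* 1 _ _) (cong₂ _*_ (T-∘ 1 1 s) (T-∘ 1 3 s))) ⟨
        s * (z * T 1 z)                                ∎
      nD′≡D : n * D′ ≡ D
      nD′≡D = begin
        n * D′
          ≡⟨ cong₂ (λ n y₁ → n * (x * y₁ + - (T 1 x * y))) n≡ (T-* 1 a x) ⟩
        s * (z * T 1 z) * (x * (T 1 a * T 1 x) + - (T 1 x * (a * x)))
          ≡⟨ solve 7 (λ s z z₁ x x₁ a a₁ → s :* (z :* z₁) :* (x :* (a₁ :* x₁) :+ :- (x₁ :* (a :* x)))
               := (x :* z) :* (x₁ :* z₁) :* (s :* (a₁ :+ :- a))) refl s z (T 1 z) x (T 1 x) a (T 1 a) ⟩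
        (x * z) * (T 1 x * T 1 z) * (D * ε ⁻¹ * ε)
          ≡⟨ cong₂ _*_ (cong₂ _*_ (⁻¹-inverseˡ z≢0) (T-⁻¹ 1 z≢0)) (trans (*-assoc _ _ _) (cong (D *_) (⁻¹-inverseˡ ε≢0))) ⟩
        1# * 1# * (D * 1#)
          ≡⟨ solve 1 (λ d → :1 :* :1 :* (d :* :1) := d) refl D ⟩
        D ∎
      -- The norm n is fixed by τ, so the equation of D passes to its quotient D′ by n.
      D′-invariant : D′ ≡ δ * T 4 D′
      D′-invariant = *-cancelˡ n≢0 (begin
        n * D′                    ≡⟨ nD′≡D ⟩
        D                         ≡⟨ proj₂ (proj₂ H) ⟩
        δ * T 4 D                 ≡⟨ cong (λ w → δ * T 4 w) nD′≡D ⟨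
        δ * T 4 (n * D′)          ≡⟨ cong (δ *_) (trans (T-* 4 n D′) (cong (_* T 4 D′) (T-Norm 4 s))) ⟩
        δ * (n * T 4 D′)          ≡⟨ solve 3 (λ d n t → d :* (n :* t) := n :* (d :* t)) refl δ n (T 4 D′) ⟩
        n * (δ * T 4 D′)          ∎)
      T4-D′ : T 4 D′ ≡ T 4 x * y + - (x * T 4 y)
      T4-D′ = trans (T-+ 4 _ _) (cong₂ _+_ (trans (T-* 4 _ _) (cong (T 4 x *_) (T-cancel 4 1 refl y)))
        (trans (T-neg 4 _) (cong -_ (trans (T-* 4 _ _) (cong (_* T 4 y) (T-cancel 4 1 refl x))))))

    -- u = x / x^(τ⁴) has norm 1 and determines the value h δ x / x = u^τ + δ / u.
    private
      value : K → K → K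
      value δ u = T 1 u + δ * u ⁻¹

      unit : K → K
      unit x = x * T 4 x ⁻¹

      T4≢0 : ∀ {x} → x ≢ 0# → T 4 x ≢ 0#
      T4≢0 x≢0 e = x≢0 (T≡0⇒≡0 4 e)

      unit* : ∀ {x} → x ≢ 0# → unit x * T 4 x ≡ x
      unit* {x} x≢0 = trans (*-assoc _ _ _) (trans (cong (x *_) (⁻¹-inverseˡ (T4≢0 x≢0))) (*-identityʳ x))

      unit-≢0 : ∀ {x} → x ≢ 0# → unit x ≢ 0#
      unit-≢0 x≢0 = *-≢0 x≢0 (⁻¹-≢0 (T4≢0 x≢0))

      unit-norm : ∀ {x} → x ≢ 0# → unit x ^ N ≡ 1#
      unit-norm {x} x≢0 = *-cancelˡ (Norm-≢0 x≢0) (begin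
        Norm x * Norm (unit x)              ≡⟨ *-comm _ _ ⟩
        Norm (unit x) * Norm x              ≡⟨ cong (Norm (unit x) *_) (Norm-T-invariant 4 x) ⟨
        Norm (unit x) * Norm (T 4 x)        ≡⟨ ^-distrib-* (unit x) (T 4 x) N ⟨
        Norm (unit x * T 4 x)               ≡⟨ cong Norm (unit* x≢0) ⟩
        Norm x                              ≡⟨ *-identityʳ _ ⟨
        Norm x * 1#                         ∎)

      unit-value : ∀ {δ x} → x ≢ 0# → value δ (unit x) * x ≡ h δ x
      unit-value {δ} {x} x≢0 = begin
        (T 1 u + δ * u ⁻¹) * x                      ≡⟨ solve 4 (λ u₁ d v x → (u₁ :+ d :* v) :* x := u₁ :* x :+ d :* v :* x) refl (T 1 u) δ (u ⁻¹) x ⟩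
        T 1 u * x + δ * u ⁻¹ * x                    ≡⟨ cong₂ _+_ first second ⟩
        T 1 x + δ * T 4 x                           ∎
        where
        u = unit x
        first : T 1 u * x ≡ T 1 x
        first = trans (cong (T 1 u *_) (sym (T-cancel 1 4 refl x))) (trans (sym (T-* 1 u (T 4 x))) (cong (T 1) (unit* x≢0)))
        second : δ * u ⁻¹ * x ≡ δ * T 4 x
        second = trans (cong (δ * u ⁻¹ *_) (sym (unit* x≢0)))
          (trans (solve 4 (λ d v u w → d :* v :* (u :* w) := v :* u :* (d :* w)) refl δ (u ⁻¹) u (T 4 x))
            (trans (cong (_* (δ * T 4 x)) (⁻¹-inverseˡ (unit-≢0 x≢0))) (*-identityˡ _)))

    module _ {δ} {ms : List K} (uniq : Unique ms) (length≡ : length ms ≡ N)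
             (values : All (λ m → ∃ λ x → x ≢ 0# × h δ x ≡ m * x) ms) where
      private
        units : ∀ {ms} → All (λ m → ∃ λ x → x ≢ 0# × h δ x ≡ m * x) ms →
          ∃ λ us → All (λ u → u ^ N ≡ 1#) us × map (value δ) us ≡ ms
        units [] = [] , [] , refl
        units ((x , x≢0 , e) ∷ vs) = let us , rs , eq = units vs in
          unit x ∷ us , unit-norm x≢0 ∷ rs , cong₂ _∷_ (*-cancelˡ x≢0 (trans (*-comm _ _) (trans (unit-value x≢0) (trans e (*-comm _ _))))) eq

        us = proj₁ (units values)
        us-roots = proj₁ (proj₂ (units values))
        us-values = proj₂ (proj₂ (units values))

        unique-map : ∀ {us} → Unique (map (value δ) us) → ∀ {u u′} → u ∈ us → u′ ∈ us → value δ u ≡ value δ u′ → u ≡ u′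
        unique-map (_ ∷ _) (here refl) (here refl) _ = refl
        unique-map (v∉ ∷ _) (here refl) (there u′∈) e = ⊥-elim (All.lookup v∉ (∈-map⁺ (value δ) u′∈) e)
        unique-map (v∉ ∷ _) (there u∈) (here refl) e = ⊥-elim (All.lookup v∉ (∈-map⁺ (value δ) u∈) (sym e))
        unique-map (_ ∷ p) (there u∈) (there u′∈) e = unique-map p u∈ u′∈ e

        unique-us : ∀ {us} → Unique (map (value δ) us) → Unique us
        unique-us {[]} [] = []
        unique-us {u ∷ us} (v∉ ∷ p) = All.map (λ ne e → ne (cong (value δ) e)) (All.map⁻ v∉) ∷ unique-us p

        -- The list `us` already holds N distinct roots of X^N - 1, so one more would exceed the
        -- degree.
        extra-root : ∀ {u} → u ^ N ≡ 1# → u ∈ us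
        extra-root {u} root with DecMembership._∈?_ _≟_ u us
        ... | yes u∈us = u∈us
        ... | no u∉us = ⊥-elim (ℕ.1+n≰n (subst (λ n → suc n ℕ.≤ N) (trans (sym (List.length-map (value δ) us)) (trans (cong length us-values) length≡))
          (x^n≡1-roots N (u ∷ us) (All.¬Any⇒All¬ us u∉us ∷ unique-us (subst Unique (sym us-values) uniq)) (root ∷ us-roots))))

      -- The N slopes use up all N-th roots of unity, so `value δ` is injective on them. Two
      -- preimages x and a x of one slope would share their unit, which forces a^(τ⁴) = a and puts a
      -- into 𝔽_q.
      scattered⇒norm≢1 : ∀ {a} → ¬ InFq a → Norm δ ≢ 1#
      scattered⇒norm≢1 {a} a∉Fq Nδ≡1 = a∉Fq (T-fixed⇒InFq 4 4 3 refl (*-cancelˡ x≢0 (begin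
        x * T 4 a                        ≡⟨ cong (_* T 4 a) (unit* x≢0) ⟨
        unit x * T 4 x * T 4 a           ≡⟨ cong (λ u → u * T 4 x * T 4 a) same ⟩
        unit y * T 4 x * T 4 a           ≡⟨ solve 3 (λ u v w → u :* v :* w := u :* (w :* v)) refl (unit y) (T 4 x) (T 4 a) ⟩
        unit y * (T 4 a * T 4 x)         ≡⟨ cong (unit y *_) (T-* 4 a x) ⟨
        unit y * T 4 y                   ≡⟨ unit* y≢0 ⟩
        a * x                            ≡⟨ *-comm _ _ ⟩
        x * a                            ∎)))
        where
        pair = two-preimages a∉Fq Nδ≡1
        x = proj₁ pair
        x≢0 = proj₁ (proj₂ pair)
        y = a * x
        a≢0 : a ≢ 0#
        a≢0 e = a∉Fq (T-1-fixed⇒InFq (trans (cong (T 1) e) (trans (T-0 1) (sym e))))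
        y≢0 : y ≢ 0#
        y≢0 = *-≢0 a≢0 x≢0
        same : unit x ≡ unit y
        same = unique-map (subst Unique (sym us-values) uniq) (extra-root (unit-norm x≢0)) (extra-root (unit-norm y≢0))
          (*-cancelˡ (*-≢0 x≢0 y≢0) (begin
            x * y * value δ (unit x)     ≡⟨ solve 3 (λ x y v → x :* y :* v := v :* x :* y) refl x y (value δ (unit x)) ⟩
            value δ (unit x) * x * y     ≡⟨ cong (_* y) (unit-value x≢0) ⟩
            h δ x * y                    ≡⟨ proj₂ (proj₂ pair) ⟩
            h δ y * x                    ≡⟨ cong (_* x) (unit-value y≢0) ⟨
            value δ (unit y) * y * x     ≡⟨ solve 3 (λ x y v → v :* y :* x := x :* y :* v) refl x y (value δ (unit y)) ⟩
            x * y * value δ (unit y)     ∎))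

-- Slopes of a linear set and conjugates of a linear form

module LinearSets (𝔽 : FiniteField) (q : ℕ) (q-pp : IsPrimePower q) (order≡ : FiniteField.order 𝔽 ≡ q ℕ.^ 5) where
  open FieldTheory 𝔽
  open Geometry 𝔽 q
  open LinearAlgebra 𝔽 q
  open Frobenius 𝔽 q q-pp order≡
  open NormOne 𝔽 q q-pp order≡
  open ≡-Reasoning

  -- In coordinates ζ whose first entry never vanishes on S, a point is determined by its slope:
  -- equal slopes put v - k w into the kernel of ζ for a suitable k.
  slopes : (S : Vec 2 → Set) (ζ : Vec 2 → Vec 2) → (∀ i → IsLinear (λ w → ζ w i)) → (∀ w → ζ w ≐ zeroV → w ≐ zeroV) →
    (∀ w → S w → ζ w 0F ≢ 0#) → ∀ {n} → HasNPoints S n →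
    ∃ λ ms → Unique ms × length ms ≡ n × All (λ m → ∃ λ w → S w × ζ w 1F ≡ m * ζ w 0F) ms
  slopes S ζ ζ-lin ζ-inj ζ₀≢0 (ps , length≡ , ps∈S , distinct , _) =
    map μ ps , unique ps∈S distinct , trans (List.length-map μ ps) length≡ , All.map⁺ (All.map (λ {w} w∈S → w , w∈S , sym (μ* w w∈S)) ps∈S)
    where
    μ : Vec 2 → K
    μ w = ζ w 1F * ζ w 0F ⁻¹
    μ* : ∀ w → S w → μ w * ζ w 0F ≡ ζ w 1F
    μ* w w∈S = trans (*-assoc _ _ _) (trans (cong (ζ w 1F *_) (⁻¹-inverseˡ (ζ₀≢0 w w∈S))) (*-identityʳ _))
    separated : ∀ {v w} → S v → S w → ¬ Proportional v w → μ v ≢ μ w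
    separated {v} {w} v∈S w∈S ¬prop e = ¬prop (k , *-≢0 (ζ₀≢0 v v∈S) (⁻¹-≢0 (ζ₀≢0 w w∈S)) , λ i →
      x-y≡0⇒x≡y (trans (cong (v i +_) (-‿distribˡ-* k (w i))) (ζ-inj (v ⊕ - k ⊙ w) kernel i)))
      where
      k = ζ v 0F * ζ w 0F ⁻¹
      ζ₀ : ζ v 0F ≡ k * ζ w 0F
      ζ₀ = sym (trans (*-assoc _ _ _) (trans (cong (ζ v 0F *_) (⁻¹-inverseˡ (ζ₀≢0 w w∈S))) (*-identityʳ _)))
      ζ₁ : ζ v 1F ≡ k * ζ w 1F
      ζ₁ = begin
        ζ v 1F                    ≡⟨ μ* v v∈S ⟨
        μ v * ζ v 0F              ≡⟨ cong₂ _*_ e ζ₀ ⟩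
        μ w * (k * ζ w 0F)        ≡⟨ solve 3 (λ m k z → m :* (k :* z) := k :* (m :* z)) refl (μ w) k (ζ w 0F) ⟩
        k * (μ w * ζ w 0F)        ≡⟨ cong (k *_) (μ* w w∈S) ⟩
        k * ζ w 1F                ∎
      expand : ∀ i → ζ v i ≡ k * ζ w i → ζ (v ⊕ - k ⊙ w) i ≡ 0#
      expand i eq = begin
        ζ (v ⊕ - k ⊙ w) i            ≡⟨ trans (IsLinear.additive (ζ-lin i) v (- k ⊙ w)) (cong (ζ v i +_) (IsLinear.homogeneous (ζ-lin i) (- k) w)) ⟩
        ζ v i + - k * ζ w i          ≡⟨ cong (_+ - k * ζ w i) eq ⟩
        k * ζ w i + - k * ζ w i      ≡⟨ solve 2 (λ k z → k :* z :+ :- k :* z := :0) refl k (ζ w i) ⟩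
        0#                           ∎
      kernel : ζ (v ⊕ - k ⊙ w) ≐ zeroV
      kernel 0F = expand 0F ζ₀
      kernel 1F = expand 1F ζ₁
    unique : ∀ {ps} → All S ps → AllPairs (λ v w → ¬ Proportional v w) ps → Unique (map μ ps)
    unique [] [] = []
    unique (v∈S ∷ ps∈S) (v∉ps ∷ distinct) =
      All.map⁺ (All.zipWith (λ (w∈S , ¬prop) → separated v∈S w∈S ¬prop) (ps∈S , v∉ps)) ∷ unique ps∈S distinct

  infixr 5 _∙_
  _∙_ : ∀ {x y z : K} → x ≡ y → y ≡ z → x ≡ z
  _∙_ = trans

  module ConjugateVectors {t} (t-exp : Exponent t) where
    open Galois t (generator t-exp) public
    open Fixed t-exp public

    TV : ∀ {n} → ℕ → Vec n → Vec n
    TV k v i = T k (v i)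

    TV-≢0 : ∀ {n} k {v : Vec n} → NonZero v → NonZero (TV k v)
    TV-≢0 k v≢0 z = v≢0 (λ i → T≡0⇒≡0 k (z i))

    module _ {ξ : Vec 5 → K} (ξ-lin : IsLinear ξ) (ξ-nonzero : ∀ u → (∀ i → InFq (u i)) → NonZero u → ξ u ≢ 0#)
             {a} (a∉Fq : ¬ InFq a) where
      open IsLinear ξ-lin

      -- The traces of the multiples of v are 𝔽_q-vectors on which ξ vanishes.
      conjugates-injective : ∀ v → ξ (TV 0 v) ≡ 0# → ξ (TV 1 v) ≡ 0# → ξ (TV 2 v) ≡ 0# → ξ (TV 3 v) ≡ 0# → ξ (TV 4 v) ≡ 0# → v ≐ zeroV
      conjugates-injective v z₀ z₁ z₂ z₃ z₄ i = trans (sym (T-id (v i)))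
        -- For a fixed coordinate i the vanishing of all traces is a relation in c between the
        -- powers of τ, with first coefficient `T 0 (v i)`.
        (T-independent a∉Fq (T 0 (v i)) (T 1 (v i)) (T 2 (v i)) (T 3 (v i)) (T 4 (v i)) (λ c → trans
          (solve 10 (λ v₀ v₁ v₂ v₃ v₄ c₀ c₁ c₂ c₃ c₄ → v₀ :* c₀ :+ (v₁ :* c₁ :+ (v₂ :* c₂ :+ (v₃ :* c₃ :+ (v₄ :* c₄ :+ :0))))
             := c₀ :* v₀ :+ (c₁ :* v₁ :+ (c₂ :* v₂ :+ (c₃ :* v₃ :+ c₄ :* v₄)))) refl
             (T 0 (v i)) (T 1 (v i)) (T 2 (v i)) (T 3 (v i)) (T 4 (v i)) (T 0 c) (T 1 c) (T 2 c) (T 3 c) (T 4 c))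
          (trace≡0 c i)))
        where
        trace : K → Vec 5
        trace c = T 0 c ⊙ TV 0 v ⊕ (T 1 c ⊙ TV 1 v ⊕ (T 2 c ⊙ TV 2 v ⊕ (T 3 c ⊙ TV 3 v ⊕ T 4 c ⊙ TV 4 v)))
        step : ∀ k c i → T 1 (T k c * T k (v i)) ≡ T (suc k) c * T (suc k) (v i)
        step k c i = T-* 1 _ _ ∙ cong₂ _*_ (T-∘ 1 k c) (T-∘ 1 k (v i))
        trace∈Fq : ∀ c i → InFq (trace c i)
        trace∈Fq c i = T-1-fixed⇒InFq (begin
          T 1 (trace c i)
            ≡⟨ T-+ 1 _ _ ∙ cong₂ _+_ (step 0 c i) (T-+ 1 _ _ ∙ cong₂ _+_ (step 1 c i) (T-+ 1 _ _ ∙ cong₂ _+_ (step 2 c i)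
                 (T-+ 1 _ _ ∙ cong₂ _+_ (step 3 c i) (step 4 c i ∙ cong₂ _*_ (T-5+ 0 c) (T-5+ 0 (v i)))))) ⟩
          T 1 c * T 1 (v i) + (T 2 c * T 2 (v i) + (T 3 c * T 3 (v i) + (T 4 c * T 4 (v i) + T 0 c * T 0 (v i))))
            ≡⟨ solve 5 (λ a b c d e → b :+ (c :+ (d :+ (e :+ a))) := a :+ (b :+ (c :+ (d :+ e)))) refl
                 (T 0 c * T 0 (v i)) (T 1 c * T 1 (v i)) (T 2 c * T 2 (v i)) (T 3 c * T 3 (v i)) (T 4 c * T 4 (v i)) ⟩
          trace c i ∎)
        term : ∀ k c → ξ (TV k v) ≡ 0# → ξ (T k c ⊙ TV k v) ≡ 0#
        term k c z = homogeneous (T k c) (TV k v) ∙ cong (T k c *_) z ∙ zeroʳ _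
        ξ-trace : ∀ c → ξ (trace c) ≡ 0#
        ξ-trace c = additive _ _ ∙ sum≡0 (term 0 c z₀) (additive _ _ ∙ sum≡0 (term 1 c z₁) (additive _ _ ∙ sum≡0 (term 2 c z₂)
          (additive _ _ ∙ sum≡0 (term 3 c z₃) (term 4 c z₄))))
        trace≡0 : ∀ c → trace c ≐ zeroV
        trace≡0 c = [ id , (λ nz → ⊥-elim (ξ-nonzero (trace c) (trace∈Fq c) nz (ξ-trace c))) ]′ (zero? (trace c))

-- Inverses of two by two matrices

module TwoByTwo (𝔽 : FiniteField) (q : ℕ) where
  open FieldTheory 𝔽
  open Geometry 𝔽 q
  open LinearAlgebra 𝔽 q
  open ≡-Reasoning

  adjugate : Mat 2 → Mat 2
  adjugate P 0F 0F = P 1F 1F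
  adjugate P 0F 1F = - P 0F 1F
  adjugate P 1F 0F = - P 1F 0F
  adjugate P 1F 1F = P 0F 0F

  det₂ : Mat 2 → K
  det₂ P = P 0F 0F * P 1F 1F + - (P 0F 1F * P 1F 0F)

  -- The product of P with the matrix of columns r and s is the identity, and determinants multiply.
  surjective⇒det≢0 : (P : Mat 2) (r s : Vec 2) → mulMV P r ≐ δ 0F → mulMV P s ≐ δ 1F → det₂ P ≢ 0#
  surjective⇒det≢0 P r s Pr Ps e = 1≢0 (begin
    1#
      ≡⟨ solve 0 (:1 := :1 :* :1 :+ :- (:0 :* :0)) refl ⟩
    1# * 1# + - (0# * 0#)
      ≡⟨ cong₂ (λ a b → a + - b) (cong₂ _*_ (Pr 0F) (Ps 1F)) (cong₂ _*_ (Pr 1F) (Ps 0F)) ⟨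
    mulMV P r 0F * mulMV P s 1F + - (mulMV P r 1F * mulMV P s 0F)
      ≡⟨ solve 8 (λ a b c d x y z w →
           (a :* x :+ (b :* y :+ :0)) :* (c :* z :+ (d :* w :+ :0)) :+ :- ((c :* x :+ (d :* y :+ :0)) :* (a :* z :+ (b :* w :+ :0)))
           := (a :* d :+ :- (b :* c)) :* (x :* w :+ :- (y :* z))) refl (P 0F 0F) (P 0F 1F) (P 1F 0F) (P 1F 1F) (r 0F) (r 1F) (s 0F) (s 1F) ⟩
    det₂ P * (r 0F * s 1F + - (r 1F * s 0F))
      ≡⟨ trans (cong (_* (r 0F * s 1F + - (r 1F * s 0F))) e) (zeroˡ _) ⟩
    0# ∎)

  module _ (P : Mat 2) (det≢0 : det₂ P ≢ 0#) where

    inverse₂ : Mat 2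
    inverse₂ i j = det₂ P ⁻¹ * adjugate P i j

    private
      Δ = det₂ P
      Δ⁻¹ = det₂ P ⁻¹

      scaled : ∀ {x y} → x ≡ Δ⁻¹ * Δ * y → x ≡ y
      scaled {y = y} e = trans e (trans (cong (_* y) (⁻¹-inverseˡ det≢0)) (*-identityˡ y))

      a = P 0F 0F
      b = P 0F 1F
      c = P 1F 0F
      d = P 1F 1F

    inverse₂-leftInverse : ∀ v → mulMV inverse₂ (mulMV P v) ≐ v
    inverse₂-leftInverse v 0F = scaled (solve 7 (λ a b c d e x y →
      e :* d :* (a :* x :+ (b :* y :+ :0)) :+ (e :* (:- b) :* (c :* x :+ (d :* y :+ :0)) :+ :0) := e :* (a :* d :+ :- (b :* c)) :* x) refl a b c d Δ⁻¹ (v 0F) (v 1F))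
    inverse₂-leftInverse v 1F = scaled (solve 7 (λ a b c d e x y →
      e :* (:- c) :* (a :* x :+ (b :* y :+ :0)) :+ (e :* a :* (c :* x :+ (d :* y :+ :0)) :+ :0) := e :* (a :* d :+ :- (b :* c)) :* y) refl a b c d Δ⁻¹ (v 0F) (v 1F))

    inverse₂-rightInverse : ∀ v → mulMV P (mulMV inverse₂ v) ≐ v
    inverse₂-rightInverse v 0F = scaled (solve 7 (λ a b c d e x y →
      a :* (e :* d :* x :+ (e :* (:- b) :* y :+ :0)) :+ (b :* (e :* (:- c) :* x :+ (e :* a :* y :+ :0)) :+ :0) := e :* (a :* d :+ :- (b :* c)) :* x) refl a b c d Δ⁻¹ (v 0F) (v 1F))
    inverse₂-rightInverse v 1F = scaled (solve 7 (λ a b c d e x y →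
      c :* (e :* d :* x :+ (e :* (:- b) :* y :+ :0)) :+ (d :* (e :* (:- c) :* x :+ (e :* a :* y :+ :0)) :+ :0) := e :* (a :* d :+ :- (b :* c)) :* y) refl a b c d Δ⁻¹ (v 0F) (v 1F))

-- From the incidence to LP type

module Sufficiency (𝔽 : FiniteField) (q : ℕ) (q-pp : IsPrimePower q) (order≡ : FiniteField.order 𝔽 ≡ q ℕ.^ 5) where
  open FieldTheory 𝔽
  open Geometry 𝔽 q
  open LinearAlgebra 𝔽 q
  open TwoByTwo 𝔽 q
  open Frobenius 𝔽 q q-pp order≡
  open NormOne 𝔽 q q-pp order≡
  open LinearSets 𝔽 q q-pp order≡
  open ≡-Reasoning

  sum5 : K → K → K → K → K → K
  sum5 a b c d e = a + (b + (c + (d + e)))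

  validS : ∀ {t} → Exponent t → ValidS t
  validS one = s≤s (s≤s z≤n) , refl
  validS two = s≤s (s≤s (s≤s z≤n)) , refl
  validS three = s≤s (s≤s (s≤s (s≤s z≤n))) , refl
  validS four = s≤s (s≤s (s≤s (s≤s (s≤s z≤n)))) , refl

  identity : Automorphism
  identity = record { f = id ; g = id ; f-+ = λ _ _ → refl ; f-* = λ _ _ → refl ; f-1 = refl ; fg = λ _ → refl ; gf = λ _ → refl }

  module _ {t} (t-exp : Exponent t) {p₀} (p₀∉Fq : ¬ InFq p₀)
    {f : Vec 5 → Vec 2} (f-lin : ∀ i → IsLinear (λ v → f v i))
    {l₀ l₁ : Vec 5} (f-l₀ : f l₀ ≐ δ 0F) (f-l₁ : f l₁ ≐ δ 1F)
    (scattered : MaxScattered (LinearSet f)) where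
    open ConjugateVectors t-exp

    private
      module f (i : Fin 2) = IsLinear (f-lin i)

    module _ {A E : Vec 5} (fA : f A ≐ zeroV) (fA₁ : f (TV 1 A) ≐ zeroV)
      (A-unique : ∀ X → NonZero X → f X ≐ zeroV → f (TV 1 X) ≐ zeroV → Proportional X A)
      (fE : f E ≐ zeroV) {α β} (E≡ : ∀ i → E i ≡ α * TV 2 A i + β * TV 4 A i)
      (indep : ∀ c d e → (∀ i → c * A i + (d * TV 1 A i + e * E i) ≡ 0#) → c ≡ 0# × d ≡ 0# × e ≡ 0#) where

      private
        f-cong : ∀ {v w} → v ≐ w → f w ≐ zeroV → f v ≐ zeroV
        f-cong e z i = trans (f.respects i e) (z i)

        E≢cA : ∀ c → ¬ (∀ i → E i ≡ c * A i)
        E≢cA c e = 1≢0 (proj₂ (proj₂ (indep (- c) 0# 1# (λ i → trans (cong (λ z → - c * A i + (0# * TV 1 A i + 1# * z)) (e i))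
          (solve 3 (λ c a b → :- c :* a :+ (:0 :* b :+ :1 :* (c :* a)) := :0) refl c (A i) (TV 1 A i))))))

        A₁≢cA : ∀ c → ¬ (∀ i → TV 1 A i ≡ c * A i)
        A₁≢cA c e = 1≢0 (proj₁ (proj₂ (indep (- c) 1# 0# (λ i → trans (cong (λ z → - c * A i + (1# * z + 0# * E i)) (e i))
          (solve 3 (λ c a b → :- c :* a :+ (:1 :* (c :* a) :+ :0 :* b) := :0) refl c (A i) (E i))))))

        A≢0 : NonZero A
        A≢0 z = A₁≢cA 0# (λ i → trans (cong (T 1) (z i)) (trans (T-0 1) (sym (zeroˡ _))))

        TV-1-4 : ∀ (v : Vec 5) → TV 1 (TV 4 v) ≐ v
        TV-1-4 v i = T-cancel 1 4 refl (v i)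

        T-wrap : ∀ j k l → j ℕ.+ k ≡ 5 ℕ.+ l → ∀ x → T j (T k x) ≡ T l x
        T-wrap j k l e x = trans (T-∘ j k x) (trans (cong (λ n → T n x) e) (T-5+ l x))

        -- Otherwise A₄ is in the kernel of f together with its image A under τ, so uniqueness makes
        -- A₄, and with it E, a multiple of A.
        α≢0 : α ≢ 0#
        α≢0 α≡0 = E≢cA (β * k) (λ i → trans (E-4 i) (trans (cong (β *_) (A₄∝A i)) (sym (*-assoc _ _ _))))
          where
          E-4 : ∀ i → E i ≡ β * TV 4 A i
          E-4 i = trans (E≡ i) (trans (cong (λ z → z * TV 2 A i + β * TV 4 A i) α≡0) (solve 2 (λ a b → :0 :* a :+ b := b) refl (TV 2 A i) _))
          β≢0 : β ≢ 0#
          β≢0 β≡0 = E≢cA 0# (λ i → trans (E-4 i) (trans (cong (_* TV 4 A i) β≡0) (trans (zeroˡ _) (sym (zeroˡ _)))))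
          fA₄ : f (TV 4 A) ≐ zeroV
          fA₄ i = xy≡0⇒y≡0 β≢0 (trans (sym (f.homogeneous i β (TV 4 A))) (trans (f.respects i (λ j → sym (E-4 j))) (fE i)))
          prop = A-unique (TV 4 A) (TV-≢0 4 A≢0) fA₄ (f-cong (TV-1-4 A) fA)
          k = proj₁ prop
          A₄∝A = proj₂ (proj₂ prop)

        -- Otherwise A₂ is in the kernel of f, so A₁ has the property that characterises A and is a
        -- multiple of it.
        β≢0 : β ≢ 0#
        β≢0 β≡0 = A₁≢cA k (proj₂ (proj₂ prop))
          where
          E-2 : ∀ i → E i ≡ α * TV 2 A i
          E-2 i = trans (E≡ i) (trans (cong (λ z → α * TV 2 A i + z * TV 4 A i) β≡0) (solve 2 (λ a b → b :+ :0 :* a := b) refl (TV 4 A i) _))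
          fA₂ : f (TV 2 A) ≐ zeroV
          fA₂ i = xy≡0⇒y≡0 α≢0 (trans (sym (f.homogeneous i α (TV 2 A))) (trans (f.respects i (λ j → sym (E-2 j))) (fE i)))
          prop = A-unique (TV 1 A) (TV-≢0 1 A≢0) fA₁ (f-cong (λ i → T-∘ 1 1 (A i)) fA₂)
          k = proj₁ prop

        E₄≡ : ∀ i → TV 4 E i ≡ T 4 α * TV 1 A i + T 4 β * TV 3 A i
        E₄≡ i = trans (cong (T 4) (E≡ i)) (trans (T-+ 4 _ _) (cong₂ _+_
          (trans (T-* 4 _ _) (cong (T 4 α *_) (T-wrap 4 2 1 refl (A i)))) (trans (T-* 4 _ _) (cong (T 4 β *_) (T-wrap 4 4 3 refl (A i))))))

        T4β≢0 : T 4 β ≢ 0#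
        T4β≢0 e = β≢0 (T≡0⇒≡0 4 e)

        -- A, A₁, E span the kernel of f, and A, A₄, E₄ span its image under τ⁴; the two planes
        -- share only the point A.
        basis : Fin 5 → Vec 5
        basis 0F = A
        basis 1F = TV 1 A
        basis 2F = E
        basis 3F = TV 4 A
        basis 4F = TV 4 E

        -- A dependency would produce a second point of Γ ∩ Γ^(σ⁴).
        basis-independent : LinIndep basis
        basis-independent c dep = result
          where
          -- Y is in the kernel of f, and the relation makes its image under τ equal to -Y′, which
          -- is in the kernel too. Hence Y is zero or a multiple of A.
          Y : Vec 5
          Y = c 1F ⊙ TV 1 A ⊕ c 2F ⊙ E
          Y′ : Vec 5
          Y′ = T 1 (c 0F) ⊙ TV 1 A ⊕ (T 1 (c 3F) ⊙ A ⊕ T 1 (c 4F) ⊙ E)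
          rest : ∀ i → T 1 (c 0F * A i + (c 3F * TV 4 A i + c 4F * TV 4 E i)) ≡ Y′ i
          rest i = trans (T-+ 1 _ _) (cong₂ _+_ (T-* 1 _ _) (trans (T-+ 1 _ _) (cong₂ _+_
            (trans (T-* 1 _ _) (cong (T 1 (c 3F) *_) (T-cancel 1 4 refl (A i)))) (trans (T-* 1 _ _) (cong (T 1 (c 4F) *_) (T-cancel 1 4 refl (E i)))))))
          Y≡ : ∀ i → Y i ≡ - (c 0F * A i + (c 3F * TV 4 A i + c 4F * TV 4 E i))
          Y≡ i = x-y≡0⇒x≡y (trans (solve 5 (λ a b c d e → b :+ c :+ :- (:- (a :+ (d :+ e))) := a :+ (b :+ (c :+ (d :+ (e :+ :0))))) refl
            (c 0F * A i) (c 1F * TV 1 A i) (c 2F * E i) (c 3F * TV 4 A i) (c 4F * TV 4 E i)) (dep i))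
          fY : f Y ≐ zeroV
          fY i = trans (f.additive i _ _) (sum≡0 (trans (f.homogeneous i _ _) (scale≡0 (c 1F) (fA₁ i))) (trans (f.homogeneous i _ _) (scale≡0 (c 2F) (fE i))))
          fY′ : f Y′ ≐ zeroV
          fY′ i = trans (f.additive i _ _) (sum≡0 (trans (f.homogeneous i _ _) (scale≡0 (T 1 (c 0F)) (fA₁ i)))
            (trans (f.additive i _ _) (sum≡0 (trans (f.homogeneous i _ _) (scale≡0 (T 1 (c 3F)) (fA i))) (trans (f.homogeneous i _ _) (scale≡0 (T 1 (c 4F)) (fE i))))))
          fY₁ : f (TV 1 Y) ≐ zeroV
          fY₁ i = trans (f.respects i (λ j → trans (cong (T 1) (Y≡ j)) (trans (T-neg 1 _) (trans (cong -_ (rest j)) (solve 1 (λ a → :- a := :- :1 :* a) refl (Y′ j))))))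
            (trans (f.homogeneous i (- 1#) Y′) (scale≡0 (- 1#) (fY′ i)))
          c₁₂ : c 1F ≡ 0# × c 2F ≡ 0#
          c₁₂ = [ (λ Y≡0 → proj₂ (indep 0# (c 1F) (c 2F) (λ i → trans (cong (_+ Y i) (zeroˡ (A i))) (trans (+-identityˡ _) (Y≡0 i)))))
                , (λ Y≢0 → let k , k≢0 , Y∝A = A-unique Y Y≢0 fY fY₁ in
                    proj₂ (indep (- k) (c 1F) (c 2F) (λ i → trans (cong (- k * A i +_) (Y∝A i)) (solve 2 (λ k a → :- k :* a :+ k :* a := :0) refl k (A i))))) ]′
                (zero? Y)
          Y′≡0 : ∀ i → Y′ i ≡ 0#
          Y′≡0 i = trans (sym (rest i)) (trans (cong (T 1) (trans (solve 3 (λ a b c → a :+ (b :+ c) := a :+ (:0 :+ (:0 :+ (b :+ (c :+ :0))))) refl _ _ _)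
            (trans (cong₂ (λ x y → c 0F * A i + (x + (y + (c 3F * TV 4 A i + (c 4F * TV 4 E i + 0#)))))
              (sym (trans (cong (_* TV 1 A i) (proj₁ c₁₂)) (zeroˡ _))) (sym (trans (cong (_* E i) (proj₂ c₁₂)) (zeroˡ _)))) (dep i)))) (T-0 1))
          c₀₃₄ = indep (T 1 (c 3F)) (T 1 (c 0F)) (T 1 (c 4F)) (λ i → trans (solve 3 (λ a b c → b :+ (a :+ c) := a :+ (b :+ c)) refl _ _ _) (Y′≡0 i))
          result : ∀ j → c j ≡ 0#
          result 0F = T≡0⇒≡0 1 (proj₁ (proj₂ c₀₃₄))
          result 1F = proj₁ c₁₂
          result 2F = proj₂ c₁₂
          result 3F = T≡0⇒≡0 1 (proj₁ c₀₃₄)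
          result 4F = T≡0⇒≡0 1 (proj₂ (proj₂ c₀₃₄))

        conj : K → K → K → K → K → Vec 5
        conj x₀ x₁ x₂ x₃ x₄ i = sum5 (x₀ * A i) (x₁ * TV 1 A i) (x₂ * TV 2 A i) (x₃ * TV 3 A i) (x₄ * TV 4 A i)

        conj-independent : ∀ x₀ x₁ x₂ x₃ x₄ → conj x₀ x₁ x₂ x₃ x₄ ≐ zeroV →
          x₀ ≡ 0# × x₁ ≡ 0# × x₂ ≡ 0# × x₃ ≡ 0# × x₄ ≡ 0#
        conj-independent x₀ x₁ x₂ x₃ x₄ z = zeros
          where
          γ = α ⁻¹
          ε = T 4 β ⁻¹
          -- The same combination expressed in `basis`, after solving E for A₂ and E₄ for A₃; the
          -- divisors are α and `T 4 β`.
          d : Fin 5 → K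
          d 0F = x₀
          d 1F = x₁ + - (x₃ * ε * T 4 α)
          d 2F = x₂ * γ
          d 3F = x₄ + - (x₂ * γ * β)
          d 4F = x₃ * ε
          d≡0 : ∀ j → d j ≡ 0#
          d≡0 = basis-independent d (λ i → begin
            d 0F * A i + (d 1F * TV 1 A i + (d 2F * E i + (d 3F * TV 4 A i + (d 4F * TV 4 E i + 0#))))
              ≡⟨ cong₂ (λ e e₄ → d 0F * A i + (d 1F * TV 1 A i + (d 2F * e + (d 3F * TV 4 A i + (d 4F * e₄ + 0#))))) (E≡ i) (E₄≡ i) ⟩
            d 0F * A i + (d 1F * TV 1 A i + (d 2F * (α * TV 2 A i + β * TV 4 A i) + (d 3F * TV 4 A i + (d 4F * (T 4 α * TV 1 A i + T 4 β * TV 3 A i) + 0#))))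
              ≡⟨ solve 16 (λ x₀ x₁ x₂ x₃ x₄ a b a′ b′ c e v₀ v₁ v₂ v₃ v₄ →
                   x₀ :* v₀ :+ ((x₁ :+ :- (x₃ :* e :* a′)) :* v₁ :+ (x₂ :* c :* (a :* v₂ :+ b :* v₄) :+ ((x₄ :+ :- (x₂ :* c :* b)) :* v₄ :+ (x₃ :* e :* (a′ :* v₁ :+ b′ :* v₃) :+ :0))))
                   := x₀ :* v₀ :+ (x₁ :* v₁ :+ ((c :* a) :* (x₂ :* v₂) :+ ((e :* b′) :* (x₃ :* v₃) :+ x₄ :* v₄)))) refl
                   x₀ x₁ x₂ x₃ x₄ α β (T 4 α) (T 4 β) γ ε (A i) (TV 1 A i) (TV 2 A i) (TV 3 A i) (TV 4 A i) ⟩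
            sum5 (x₀ * A i) (x₁ * TV 1 A i) (γ * α * (x₂ * TV 2 A i)) (ε * T 4 β * (x₃ * TV 3 A i)) (x₄ * TV 4 A i)
              ≡⟨ cong₂ (λ u w → sum5 (x₀ * A i) (x₁ * TV 1 A i) u w (x₄ * TV 4 A i))
                   (trans (cong (_* (x₂ * TV 2 A i)) (⁻¹-inverseˡ α≢0)) (*-identityˡ _))
                   (trans (cong (_* (x₃ * TV 3 A i)) (⁻¹-inverseˡ T4β≢0)) (*-identityˡ _)) ⟩
            conj x₀ x₁ x₂ x₃ x₄ i ≡⟨ z i ⟩
            0# ∎)
          x₂≡0 : x₂ ≡ 0#
          x₂≡0 = xy≡0⇒x≡0 (⁻¹-≢0 α≢0) (d≡0 2F)
          x₃≡0 : x₃ ≡ 0#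
          x₃≡0 = xy≡0⇒x≡0 (⁻¹-≢0 T4β≢0) (d≡0 4F)
          zeros : x₀ ≡ 0# × x₁ ≡ 0# × x₂ ≡ 0# × x₃ ≡ 0# × x₄ ≡ 0#
          zeros = d≡0 0F
            , trans (solve 3 (λ x e a → x := x :+ :- (:0 :* e :* a)) refl x₁ ε (T 4 α)) (trans (cong (λ w → x₁ + - (w * ε * T 4 α)) (sym x₃≡0)) (d≡0 1F))
            , x₂≡0 , x₃≡0
            , trans (solve 3 (λ x e a → x := x :+ :- (:0 :* e :* a)) refl x₄ γ β) (trans (cong (λ w → x₄ + - (w * γ * β)) (sym x₂≡0)) (d≡0 3F))

        conj-spanning : ∀ v → ∃ λ (x : Fin 5 → K) → v ≐ conj (x 0F) (x 1F) (x 2F) (x 3F) (x 4F)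
        conj-spanning v = let x , v≡ = independent⇒spanning conjugates independent v in x , λ i → trans (v≡ i) (drop-0 _ _ _ _ _)
          where
          conjugates : Fin 5 → Vec 5
          conjugates 0F = A
          conjugates 1F = TV 1 A
          conjugates 2F = TV 2 A
          conjugates 3F = TV 3 A
          conjugates 4F = TV 4 A
          drop-0 : ∀ a b c d e → a + (b + (c + (d + (e + 0#)))) ≡ sum5 a b c d e
          drop-0 = solve 5 (λ a b c d e → a :+ (b :+ (c :+ (d :+ (e :+ :0)))) := a :+ (b :+ (c :+ (d :+ e)))) refl
          independent : LinIndep conjugates
          independent c z = λ { 0F → proj₁ zeros ; 1F → proj₁ (proj₂ zeros) ; 2F → proj₁ (proj₂ (proj₂ zeros))
                              ; 3F → proj₁ (proj₂ (proj₂ (proj₂ zeros))) ; 4F → proj₂ (proj₂ (proj₂ (proj₂ zeros))) }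
            where
            zeros = conj-independent (c 0F) (c 1F) (c 2F) (c 3F) (c 4F) (λ i → trans (sym (drop-0 _ _ _ _ _)) (z i))

        conj-injective : ∀ {x₀ x₁ x₂ x₃ x₄ y₀ y₁ y₂ y₃ y₄} → conj x₀ x₁ x₂ x₃ x₄ ≐ conj y₀ y₁ y₂ y₃ y₄ →
          x₀ ≡ y₀ × x₁ ≡ y₁ × x₂ ≡ y₂ × x₃ ≡ y₃ × x₄ ≡ y₄
        conj-injective {x₀} {x₁} {x₂} {x₃} {x₄} {y₀} {y₁} {y₂} {y₃} {y₄} e =
          let z₀ , z₁ , z₂ , z₃ , z₄ = conj-independent (x₀ + - y₀) (x₁ + - y₁) (x₂ + - y₂) (x₃ + - y₃) (x₄ + - y₄) difference
          in x-y≡0⇒x≡y z₀ , x-y≡0⇒x≡y z₁ , x-y≡0⇒x≡y z₂ , x-y≡0⇒x≡y z₃ , x-y≡0⇒x≡y z₄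
          where
          difference : conj (x₀ + - y₀) (x₁ + - y₁) (x₂ + - y₂) (x₃ + - y₃) (x₄ + - y₄) ≐ zeroV
          difference i = trans (solve 15 (λ x₀ x₁ x₂ x₃ x₄ y₀ y₁ y₂ y₃ y₄ v₀ v₁ v₂ v₃ v₄ →
              (x₀ :+ :- y₀) :* v₀ :+ ((x₁ :+ :- y₁) :* v₁ :+ ((x₂ :+ :- y₂) :* v₂ :+ ((x₃ :+ :- y₃) :* v₃ :+ (x₄ :+ :- y₄) :* v₄)))
              := x₀ :* v₀ :+ (x₁ :* v₁ :+ (x₂ :* v₂ :+ (x₃ :* v₃ :+ x₄ :* v₄))) :+ :- (y₀ :* v₀ :+ (y₁ :* v₁ :+ (y₂ :* v₂ :+ (y₃ :* v₃ :+ y₄ :* v₄))))) refl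
              x₀ x₁ x₂ x₃ x₄ y₀ y₁ y₂ y₃ y₄ (A i) (TV 1 A i) (TV 2 A i) (TV 3 A i) (TV 4 A i))
            (trans (cong (_+ - conj y₀ y₁ y₂ y₃ y₄ i) (e i)) (-‿inverseʳ _))

        T-conj : ∀ x₀ x₁ x₂ x₃ x₄ → TV 1 (conj x₀ x₁ x₂ x₃ x₄) ≐ conj (T 1 x₄) (T 1 x₀) (T 1 x₁) (T 1 x₂) (T 1 x₃)
        T-conj x₀ x₁ x₂ x₃ x₄ i = begin
          T 1 (conj x₀ x₁ x₂ x₃ x₄ i)
            ≡⟨ T-+ 1 _ _ ∙ cong₂ _+_ (T-* 1 _ _) (T-+ 1 _ _ ∙ cong₂ _+_ (step 1 x₁) (T-+ 1 _ _ ∙ cong₂ _+_ (step 2 x₂)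
                 (T-+ 1 _ _ ∙ cong₂ _+_ (step 3 x₃) (T-* 1 _ _ ∙ cong (T 1 x₄ *_) (T-cancel 1 4 refl (A i)))))) ⟩
          sum5 (T 1 x₀ * TV 1 A i) (T 1 x₁ * TV 2 A i) (T 1 x₂ * TV 3 A i) (T 1 x₃ * TV 4 A i) (T 1 x₄ * A i)
            ≡⟨ solve 5 (λ a b c d e → a :+ (b :+ (c :+ (d :+ e))) := e :+ (a :+ (b :+ (c :+ d)))) refl _ _ _ _ _ ⟩
          conj (T 1 x₄) (T 1 x₀) (T 1 x₁) (T 1 x₂) (T 1 x₃) i ∎
          where
          step : ∀ k x → T 1 (x * TV k A i) ≡ T 1 x * TV (suc k) A i
          step k x = T-* 1 _ _ ∙ cong (T 1 x *_) (T-∘ 1 k (A i))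

        δ′ : K
        δ′ = - β * α ⁻¹

        fA₂ : ∀ i → f (TV 2 A) i ≡ δ′ * f (TV 4 A) i
        fA₂ i = *-cancelˡ α≢0 (begin
          α * f (TV 2 A) i
            ≡⟨ solve 3 (λ a b c → a := (a :+ b) :+ :- b) refl (α * f (TV 2 A) i) (β * f (TV 4 A) i) 0# ⟩
          (α * f (TV 2 A) i + β * f (TV 4 A) i) + - (β * f (TV 4 A) i)
            ≡⟨ cong (_+ - (β * f (TV 4 A) i)) (begin
                 α * f (TV 2 A) i + β * f (TV 4 A) i    ≡⟨ cong₂ _+_ (f.homogeneous i α (TV 2 A)) (f.homogeneous i β (TV 4 A)) ⟨
                 f (α ⊙ TV 2 A) i + f (β ⊙ TV 4 A) i    ≡⟨ f.additive i _ _ ⟨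
                 f (α ⊙ TV 2 A ⊕ β ⊙ TV 4 A) i          ≡⟨ f.respects i (λ j → sym (E≡ j)) ⟩
                 f E i                                  ≡⟨ fE i ⟩
                 0#                                     ∎) ⟩
          0# + - (β * f (TV 4 A) i)
            ≡⟨ solve 2 (λ b u → :0 :+ :- (b :* u) := :1 :* (:- b :* u)) refl β (f (TV 4 A) i) ⟩
          1# * (- β * f (TV 4 A) i)
            ≡⟨ cong (_* (- β * f (TV 4 A) i)) (⁻¹-inverseʳ α≢0) ⟨
          α * α ⁻¹ * (- β * f (TV 4 A) i)
            ≡⟨ solve 4 (λ a c b u → a :* c :* (b :* u) := a :* (b :* c :* u)) refl α (α ⁻¹) (- β) (f (TV 4 A) i) ⟩
          α * (δ′ * f (TV 4 A) i) ∎)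

        -- Since f annihilates A and A₁ and sends A₂ to δ′ times f(A₄), its values are combinations
        -- of f(A₃) and f(A₄).
        P : Mat 2
        P i 0F = f (TV 3 A) i
        P i 1F = f (TV 4 A) i

        pair : K → K → Vec 2
        pair a b 0F = a
        pair a b 1F = b

        pair-cong : ∀ {a b a′ b′} → a ≡ a′ → b ≡ b′ → pair a b ≐ pair a′ b′
        pair-cong refl refl _ = refl

        f-conj : ∀ x₀ x₁ x₂ x₃ x₄ → f (conj x₀ x₁ x₂ x₃ x₄) ≐ mulMV P (pair x₃ (x₄ + δ′ * x₂))
        f-conj x₀ x₁ x₂ x₃ x₄ i = begin
          f (conj x₀ x₁ x₂ x₃ x₄) i
            ≡⟨ f.additive i _ _ ∙ cong₂ _+_ (f.homogeneous i x₀ A) (f.additive i _ _ ∙ cong₂ _+_ (f.homogeneous i x₁ (TV 1 A)) (f.additive i _ _ ∙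
                 cong₂ _+_ (f.homogeneous i x₂ (TV 2 A)) (f.additive i _ _ ∙ cong₂ _+_ (f.homogeneous i x₃ (TV 3 A)) (f.homogeneous i x₄ (TV 4 A))))) ⟩
          sum5 (x₀ * f A i) (x₁ * f (TV 1 A) i) (x₂ * f (TV 2 A) i) (x₃ * f (TV 3 A) i) (x₄ * f (TV 4 A) i)
            ≡⟨ cong₂ (λ u w → sum5 (x₀ * u) (x₁ * w) (x₂ * f (TV 2 A) i) (x₃ * f (TV 3 A) i) (x₄ * f (TV 4 A) i)) (fA i) (fA₁ i) ⟩
          sum5 (x₀ * 0#) (x₁ * 0#) (x₂ * f (TV 2 A) i) (x₃ * f (TV 3 A) i) (x₄ * f (TV 4 A) i)
            ≡⟨ cong (λ u → sum5 (x₀ * 0#) (x₁ * 0#) (x₂ * u) (x₃ * f (TV 3 A) i) (x₄ * f (TV 4 A) i)) (fA₂ i) ⟩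
          sum5 (x₀ * 0#) (x₁ * 0#) (x₂ * (δ′ * f (TV 4 A) i)) (x₃ * f (TV 3 A) i) (x₄ * f (TV 4 A) i)
            ≡⟨ solve 8 (λ x₀ x₁ x₂ x₃ x₄ d u w → x₀ :* :0 :+ (x₁ :* :0 :+ (x₂ :* (d :* w) :+ (x₃ :* u :+ x₄ :* w)))
                 := u :* x₃ :+ (w :* (x₄ :+ d :* x₂) :+ :0)) refl x₀ x₁ x₂ x₃ x₄ δ′ (f (TV 3 A) i) (f (TV 4 A) i) ⟩
          mulMV P (pair x₃ (x₄ + δ′ * x₂)) i ∎

        preimage : ∀ v → ∃ λ r → f v ≐ mulMV P r
        preimage v = let x , v≡ = conj-spanning v in
          pair (x 3F) (x 4F + δ′ * x 2F) , λ i → trans (f.respects i v≡) (f-conj (x 0F) (x 1F) (x 2F) (x 3F) (x 4F) i)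

        -- The map f reaches both unit vectors, at l₀ and l₁, and all its values lie in the image of
        -- P.
        detP≢0 : det₂ P ≢ 0#
        detP≢0 = surjective⇒det≢0 P (proj₁ (preimage l₀)) (proj₁ (preimage l₁))
          (λ i → trans (sym (proj₂ (preimage l₀) i)) (f-l₀ i)) (λ i → trans (sym (proj₂ (preimage l₁) i)) (f-l₁ i))

        Q : Mat 2
        Q = inverse₂ P detP≢0

        QP : ∀ v → mulMV Q (mulMV P v) ≐ v
        QP = inverse₂-leftInverse P detP≢0

        PQ : ∀ v → mulMV P (mulMV Q v) ≐ v
        PQ = inverse₂-rightInverse P detP≢0

        -- On Σ the coordinates with respect to A, A₁, …, A₄ are the conjugates of one of them.
        on-Σ : ∀ u → (∀ i → InFq (u i)) → NonZero u → ∃ λ x → x ≢ 0# × f u ≐ mulMV P (pair x (h δ′ x))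
        on-Σ u u∈Fq u≢0 = x 3F , x₃≢0 , λ i → trans (f.respects i u≡) (trans (f-conj (x 0F) (x 1F) (x 2F) (x 3F) (x 4F) i)
            (mulMV-cong P (pair-cong refl (cong₂ (λ y z → y + δ′ * z) x₄≡ x₂≡)) i))
          where
          x = proj₁ (conj-spanning u)
          u≡ = proj₂ (conj-spanning u)
          -- As τ fixes u and shifts the basis cyclically, each coordinate is τ of the preceding
          -- one; all are governed by the coordinate at A₃, which f turns into the first coordinate.
          shifted = conj-injective {x 0F} {x 1F} {x 2F} {x 3F} {x 4F} (λ i → trans (sym (u≡ i))
            (trans (sym (InFq⇒T-fixed (u∈Fq i) 1)) (trans (cong (T 1) (u≡ i)) (T-conj (x 0F) (x 1F) (x 2F) (x 3F) (x 4F) i))))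
          x₀≡ : x 0F ≡ T 1 (x 4F)
          x₀≡ = proj₁ shifted
          x₁≡ : x 1F ≡ T 1 (x 0F)
          x₁≡ = proj₁ (proj₂ shifted)
          x₃≡ : x 3F ≡ T 1 (x 2F)
          x₃≡ = proj₁ (proj₂ (proj₂ (proj₂ shifted)))
          x₄≡ : x 4F ≡ T 1 (x 3F)
          x₄≡ = proj₂ (proj₂ (proj₂ (proj₂ shifted)))
          x₂≡ : x 2F ≡ T 4 (x 3F)
          x₂≡ = sym (trans (cong (T 4) x₃≡) (T-cancel 4 1 refl (x 2F)))
          vanish : ∀ {y z} k → y ≡ T k z → z ≡ 0# → y ≡ 0#
          vanish k e refl = trans e (T-0 k)
          x₃≢0 : x 3F ≢ 0#
          x₃≢0 z₃ = u≢0 (λ i → trans (u≡ i) (all-zero i))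
            where
            z₄ = vanish 1 x₄≡ z₃
            z₀ = vanish 1 x₀≡ z₄
            z₁ = vanish 1 x₁≡ z₀
            z₂ = vanish 4 x₂≡ z₃
            all-zero : ∀ i → conj (x 0F) (x 1F) (x 2F) (x 3F) (x 4F) i ≡ 0#
            all-zero i = trans (cong₂ _+_ (times z₀ (A i)) (cong₂ _+_ (times z₁ (TV 1 A i)) (cong₂ _+_ (times z₂ (TV 2 A i)) (cong₂ _+_ (times z₃ (TV 3 A i)) (times z₄ (TV 4 A i))))))
              (solve 0 (:0 :+ (:0 :+ (:0 :+ (:0 :+ :0))) := :0) refl)
              where
              times : ∀ {y} → y ≡ 0# → ∀ b → y * b ≡ 0#
              times refl b = zeroˡ b

        from-Σ : ∀ x → x ≢ 0# → ∃ λ u → (∀ i → InFq (u i)) × NonZero u × f u ≐ mulMV P (pair x (h δ′ x))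
        from-Σ x x≢0 = u , (λ i → T-1-fixed⇒InFq (trans (T-conj (T 2 x) (T 3 x) (T 4 x) (T 0 x) (T 1 x) i) (rotate i)))
          , (λ z → x≢0 (trans (sym (T-id x)) (proj₁ (proj₂ (proj₂ (proj₂ (conj-independent _ _ _ _ _ z)))))))
          , λ i → trans (f-conj (T 2 x) (T 3 x) (T 4 x) (T 0 x) (T 1 x) i) (mulMV-cong P (pair-cong (T-id x) refl) i)
          where
          -- The powers of τ are arranged so that u is fixed by τ and has coordinate x at A₃.
          u = conj (T 2 x) (T 3 x) (T 4 x) (T 0 x) (T 1 x)
          rotate : ∀ i → conj (T 1 (T 1 x)) (T 1 (T 2 x)) (T 1 (T 3 x)) (T 1 (T 4 x)) (T 1 (T 0 x)) i ≡ u i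
          rotate i = cong₂ _+_ (cong (_* A i) (T-∘ 1 1 x)) (cong₂ _+_ (cong (_* TV 1 A i) (T-∘ 1 2 x)) (cong₂ _+_ (cong (_* TV 2 A i) (T-∘ 1 3 x))
            (cong₂ _+_ (cong (_* TV 3 A i) (T-wrap 1 4 0 refl x)) (cong (_* TV 4 A i) (T-∘ 1 0 x)))))

        h≡ : ∀ x → h δ′ x ≡ x ^ (q ℕ.^ t) + δ′ * x ^ (q ℕ.^ (5 ℕ.∸ t))
        h≡ x = cong₂ (λ y z → y + δ′ * z) (sym (Fr-t t-exp x)) (sym (Fr-5∸t t-exp x))

        Q-proportional : ∀ {v k r} → (∀ i → v i ≡ k * mulMV P r i) → ∀ i → mulMV Q v i ≡ k * r i
        Q-proportional {v} {k} {r} e i = trans (mulMV-cong Q e i) (trans (IsLinear.homogeneous (mulMV-linear Q i) k (mulMV P r)) (cong (k *_) (QP r i)))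

        Q-≢0 : ∀ {v} → NonZero v → NonZero (mulMV Q v)
        Q-≢0 {v} v≢0 z = v≢0 (λ i → trans (sym (PQ v i)) (IsLinear.at-0 (mulMV-linear P i) z))

        norm≢1 : Norm δ′ ≢ 1#
        norm≢1 = let ms , uniq , length≡ , values = slopes (LinearSet f) (mulMV Q) (mulMV-linear Q) Q-inj Q₀≢0 scattered in
          scattered⇒norm≢1 {δ′} uniq length≡ (All.map value values) p₀∉Fq
          where
          coordinates : ∀ w → LinearSet f w → ∃₂ λ k x → k ≢ 0# × x ≢ 0# × (∀ i → mulMV Q w i ≡ k * pair x (h δ′ x) i)
          coordinates w (_ , u , u∈Fq , u≢0 , k , k≢0 , w≡) = let x , x≢0 , fu≡ = on-Σ u u∈Fq u≢0 in
            k , x , k≢0 , x≢0 , Q-proportional (λ i → trans (w≡ i) (cong (k *_) (fu≡ i)))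
          Q-inj : ∀ w → mulMV Q w ≐ zeroV → w ≐ zeroV
          Q-inj w z i = trans (sym (PQ w i)) (IsLinear.at-0 (mulMV-linear P i) z)
          Q₀≢0 : ∀ w → LinearSet f w → mulMV Q w 0F ≢ 0#
          Q₀≢0 w w∈L e = let k , x , k≢0 , x≢0 , eq = coordinates w w∈L in *-≢0 k≢0 x≢0 (trans (sym (eq 0F)) e)
          value : ∀ {m} → (∃ λ w → LinearSet f w × mulMV Q w 1F ≡ m * mulMV Q w 0F) → ∃ λ x → x ≢ 0# × h δ′ x ≡ m * x
          value {m} (w , w∈L , e) = let k , x , k≢0 , x≢0 , eq = coordinates w w∈L in x , x≢0 , *-cancelˡ k≢0
            (trans (sym (eq 1F)) (trans e (trans (cong (m *_) (eq 0F)) (solve 3 (λ m k x → m :* (k :* x) := k :* (m :* x)) refl m k x))))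

        equivalence : Semilinear 2
        equivalence = record { mat = Q ; mat-inv = P , QP , PQ ; aut = identity }

      sufficient : IsLPType (LinearSet f)
      sufficient = t , δ′ , validS t-exp , Norm-≢0 δ′≢0 , norm≢1 , equivalence , to , from
        where
        δ′≢0 : δ′ ≢ 0#
        δ′≢0 = *-≢0 (-≢0 β≢0) (⁻¹-≢0 α≢0)
        to : ∀ v → LinearSet f v → LPSet t δ′ (mulMV Q v)
        to v (v≢0 , u , u∈Fq , u≢0 , k , k≢0 , v≡) = let x , x≢0 , fu≡ = on-Σ u u∈Fq u≢0
                                                         eq = Q-proportional {v} {k} {pair x (h δ′ x)} (λ i → trans (v≡ i) (cong (k *_) (fu≡ i))) in
          Q-≢0 v≢0 , x , x≢0 , k , k≢0 , λ { 0F → eq 0F ; 1F → trans (eq 1F) (cong (k *_) (h≡ x)) }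
        from : ∀ w → LPSet t δ′ w → ∃ λ v → LinearSet f v × Proportional w (mulMV Q v)
        from w (_ , x , x≢0 , k , k≢0 , w≡) = let u , u∈Fq , u≢0 , fu≡ = from-Σ x x≢0
                                                  eq = λ i → trans (mulMV-cong Q fu≡ i) (QP (pair x (h δ′ x)) i) in
          f u , ((λ z → x≢0 (trans (sym (eq 0F)) (IsLinear.at-0 (mulMV-linear Q 0F) z))) , u , u∈Fq , u≢0 , 1# , 1≢0 , λ i → sym (*-identityˡ _))
          , k , k≢0 , λ { 0F → trans (w≡ 0F) (cong (k *_) (sym (eq 0F))) ; 1F → trans (w≡ 1F) (cong (k *_) (trans (sym (h≡ x)) (sym (eq 1F)))) }

-- From LP type to the incidence

module Necessity (𝔽 : FiniteField) (q : ℕ) (q-pp : IsPrimePower q) (order≡ : FiniteField.order 𝔽 ≡ q ℕ.^ 5) where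
  open FieldTheory 𝔽
  open Geometry 𝔽 q
  open Powers 𝔽 q
  open Polynomials 𝔽 q using (module Multilinear)
  open LinearAlgebra 𝔽 q
  open Frobenius 𝔽 q q-pp order≡
  open Multilinear 2≤q using (size)
  open Dickson 𝔽 q q-pp order≡
  open Shape 𝔽 q q-pp order≡
  open NormOne 𝔽 q q-pp order≡
  open LinearSets 𝔽 q q-pp order≡
  open ≡-Reasoning

  FrV : ∀ {n} → ℕ → Vec n → Vec n
  FrV k v i = Fr k (v i)

  module AutomorphismInverse (α : Automorphism) where
    open Automorphism α public

    f-injective : ∀ {x y} → f x ≡ f y → x ≡ y
    f-injective {x} {y} e = trans (sym (gf x)) (trans (cong g e) (gf y))

    f-0 : f 0# ≡ 0#
    f-0 = begin
      f 0#                   ≡⟨ solve 1 (λ a → a := a :+ a :+ :- a) refl (f 0#) ⟩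
      f 0# + f 0# + - f 0#   ≡⟨ cong (_+ - f 0#) (trans (sym (f-+ 0# 0#)) (cong f (+-identityˡ 0#))) ⟩
      f 0# + - f 0#          ≡⟨ -‿inverseʳ _ ⟩
      0#                     ∎

    g-+ : ∀ x y → g (x + y) ≡ g x + g y
    g-+ x y = f-injective (trans (fg _) (sym (trans (f-+ _ _) (cong₂ _+_ (fg x) (fg y)))))

    g-* : ∀ x y → g (x * y) ≡ g x * g y
    g-* x y = f-injective (trans (fg _) (sym (trans (f-* _ _) (cong₂ _*_ (fg x) (fg y)))))

    g-0 : g 0# ≡ 0#
    g-0 = f-injective (trans (fg 0#) (sym f-0))

    g-1 : g 1# ≡ 1#
    g-1 = f-injective (trans (fg 1#) (sym f-1))

    g-^ : ∀ x n → g (x ^ n) ≡ g x ^ n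
    g-^ x zero = g-1
    g-^ x (suc n) = trans (g-* x (x ^ n)) (cong (g x *_) (g-^ x n))

    f-≢0 : ∀ {x} → x ≢ 0# → f x ≢ 0#
    f-≢0 x≢0 e = x≢0 (f-injective (trans e (sym f-0)))

    g-≢0 : ∀ {x} → x ≢ 0# → g x ≢ 0#
    g-≢0 {x} x≢0 e = x≢0 (trans (sym (fg x)) (trans (cong f e) f-0))

  -- Fr k ∘ ξ ∘ FrV (5 ∸ k) is the linear form whose coefficients are those of ξ raised to the power q^k.
  Shaped : (Vec 5 → Vec 2) → (Vec 5 → K) → ℕ → Set
  Shaped f ξ s = ∃₂ λ a b → a ≢ 0# × b ≢ 0# ×
    (∀ X → f X ≐ zeroV → a * Fr s (ξ (FrV (5 ℕ.∸ s) X)) + b * Fr (5 ℕ.∸ s) (ξ (FrV s X)) ≡ 0#)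

  module _ {p₀} (p₀∉Fq : ¬ InFq p₀)
    {f : Vec 5 → Vec 2} (f-lin : ∀ i → IsLinear (λ v → f v i))
    (f-nonzero : ∀ u → (∀ i → InFq (u i)) → NonZero u → NonZero (f u))
    (scattered : MaxScattered (LinearSet f)) where

    private
      module f (i : Fin 2) = IsLinear (f-lin i)

    module _ {s} (s-exp : Exponent s) {δ₀} (Nδ≢0 : Norm δ₀ ≢ 0#) (equiv : PΓLEquivalent (LinearSet f) (LPSet s δ₀)) where
      private
        C = Semilinear.mat (proj₁ equiv)
        C⁻¹ = proj₁ (Semilinear.mat-inv (proj₁ equiv))
        C⁻¹C = proj₂ (proj₂ (Semilinear.mat-inv (proj₁ equiv)))
        module α = AutomorphismInverse (Semilinear.aut (proj₁ equiv))

        -- The equivalence followed by the inverse of its automorphism. This is linear, and since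
        -- automorphisms commute with powers it still maps into an LP set of exponent s, with δ₁ in
        -- place of δ₀.
        ζ : Vec 2 → Vec 2
        ζ w i = α.g (mulMV C (λ j → α.f (w j)) i)

        ζ-lin : ∀ i → IsLinear (λ w → ζ w i)
        ζ-lin i = record
          { respects = λ e → cong α.g (mulMV-cong C (λ j → cong α.f (e j)) i)
          ; additive = λ v w → trans (cong α.g (trans (mulMV-cong C (λ j → α.f-+ (v j) (w j)) i)
              (IsLinear.additive (mulMV-linear C i) (λ j → α.f (v j)) (λ j → α.f (w j))))) (α.g-+ _ _)
          ; homogeneous = λ c v → trans (cong α.g (trans (mulMV-cong C (λ j → α.f-* c (v j)) i)
              (IsLinear.homogeneous (mulMV-linear C i) (α.f c) (λ j → α.f (v j))))) (trans (α.g-* _ _) (cong (_* ζ v i) (α.gf c))) }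

        module ζ (i : Fin 2) = IsLinear (ζ-lin i)

        ζ-inj : ∀ w → ζ w ≐ zeroV → w ≐ zeroV
        ζ-inj w z i = begin
          w i            ≡⟨ α.gf (w i) ⟨
          α.g (α.f (w i))
            ≡⟨ cong α.g (C⁻¹C (λ j → α.f (w j)) i) ⟨
          α.g (mulMV C⁻¹ (mulMV C (λ j → α.f (w j))) i)
            ≡⟨ cong α.g (IsLinear.at-0 (mulMV-linear C⁻¹ i) (λ j → trans (sym (α.fg _)) (trans (cong α.f (z j)) α.f-0))) ⟩
          α.g 0#         ≡⟨ α.g-0 ⟩
          0#             ∎

        ξ η : Vec 5 → K
        ξ v = ζ (f v) 0F
        η v = ζ (f v) 1F

        ζf-lin : ∀ i → IsLinear (λ v → ζ (f v) i)
        ζf-lin i = record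
          { respects = λ e → ζ.respects i (λ j → f.respects j e)
          ; additive = λ v w → trans (ζ.respects i (λ j → f.additive j v w)) (ζ.additive i (f v) (f w))
          ; homogeneous = λ c v → trans (ζ.respects i (λ j → f.homogeneous j c v)) (ζ.homogeneous i c (f v)) }

        δ₁ = α.g δ₀

        b′ : ∀ {s} → Exponent s → Fin 5 → K
        b′ one 1F = 1#
        b′ one 4F = δ₁
        b′ two 2F = 1#
        b′ two 3F = δ₁
        b′ three 3F = 1#
        b′ three 2F = δ₁
        b′ four 4F = 1#
        b′ four 1F = δ₁
        b′ _ _ = 0#

        qpoly-b′ : ∀ {s} (e : Exponent s) y → qpoly (b′ e) y ≡ Fr s y + δ₁ * Fr (5 ℕ.∸ s) y
        qpoly-b′ one y = solve 6 (λ d a b c e f → :0 :* a :+ (:1 :* b :+ (:0 :* c :+ (:0 :* e :+ d :* f))) := b :+ d :* f) refl δ₁ (Fr 0 y) (Fr 1 y) (Fr 2 y) (Fr 3 y) (Fr 4 y)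
        qpoly-b′ two y = solve 6 (λ d a b c e f → :0 :* a :+ (:0 :* b :+ (:1 :* c :+ (d :* e :+ :0 :* f))) := c :+ d :* e) refl δ₁ (Fr 0 y) (Fr 1 y) (Fr 2 y) (Fr 3 y) (Fr 4 y)
        qpoly-b′ three y = solve 6 (λ d a b c e f → :0 :* a :+ (:0 :* b :+ (d :* c :+ (:1 :* e :+ :0 :* f))) := e :+ d :* c) refl δ₁ (Fr 0 y) (Fr 1 y) (Fr 2 y) (Fr 3 y) (Fr 4 y)
        qpoly-b′ four y = solve 6 (λ d a b c e f → :0 :* a :+ (d :* b :+ (:0 :* c :+ (:0 :* e :+ :1 :* f))) := f :+ d :* b) refl δ₁ (Fr 0 y) (Fr 1 y) (Fr 2 y) (Fr 3 y) (Fr 4 y)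

        in-LP : ∀ w → LinearSet f w → ∃₂ λ k y → k ≢ 0# × y ≢ 0# × ζ w 0F ≡ k * y × ζ w 1F ≡ k * qpoly (b′ s-exp) y
        in-LP w w∈L with proj₁ (proj₂ equiv) w w∈L
        ... | _ , x , x≢0 , k , k≢0 , eq = α.g k , α.g x , α.g-≢0 k≢0 , α.g-≢0 x≢0
          , trans (cong α.g (eq 0F)) (α.g-* k x)
          , (begin
            ζ w 1F                                                               ≡⟨ cong α.g (eq 1F) ⟩
            α.g (k * (x ^ (q ℕ.^ s) + δ₀ * x ^ (q ℕ.^ (5 ℕ.∸ s))))               ≡⟨ α.g-* _ _ ⟩
            α.g k * α.g (x ^ (q ℕ.^ s) + δ₀ * x ^ (q ℕ.^ (5 ℕ.∸ s)))
              ≡⟨ cong (α.g k *_) (trans (α.g-+ _ _) (cong₂ _+_ (α.g-^ x (q ℕ.^ s)) (trans (α.g-* _ _) (cong (δ₁ *_) (α.g-^ x (q ℕ.^ (5 ℕ.∸ s))))))) ⟩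
            α.g k * (Fr s (α.g x) + δ₁ * Fr (5 ℕ.∸ s) (α.g x))                   ≡⟨ cong (α.g k *_) (qpoly-b′ s-exp (α.g x)) ⟨
            α.g k * qpoly (b′ s-exp) (α.g x)                                     ∎)

        ζ₀≢0 : ∀ w → LinearSet f w → ζ w 0F ≢ 0#
        ζ₀≢0 w w∈L e = let k , y , k≢0 , y≢0 , e₀ , _ = in-LP w w∈L in *-≢0 k≢0 y≢0 (trans (sym e₀) e)

        ξ-nonzero : ∀ u → (∀ i → InFq (u i)) → NonZero u → ξ u ≢ 0#
        ξ-nonzero u u∈Fq u≢0 = ζ₀≢0 (f u) (f-nonzero u u∈Fq u≢0 , u , u∈Fq , u≢0 , 1# , 1≢0 , λ i → sym (*-identityˡ _))

        open ConjugateVectors one using (conjugates-injective)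

        -- The conjugate forms of ξ. At vectors over 𝔽_q the form `φ k` takes the value ξ^(q^k), so
        -- a combination of these forms becomes a q-polynomial in ξ.
        φ : Fin 5 → Vec 5 → K
        φ k v = Fr (Fin.toℕ k) (ξ (FrV (5 ℕ.∸ Fin.toℕ k) v))

        φ-lin : ∀ k → IsLinear (φ k)
        φ-lin k = record
          { respects = λ e → cong (Fr i) (ξ.respects (λ l → cong (Fr j) (e l)))
          ; additive = λ v w → trans (cong (Fr i) (trans (ξ.respects (λ l → Fr-+ j (v l) (w l))) (ξ.additive _ _))) (Fr-+ i _ _)
          ; homogeneous = λ c v → trans (cong (Fr i) (trans (ξ.respects (λ l → Fr-* j c (v l))) (ξ.homogeneous _ _)))
              (trans (Fr-* i _ _) (cong (_* φ k v) (trans (Fr-∘ i j c) (trans (cong (λ n → Fr n c) (ℕ.m+[n∸m]≡n (ℕ.<⇒≤ (Fin.toℕ<n k)))) (Fr-5 c))))) }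
          where
          module ξ = IsLinear (ζf-lin 0F)
          i = Fin.toℕ k
          j = 5 ℕ.∸ Fin.toℕ k

        φ-inj : ∀ v → (∀ k → φ k v ≡ 0#) → v ≐ zeroV
        φ-inj v z = conjugates-injective (ζf-lin 0F) ξ-nonzero p₀∉Fq v
          (trans (IsLinear.respects (ζf-lin 0F) (λ i → trans (Fr-id (v i)) (sym (Fr-5 (v i))))) (Fr≡0⇒≡0 0 (z 0F)))
          (Fr≡0⇒≡0 4 (z 4F)) (Fr≡0⇒≡0 3 (z 3F)) (Fr≡0⇒≡0 2 (z 2F)) (Fr≡0⇒≡0 1 (z 1F))

        η-expansion : ∃ λ (b : Fin 5 → K) → ∀ v → η v ≡ sumF 5 (λ k → b k * φ k v)
        η-expansion = forms-spanning φ φ-lin φ-inj (ζf-lin 1F)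

        b : Fin 5 → K
        b = proj₁ η-expansion

        η≡qpoly : ∀ u → (∀ i → InFq (u i)) → η u ≡ qpoly b (ξ u)
        η≡qpoly u u∈Fq = trans (proj₂ η-expansion u) (trans
          (cong₂ _+_ (term 0F) (cong₂ _+_ (term 1F) (cong₂ _+_ (term 2F) (cong₂ _+_ (term 3F) (cong (_+ 0#) (term 4F))))))
          (solve 5 (λ a b c d e → a :+ (b :+ (c :+ (d :+ (e :+ :0)))) := a :+ (b :+ (c :+ (d :+ e)))) refl _ _ _ _ _))
          where
          term : ∀ k → b k * φ k u ≡ b k * Fr (Fin.toℕ k) (ξ u)
          term k = cong (λ z → b k * Fr (Fin.toℕ k) z) (IsLinear.respects (ζf-lin 0F) (λ i → InFq⇒Fr-fixed (u∈Fq i) (5 ℕ.∸ Fin.toℕ k)))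

        eigen : ∀ {m} → (∃ λ w → LinearSet f w × ζ w 1F ≡ m * ζ w 0F) →
          (∃ λ x → x ≢ 0# × qpoly b x ≡ m * x) × (∃ λ x → x ≢ 0# × qpoly (b′ s-exp) x ≡ m * x)
        eigen {m} (w , w∈L@(_ , u , u∈Fq , u≢0 , k , k≢0 , w≡) , e) =
          (ξ u , ξ-nonzero u u∈Fq u≢0 , trans (sym (η≡qpoly u u∈Fq)) (*-cancelˡ k≢0 (ratio (ζk 1F) (ζk 0F))))
          , let k′ , y , k′≢0 , y≢0 , e₀ , e₁ = in-LP w w∈L in y , y≢0 , *-cancelˡ k′≢0 (ratio e₁ e₀)
          where
          ζk : ∀ i → ζ w i ≡ k * ζ (f u) i
          ζk i = trans (ζ.respects i w≡) (ζ.homogeneous i k (f u))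
          ratio : ∀ {k x y} → ζ w 1F ≡ k * y → ζ w 0F ≡ k * x → k * y ≡ k * (m * x)
          ratio {k} {x} {y} e₁ e₀ = trans (sym e₁) (trans e (trans (cong (m *_) e₀) (solve 3 (λ m k x → m :* (k :* x) := k :* (m :* x)) refl m k x)))

        size≡ : size 5 ≡ suc N
        size≡ = arith q (q ℕ.^ 2) (q ℕ.^ 3) (q ℕ.^ 4) (ℕ.^-identityʳ q)
          where
          arith′ : ∀ q a b c → c ℕ.+ (b ℕ.+ (a ℕ.+ (q ℕ.+ (1 ℕ.+ 1)))) ≡ suc (1 ℕ.+ q ℕ.+ a ℕ.+ b ℕ.+ c)
          arith′ = solve-∀
          arith : ∀ q a b c {q₁} → q₁ ≡ q → c ℕ.+ (b ℕ.+ (a ℕ.+ (q₁ ℕ.+ (1 ℕ.+ 1)))) ≡ suc (1 ℕ.+ q ℕ.+ a ℕ.+ b ℕ.+ c)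
          arith q a b c refl = arith′ q a b c

        agree : ∀ bs → length bs ≡ 5 → coefficient b bs ≡ coefficient (b′ s-exp) bs
        agree = let ms , uniq , length≡ , values = slopes (LinearSet f) ζ ζ-lin ζ-inj ζ₀≢0 scattered in
          coefficients-agree b (b′ s-exp) ms uniq (ℕ.≤-reflexive (trans size≡ (cong suc (sym length≡)))) (All.map eigen values)

        δ₁≢0 : δ₁ ≢ 0#
        δ₁≢0 = α.g-≢0 (λ e → Nδ≢0 (trans (cong Norm e) (zeroˡ _)))

        vanishing : ∀ i X → f X ≐ zeroV → ζ (f X) i ≡ 0#
        vanishing i X = ζ.at-0 i

        -- The form η vanishes on the kernel of f, and only two terms of its expansion in the
        -- conjugates of ξ are left.
        expansion-14 : b 0F ≡ 0# → (b 2F ≡ 0# × b 3F ≡ 0#) × b 1F ≢ 0# × b 4F ≢ 0# → Shaped f ξ 1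
        expansion-14 b₀ ((b₂ , b₃) , b₁≢0 , b₄≢0) = b 1F , b 4F , b₁≢0 , b₄≢0 , λ X fX → trans
          (solve 7 (λ p r x y z b₁ b₄ → b₁ :* p :+ b₄ :* r := :0 :* x :+ (b₁ :* p :+ (:0 :* y :+ (:0 :* z :+ (b₄ :* r :+ :0))))) refl
            (φ 1F X) (φ 4F X) (φ 0F X) (φ 2F X) (φ 3F X) (b 1F) (b 4F))
          (trans (cong₂ (λ u w → u * φ 0F X + (b 1F * φ 1F X + w)) (sym b₀)
             (cong₂ (λ u w → u * φ 2F X + (w * φ 3F X + (b 4F * φ 4F X + 0#))) (sym b₂) (sym b₃)))
            (trans (sym (proj₂ η-expansion X)) (vanishing 1F X fX)))

        expansion-23 : b 0F ≡ 0# → (b 1F ≡ 0# × b 4F ≡ 0#) × b 2F ≢ 0# × b 3F ≢ 0# → Shaped f ξ 2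
        expansion-23 b₀ ((b₁ , b₄) , b₂≢0 , b₃≢0) = b 2F , b 3F , b₂≢0 , b₃≢0 , λ X fX → trans
          (solve 7 (λ p r x y z b₂ b₃ → b₂ :* p :+ b₃ :* r := :0 :* x :+ (:0 :* y :+ (b₂ :* p :+ (b₃ :* r :+ (:0 :* z :+ :0))))) refl
            (φ 2F X) (φ 3F X) (φ 0F X) (φ 1F X) (φ 4F X) (b 2F) (b 3F))
          (trans (cong₂ (λ u w → u * φ 0F X + w) (sym b₀)
             (cong₂ (λ u w → u * φ 1F X + (b 2F * φ 2F X + (b 3F * φ 3F X + (w * φ 4F X + 0#)))) (sym b₁) (sym b₄)))
            (trans (sym (proj₂ η-expansion X)) (vanishing 1F X fX)))

        -- The exponents s and 5 - s involve the same two monomials and merely exchange the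
        -- coefficients 1 and δ₁.
        shape : ∀ {s} (e : Exponent s) → (∀ bs → length bs ≡ 5 → coefficient b bs ≡ coefficient (b′ e) bs) → Shaped f ξ 1 ⊎ Shaped f ξ 2
        shape one agree = inj₁ (expansion-14 (b₀≡0 agree refl) (shape-14 agree refl refl refl 1≢0 δ₁≢0))
        shape four agree = inj₁ (expansion-14 (b₀≡0 agree refl) (shape-14 agree refl refl refl δ₁≢0 1≢0))
        shape two agree = inj₂ (expansion-23 (b₀≡0 agree refl) (shape-23 agree refl refl refl 1≢0 δ₁≢0))
        shape three agree = inj₂ (expansion-23 (b₀≡0 agree refl) (shape-23 agree refl refl refl δ₁≢0 1≢0))

      LP⇒shaped : ∃ λ (ξ : Vec 5 → K) → IsLinear ξ × (∀ u → (∀ i → InFq (u i)) → NonZero u → ξ u ≢ 0#) ×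
        (∀ X → f X ≐ zeroV → ξ X ≡ 0#) × (Shaped f ξ 1 ⊎ Shaped f ξ 2)
      LP⇒shaped = ξ , ζf-lin 0F , ξ-nonzero , vanishing 0F , shape s-exp agree

  module _ {t} (t-exp : Exponent t) {p₀} (p₀∉Fq : ¬ InFq p₀) {f : Vec 5 → Vec 2}
    {ξ : Vec 5 → K} (ξ-lin : IsLinear ξ) (ξ-nonzero : ∀ u → (∀ i → InFq (u i)) → NonZero u → ξ u ≢ 0#)
    (ξ-vanishes : ∀ X → f X ≐ zeroV → ξ X ≡ 0#) where
    open ConjugateVectors t-exp

    module _ {a b} (a≢0 : a ≢ 0#) (b≢0 : b ≢ 0#)
      (shaped : ∀ X → f X ≐ zeroV → a * T 1 (ξ (TV 4 X)) + b * T 4 (ξ (TV 1 X)) ≡ 0#)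
      {A B E : Vec 5} (A≢0 : NonZero A) (fA : f A ≐ zeroV) (fA₁ : f (TV 1 A) ≐ zeroV) (fB : f B ≐ zeroV) (fB₂ : f (TV 2 B) ≐ zeroV)
      {x y z w : K} (E≡ : ∀ i → E i ≡ x * A i + y * B i) (E≡′ : ∀ i → E i ≡ z * TV 1 A i + w * TV 2 B i) where
      private
        module ξ = IsLinear ξ-lin

        wrap : ∀ j k l → j ℕ.+ k ≡ 5 ℕ.+ l → ∀ X → ξ (TV j (TV k X)) ≡ ξ (TV l X)
        wrap j k l e X = ξ.respects (λ i → trans (T-∘ j k (X i)) (trans (cong (λ n → T n (X i)) e) (T-5+ l (X i))))

        compose : ∀ j k X → ξ (TV j (TV k X)) ≡ ξ (TV (j ℕ.+ k) X)
        compose j k X = ξ.respects (λ i → T-∘ j k (X i))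

        ξ₀ : ∀ X → ξ (TV 0 X) ≡ ξ X
        ξ₀ X = ξ.respects (λ i → T-id (X i))

        linear : ∀ j (c d : K) (X Y Z : Vec 5) → (∀ i → Z i ≡ c * X i + d * Y i) → ξ (TV j Z) ≡ T j c * ξ (TV j X) + T j d * ξ (TV j Y)
        linear j c d X Y Z e = trans (ξ.respects (λ i → trans (cong (T j) (e i)) (trans (T-+ j _ _) (cong₂ _+_ (T-* j _ _) (T-* j _ _)))))
          (trans (ξ.additive (T j c ⊙ TV j X) (T j d ⊙ TV j Y)) (cong₂ _+_ (ξ.homogeneous (T j c) (TV j X)) (ξ.homogeneous (T j d) (TV j Y))))

        linear-0 : ∀ j (c d : K) (X Y Z : Vec 5) → (∀ i → Z i ≡ c * X i + d * Y i) → ξ (TV j X) ≡ 0# → ξ (TV j Y) ≡ 0# → ξ (TV j Z) ≡ 0#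
        linear-0 j c d X Y Z e p r = trans (linear j c d X Y Z e) (sum≡0 (scale≡0 (T j c) p) (scale≡0 (T j d) r))

        A₀ : ξ (TV 0 A) ≡ 0#
        A₀ = trans (ξ₀ A) (ξ-vanishes A fA)

        A₁ : ξ (TV 1 A) ≡ 0#
        A₁ = ξ-vanishes (TV 1 A) fA₁

        -- In `shaped` at A the second term contains ξ(A₁) = 0. In the same way, for A₂ below, the
        -- first term of `shaped` at A₁ contains ξ(A) = 0.
        A₄ : ξ (TV 4 A) ≡ 0#
        A₄ = T≡0⇒≡0 1 (xy≡0⇒y≡0 a≢0 (trans (sym (+-identityʳ _))
          (trans (cong (a * T 1 (ξ (TV 4 A)) +_) (sym (scale≡0 b (trans (cong (T 4) A₁) (T-0 4))))) (shaped A fA))))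

        A₂ : ξ (TV 2 A) ≡ 0#
        A₂ = T≡0⇒≡0 4 (xy≡0⇒y≡0 b≢0 (trans (sym (+-identityˡ _)) (trans
          (cong₂ _+_ (sym (scale≡0 a (trans (cong (T 1) (trans (wrap 4 1 0 refl A) A₀)) (T-0 1)))) (cong (λ v → b * T 4 v) (sym (compose 1 1 A))))
          (shaped (TV 1 A) fA₁))))

        A₃≢0 : ξ (TV 3 A) ≢ 0#
        A₃≢0 A₃ = A≢0 (conjugates-injective ξ-lin ξ-nonzero p₀∉Fq A A₀ A₁ A₂ A₃ A₄)

        B₀ : ξ (TV 0 B) ≡ 0#
        B₀ = trans (ξ₀ B) (ξ-vanishes B fB)

        B₂ : ξ (TV 2 B) ≡ 0#
        B₂ = ξ-vanishes (TV 2 B) fB₂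

        -- Each conjugate uses the line on which both points are known to give 0: AB for the indices
        -- 0 and 2, and A₁B₂ for the index 3, where A₄ and B₅ = B appear.
        E₀ : ξ (TV 0 E) ≡ 0#
        E₀ = linear-0 0 x y A B E E≡ A₀ B₀

        E₂ : ξ (TV 2 E) ≡ 0#
        E₂ = linear-0 2 x y A B E E≡ A₂ B₂

        E₃ : ξ (TV 3 E) ≡ 0#
        E₃ = linear-0 3 z w (TV 1 A) (TV 2 B) E E≡′ (trans (compose 3 1 A) A₄) (trans (wrap 3 2 0 refl B) B₀)

        κ = ξ (TV 3 A)
        -- Among the conjugates of A only A₃ has nonzero ξ. It arises from A₂ by τ and from A₄ by
        -- τ⁴, so c and d are found by matching E at the indices 1 and 4.
        c = T 4 (ξ (TV 1 E) * κ ⁻¹)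
        d = T 1 (ξ (TV 4 E) * κ ⁻¹)

        R : Vec 5
        R i = 1# * E i + - 1# * (c * TV 2 A i + d * TV 4 A i)

        S : Vec 5
        S i = c * TV 2 A i + d * TV 4 A i

        R-at : ∀ j → ξ (TV j R) ≡ ξ (TV j E) + - (T j c * ξ (TV j (TV 2 A)) + T j d * ξ (TV j (TV 4 A)))
        R-at j = trans (linear j 1# (- 1#) E S R (λ _ → refl)) (trans
          (cong₂ (λ u v → u * ξ (TV j E) + v * ξ (TV j S)) (T-1 j) (trans (T-neg j 1#) (cong -_ (T-1 j))))
          (trans (cong (λ v → 1# * ξ (TV j E) + - 1# * v) (linear j c d (TV 2 A) (TV 4 A) S (λ _ → refl)))
            (solve 2 (λ e s → :1 :* e :+ :- :1 :* s := e :+ :- s) refl (ξ (TV j E)) _)))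

        R-zero : ∀ j → ξ (TV j E) ≡ 0# → ξ (TV j (TV 2 A)) ≡ 0# → ξ (TV j (TV 4 A)) ≡ 0# → ξ (TV j R) ≡ 0#
        R-zero j e p r = trans (R-at j) (trans (cong₂ (λ u v → u + - v) e (sum≡0 (scale≡0 (T j c) p) (scale≡0 (T j d) r))) (-‿inverseʳ 0#))

        cancel : ∀ e → e * κ ⁻¹ * κ ≡ e
        cancel e = trans (*-assoc _ _ _) (trans (cong (e *_) (⁻¹-inverseˡ A₃≢0)) (*-identityʳ e))

        R₁ : ξ (TV 1 R) ≡ 0#
        R₁ = trans (R-at 1) (trans (cong (λ v → ξ (TV 1 E) + - v) (trans (cong₂ _+_
            (trans (cong₂ _*_ (T-cancel 1 4 refl _) (compose 1 2 A)) (cancel (ξ (TV 1 E))))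
            (scale≡0 (T 1 d) (trans (wrap 1 4 0 refl A) A₀))) (+-identityʳ _))) (-‿inverseʳ _))

        R₄ : ξ (TV 4 R) ≡ 0#
        R₄ = trans (R-at 4) (trans (cong (λ v → ξ (TV 4 E) + - v) (trans (cong₂ _+_
            (scale≡0 (T 4 c) (trans (wrap 4 2 1 refl A) A₁))
            (trans (cong₂ _*_ (T-cancel 4 1 refl _) (wrap 4 4 3 refl A)) (cancel (ξ (TV 4 E))))) (+-identityˡ _))) (-‿inverseʳ _))

        R≡0 : R ≐ zeroV
        R≡0 = conjugates-injective ξ-lin ξ-nonzero p₀∉Fq R
          (R-zero 0 E₀ (trans (ξ₀ (TV 2 A)) A₂) (trans (ξ₀ (TV 4 A)) A₄)) R₁
          (R-zero 2 E₂ (trans (compose 2 2 A) A₄) (trans (wrap 2 4 1 refl A) A₁))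
          (R-zero 3 E₃ (trans (wrap 3 2 0 refl A) A₀) (trans (wrap 3 4 2 refl A) A₂)) R₄

      necessary : ∃₂ λ c d → ∀ i → E i ≡ c * TV 2 A i + d * TV 4 A i
      necessary = c , d , λ i → x-y≡0⇒x≡y (trans (solve 2 (λ e s → e :+ :- s := :1 :* e :+ :- :1 :* s) refl (E i) _) (R≡0 i))

-- Coordinates adapted to Σ and to the projection from Γ

module Coordinates (𝔽 : FiniteField) (q : ℕ) where
  open FieldTheory 𝔽
  open Geometry 𝔽 q
  open LinearAlgebra 𝔽 q
  open ≡-Reasoning

  comb-δ : ∀ {n k} (ws : Fin k → Vec n) j → comb (δ j) ws ≐ ws j
  comb-δ ws j i = trans (sumF-cong (λ l → trans (*-comm (δ j l) (ws l i)) (cong (ws l i *_) (δ-sym j l)))) (sumF-δ (λ l → ws l i) j)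

  coordinates-unique : ∀ {n k} {ws : Fin k → Vec n} → LinIndep ws → ∀ {c d} → comb c ws ≐ comb d ws → c ≐ d
  coordinates-unique {ws = ws} indep {c} {d} e j = x-y≡0⇒x≡y (trans (cong (c j +_) (solve 1 (λ a → :- a := :- :1 :* a) refl (d j)))
    (indep (λ j → c j + - 1# * d j) (λ i → trans (comb-+ c (λ j → - 1# * d j) ws i)
      (trans (cong₂ _+_ (e i) (comb-* (- 1#) d ws i)) (solve 1 (λ a → a :+ :- :1 :* a := :0) refl (comb d ws i)))) j))

  module Invert {n} (M N : Mat n) (MN : ∀ v → mulMV M (mulMV N v) ≐ v) (NM : ∀ v → mulMV N (mulMV M v) ≐ v) where

    M-≢0 : ∀ {v} → NonZero v → NonZero (mulMV M v)
    M-≢0 {v} v≢0 z = v≢0 (λ i → trans (sym (NM v i)) (IsLinear.at-0 (mulMV-linear N i) z))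

    N-≢0 : ∀ {v} → NonZero v → NonZero (mulMV N v)
    N-≢0 {v} v≢0 z = v≢0 (λ i → trans (sym (MN v i)) (IsLinear.at-0 (mulMV-linear M i) z))

    N-injective : ∀ {v w} → mulMV N v ≐ mulMV N w → v ≐ w
    N-injective {v} {w} e i = trans (sym (MN v i)) (trans (mulMV-cong M e i) (MN w i))

  module ProjectionCoordinates (M N : Mat 5) (MN : ∀ v → mulMV M (mulMV N v) ≐ v) (NM : ∀ v → mulMV N (mulMV M v) ≐ v)
    (g : Fin 3 → Vec 5) (g-indep : LinIndep g) (l : Fin 2 → Vec 5) (l-indep : LinIndep l) (disjoint : LineDisjointPlane g l) where
    open Invert M N MN NM

    private
      ws : Fin 5 → Vec 5
      ws = extend (extend g (l 1F)) (l 0F)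

      split : ∀ c i → comb c ws i ≡ comb (λ j → c (Fin.inject≤ j (s≤s (s≤s z≤n)))) l i + comb (λ j → c (suc (suc j))) g i
      split c i = solve 3 (λ a b s → a :+ (b :+ s) := a :+ (b :+ :0) :+ s) refl (c 0F * l 0F i) (c 1F * l 1F i) (comb (λ j → c (suc (suc j))) g i)

      -- In a relation the part on ℓ is minus the part in Γ, so it vanishes because ℓ and Γ are
      -- disjoint.
      ws-indep : LinIndep ws
      ws-indep c z = result
        where
        c₂ : Fin 2 → K
        c₂ j = c (Fin.inject≤ j (s≤s (s≤s z≤n)))
        c₃ : Fin 3 → K
        c₃ j = c (suc (suc j))
        X : Vec 5
        X = comb c₂ l
        X≡ : X ≐ comb (λ j → - 1# * c₃ j) g
        X≡ i = x-y≡0⇒x≡y (trans (cong (λ y → X i + - y) (comb-* (- 1#) c₃ g i))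
          (trans (solve 2 (λ x y → x :+ :- (:- :1 :* y) := x :+ y) refl (X i) (comb c₃ g i)) (trans (sym (split c i)) (z i))))
        X≡0 : X ≐ zeroV
        X≡0 = [ id , (λ X≢0 → ⊥-elim (disjoint (X , X≢0 , ((λ j → - 1# * c₃ j) , X≡) , (c₂ , λ _ → refl)))) ]′ (zero? X)
        c₂≡0 = l-indep c₂ X≡0
        c₃≡0 = g-indep c₃ (λ i → trans (sym (+-identityˡ _)) (trans (cong (_+ comb c₃ g i) (sym (X≡0 i))) (trans (sym (split c i)) (z i))))
        result : ∀ j → c j ≡ 0#
        result 0F = c₂≡0 0F
        result 1F = c₂≡0 1F
        result (suc (suc j)) = c₃≡0 j

      coords : Vec 5 → Fin 5 → K
      coords v = proj₁ (independent⇒spanning ws ws-indep (mulMV M v))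

      coords≡ : ∀ v → mulMV M v ≐ comb (coords v) ws
      coords≡ v = proj₂ (independent⇒spanning ws ws-indep (mulMV M v))

      coords-unique : ∀ {v c} → mulMV M v ≐ comb c ws → coords v ≐ c
      coords-unique {v} e = coordinates-unique {ws = ws} ws-indep (λ i → trans (sym (coords≡ v i)) (e i))

    -- The coordinates on ℓ of the projection from Γ.
    f : Vec 5 → Vec 2
    f v 0F = coords v 0F
    f v 1F = coords v 1F

    private
      coords-lin : ∀ j → IsLinear (λ v → coords v j)
      coords-lin j = record
        { respects = λ {v} {w} e → coords-unique {v} {coords w} (λ i → trans (mulMV-cong M e i) (coords≡ w i)) j
        ; additive = λ v w → coords-unique {v ⊕ w} {λ j → coords v j + coords w j} (λ i → trans (IsLinear.additive (mulMV-linear M i) v w)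
            (trans (cong₂ _+_ (coords≡ v i) (coords≡ w i)) (sym (comb-+ (coords v) (coords w) ws i)))) j
        ; homogeneous = λ c v → coords-unique {c ⊙ v} {λ j → c * coords v j} (λ i → trans (IsLinear.homogeneous (mulMV-linear M i) c v)
            (trans (cong (c *_) (coords≡ v i)) (sym (comb-* c (coords v) ws i)))) j }

      assemble : Vec 2 → Vec 3 → Fin 5 → K
      assemble w c 0F = w 0F
      assemble w c 1F = w 1F
      assemble w c (suc (suc j)) = c j

      comb-assemble : ∀ w c i → comb (assemble w c) ws i ≡ comb w l i + comb c g i
      comb-assemble w c = split (assemble w c)

      f-unique : ∀ {v w c} → mulMV M v ≐ (λ i → comb w l i + comb c g i) → f v ≐ w
      f-unique {v} {w} {c} e = λ { 0F → eq 0F ; 1F → eq 1F }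
        where
        eq = coords-unique {v} {assemble w c} (λ i → trans (e i) (sym (comb-assemble w c i)))

      residue : Vec 5 → Vec 3
      residue v j = coords v (suc (suc j))

      f-spec : ∀ v i → mulMV M v i ≡ comb (f v) l i + comb (residue v) g i
      f-spec v i = trans (coords≡ v i) (split (coords v) i)

    f-lin : ∀ i → IsLinear (λ v → f v i)
    f-lin 0F = coords-lin 0F
    f-lin 1F = coords-lin 1F

    f-l : ∀ j → f (mulMV N (l j)) ≐ δ j
    f-l j = f-unique {c = zeroV} (λ i → trans (MN (l j) i) (sym (trans (cong₂ _+_ (comb-δ l j i) (sumF-0 (λ k → zeroˡ (g k i)))) (+-identityʳ _))))

    -- With its converse below it identifies Γ, in the coordinates of Σ, with the kernel of f.
    f≡0⇒Γ : ∀ v → f v ≐ zeroV → InSpan g (mulMV M v)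
    f≡0⇒Γ v z = residue v , λ i → trans (f-spec v i) (trans (cong (_+ comb (residue v) g i)
      (sumF-0 (λ j → trans (cong (_* l j i) (z j)) (zeroˡ _)))) (+-identityˡ _))

    Γ⇒f≡0 : ∀ v → InSpan g (mulMV M v) → f v ≐ zeroV
    Γ⇒f≡0 v (c , e) = f-unique {c = c} (λ i → trans (e i) (sym (trans (cong (_+ comb c g i) (sumF-0 (λ j → zeroˡ (l j i)))) (+-identityˡ _))))

    subgeomPoint : ∀ u → (∀ i → InFq (u i)) → NonZero u → SubgeomPoint M (mulMV M u)
    subgeomPoint u u∈Fq u≢0 = M-≢0 u≢0 , u , u∈Fq , u≢0 , 1# , 1≢0 , λ i → sym (*-identityˡ _)

    module _ (empty : ¬ (∃ λ X → SubgeomPoint M X × InPlane g X)) where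

      f-nonzero : ∀ u → (∀ i → InFq (u i)) → NonZero u → NonZero (f u)
      f-nonzero u u∈Fq u≢0 z = empty (mulMV M u , subgeomPoint u u∈Fq u≢0 , M-≢0 u≢0 , f≡0⇒Γ u z)

    projection⇒ : ∀ w → Projection M g l w → LinearSet f w
    projection⇒ w (w≢0 , P , (P≢0 , u , u∈Fq , u≢0 , k , k≢0 , P≡) , c , e) =
      w≢0 , u , u∈Fq , u≢0 , c 0F * k , *-≢0 c₀≢0 k≢0 , λ i → sym (eq i)
      where
      c′ : Vec 3
      c′ j = c (suc j)
      -- Without a contribution of P the point of ℓ would lie in Γ.
      c₀≢0 : c 0F ≢ 0#
      c₀≢0 c₀≡0 = disjoint (comb w l , (λ z → w≢0 (l-indep w z)) , (c′ , λ i → trans (e i) (trans (cong (λ z → z * P i + comb c′ g i) c₀≡0)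
        (trans (cong (_+ comb c′ g i) (zeroˡ _)) (+-identityˡ _)))) , (w , λ _ → refl))
      eq : ∀ i → c 0F * k * f u i ≡ w i
      eq i = trans (sym (IsLinear.homogeneous (f-lin i) (c 0F * k) u)) (f-unique {c 0F * k ⊙ u} {w} {λ j → - 1# * c′ j} (λ j → begin
        mulMV M (c 0F * k ⊙ u) j                          ≡⟨ IsLinear.homogeneous (mulMV-linear M j) (c 0F * k) u ⟩
        c 0F * k * mulMV M u j                            ≡⟨ trans (*-assoc _ _ _) (cong (c 0F *_) (sym (P≡ j))) ⟩
        c 0F * P j                                        ≡⟨ solve 2 (λ a b → a := a :+ b :+ :- :1 :* b) refl (c 0F * P j) (comb c′ g j) ⟩
        c 0F * P j + comb c′ g j + - 1# * comb c′ g j     ≡⟨ cong₂ _+_ (e j) (comb-* (- 1#) c′ g j) ⟨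
        comb w l j + comb (λ j → - 1# * c′ j) g j         ∎) i)

    ⇒projection : ∀ w → LinearSet f w → Projection M g l w
    ⇒projection w (w≢0 , u , u∈Fq , u≢0 , k , k≢0 , w≡) = w≢0 , mulMV M u , subgeomPoint u u∈Fq u≢0 , c , λ i → begin
      comb w l i                                                     ≡⟨ comb-cong w≡ l i ⟩
      comb (λ j → k * f u j) l i                                     ≡⟨ comb-* k (f u) l i ⟩
      k * comb (f u) l i
        ≡⟨ solve 3 (λ k a b → k :* a := k :* (a :+ b) :+ :- k :* b) refl k (comb (f u) l i) (comb (residue u) g i) ⟩
      k * (comb (f u) l i + comb (residue u) g i) + - k * comb (residue u) g i
        ≡⟨ cong₂ (λ a b → k * a + b) (sym (f-spec u i)) (sym (comb-* (- k) (residue u) g i)) ⟩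
      k * mulMV M u i + comb (λ j → - k * residue u j) g i           ∎
      where
      c : Fin 4 → K
      c zero = k
      c (suc j) = - k * residue u j

-- Invariance under equality of point sets

module Transport (𝔽 : FiniteField) (q : ℕ) where
  open Geometry 𝔽 q

  module _ {S S′ : Vec 2 → Set} (to : ∀ w → S w → S′ w) (from : ∀ w → S′ w → S w) where

    MaxScattered-resp : MaxScattered S → MaxScattered S′
    MaxScattered-resp (ps , length≡ , ps∈S , distinct , complete) =
      ps , length≡ , All.map (to _) ps∈S , distinct , λ v v∈S′ → complete v (from v v∈S′)

    LPType-resp : IsLPType S → IsLPType S′
    LPType-resp (s , δ , s-valid , Nδ≢0 , Nδ≢1 , φ , S⇒T , T⇒S) =
      s , δ , s-valid , Nδ≢0 , Nδ≢1 , φ , (λ v v∈S′ → S⇒T v (from v v∈S′)) ,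
      λ w w∈T → let v , v∈S , w∝ = T⇒S w w∈T in v , to v v∈S , w∝

-- Collineations that fix the subgeometry pointwise

module SubgeometryStabilizer (𝔽 : FiniteField) (q : ℕ) (q-pp : IsPrimePower q) (order≡ : FiniteField.order 𝔽 ≡ q ℕ.^ 5) where
  open FieldTheory 𝔽
  open Geometry 𝔽 q
  open Powers 𝔽 q
  open LinearAlgebra 𝔽 q
  open Coordinates 𝔽 q
  open Frobenius 𝔽 q q-pp order≡
  open NormOne 𝔽 q q-pp order≡
  open Necessity 𝔽 q q-pp order≡ using (module AutomorphismInverse)
  open ≡-Reasoning

  0∈Fq : InFq 0#
  0∈Fq = 0^n≡0 q {{q≢0}}

  1∈Fq : InFq 1#
  1∈Fq = 1^n≡1 q

  δ∈Fq : ∀ {n} (j i : Fin n) → InFq (δ j i)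
  δ∈Fq zero zero = 1∈Fq
  δ∈Fq zero (suc i) = 0∈Fq
  δ∈Fq (suc j) zero = 0∈Fq
  δ∈Fq (suc j) (suc i) = δ∈Fq j i

  δ-diagonal : ∀ {n} (j : Fin n) → δ j j ≡ 1#
  δ-diagonal zero = refl
  δ-diagonal (suc j) = δ-diagonal j

  module _ (M N : Mat 5) (MN : ∀ v → mulMV M (mulMV N v) ≐ v) (NM : ∀ v → mulMV N (mulMV M v) ≐ v)
    (σ : Semilinear 5) (σ∈G : InG M σ) (σ≢1 : NotIdentity σ) where
    open Invert M N MN NM

    private
      S = Semilinear.mat σ
      module τ = AutomorphismInverse (Semilinear.aut σ)
      τ = τ.f

      τ-sum : ∀ {k} (a : Fin k → K) → τ (sumF k a) ≡ sumF k (λ j → τ (a j))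
      τ-sum {zero} a = τ.f-0
      τ-sum {suc k} a = trans (τ.f-+ _ _) (cong (τ (a zero) +_) (τ-sum (a ∘ suc)))

      τ-δ : ∀ {n} (j i : Fin n) → τ (δ j i) ≡ δ j i
      τ-δ zero zero = τ.f-1
      τ-δ zero (suc i) = τ.f-0
      τ-δ (suc j) zero = τ.f-0
      τ-δ (suc j) (suc i) = τ-δ j i

      τM : Mat 5
      τM i j = τ (M i j)

      -- The linear part of σ in the coordinates of Σ: the coordinates of the image are W applied to
      -- τ of the coordinates.
      W : Vec 5 → Vec 5
      W x = mulMV N (mulMV S (mulMV τM x))

      W-lin : ∀ i → IsLinear (λ v → W v i)
      W-lin i = record
        { respects = λ e → mulMV-cong N (mulMV-cong S (mulMV-cong τM e)) i
        ; additive = λ v w → trans (mulMV-cong N (λ j → trans (mulMV-cong S (λ k → IsLinear.additive (mulMV-linear τM k) v w) j)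
            (IsLinear.additive (mulMV-linear S j) (mulMV τM v) (mulMV τM w))) i)
            (IsLinear.additive (mulMV-linear N i) (mulMV S (mulMV τM v)) (mulMV S (mulMV τM w)))
        ; homogeneous = λ c v → trans (mulMV-cong N (λ j → trans (mulMV-cong S (λ k → IsLinear.homogeneous (mulMV-linear τM k) c v) j)
            (IsLinear.homogeneous (mulMV-linear S j) c (mulMV τM v))) i)
            (IsLinear.homogeneous (mulMV-linear N i) c (mulMV S (mulMV τM v))) }

      W-apply : ∀ v → mulMV N (apply σ (mulMV M v)) ≐ W (λ i → τ (v i))
      W-apply v = mulMV-cong N (mulMV-cong S (λ i → trans (τ-sum (λ j → M i j * v j)) (sumF-cong (λ j → τ.f-* (M i j) (v j)))))

      W-point : ∀ u → (∀ i → InFq (u i)) → NonZero u → ∃ λ c → c ≢ 0# × (∀ i → W (λ j → τ (u j)) i ≡ c * u i)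
      W-point u u∈Fq u≢0 = let c , c≢0 , e = σ∈G (mulMV M u) (M-≢0 u≢0 , u , u∈Fq , u≢0 , 1# , 1≢0 , λ i → sym (*-identityˡ _)) in
        c , c≢0 , λ i → trans (sym (W-apply u i)) (trans (mulMV-cong N e i)
          (trans (IsLinear.homogeneous (mulMV-linear N i) c (mulMV M u)) (cong (c *_) (NM u i))))

      δ≢0 : ∀ j → NonZero (δ {5} j)
      δ≢0 j z = 1≢0 (trans (sym (δ-diagonal j)) (z j))

      eigenvalue : Fin 5 → K
      eigenvalue j = proj₁ (W-point (δ j) (δ∈Fq j) (δ≢0 j))

      W-δ : ∀ j i → W (δ j) i ≡ eigenvalue j * δ j i
      W-δ j i = trans (IsLinear.respects (W-lin i) (λ k → sym (τ-δ j k))) (proj₂ (proj₂ (W-point (δ j) (δ∈Fq j) (δ≢0 j))) i)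

      -- The eigenvalues are compared on the points e₀ + a e_j of Σ.
      compare : ∀ j a → InFq a → τ a * eigenvalue (suc j) ≡ eigenvalue zero * a
      compare j a a∈Fq = begin
        τ a * eigenvalue (suc j)
          ≡⟨ solve 3 (λ e t l → t :* l := e :* :0 :+ t :* (l :* :1)) refl (eigenvalue zero) (τ a) (eigenvalue (suc j)) ⟩
        eigenvalue zero * 0# + τ a * (eigenvalue (suc j) * 1#)
          ≡⟨ cong (λ z → eigenvalue zero * 0# + τ a * (eigenvalue (suc j) * z)) (δ-diagonal (suc j)) ⟨
        eigenvalue zero * δ zero (suc j) + τ a * (eigenvalue (suc j) * δ (suc j) (suc j))
          ≡⟨ W-u (suc j) ⟨
        W (λ k → τ (u k)) (suc j)              ≡⟨ cu (suc j) ⟩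
        c * (0# + a * δ (suc j) (suc j))       ≡⟨ cong₂ (λ y z → y * (0# + a * z)) c≡ (δ-diagonal (suc j)) ⟩
        eigenvalue zero * (0# + a * 1#)        ≡⟨ solve 2 (λ e a → e :* (:0 :+ a :* :1) := e :* a) refl (eigenvalue zero) a ⟩
        eigenvalue zero * a                    ∎
        where
        u : Vec 5
        u = δ zero ⊕ a ⊙ δ (suc j)
        u₀≡1 : u zero ≡ 1#
        u₀≡1 = solve 1 (λ a → :1 :+ a :* :0 := :1) refl a
        u∈Fq : ∀ i → InFq (u i)
        u∈Fq i = Fr-1-fixed⇒InFq (trans (Fr-+ 1 _ _) (cong₂ _+_ (InFq⇒Fr-fixed (δ∈Fq zero i) 1)
          (trans (Fr-* 1 _ _) (cong₂ _*_ (InFq⇒Fr-fixed a∈Fq 1) (InFq⇒Fr-fixed (δ∈Fq (suc j) i) 1)))))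
        point = W-point u u∈Fq (λ z → 1≢0 (trans (sym u₀≡1) (z zero)))
        c = proj₁ point
        cu = proj₂ (proj₂ point)
        W-u : ∀ i → W (λ k → τ (u k)) i ≡ eigenvalue zero * δ zero i + τ a * (eigenvalue (suc j) * δ (suc j) i)
        W-u i = trans (IsLinear.respects (W-lin i) (λ k → trans (τ.f-+ _ _) (cong₂ _+_ (τ-δ zero k) (trans (τ.f-* _ _) (cong (τ a *_) (τ-δ (suc j) k))))))
          (trans (IsLinear.additive (W-lin i) (δ zero) (τ a ⊙ δ (suc j)))
            (cong₂ _+_ (W-δ zero i) (trans (IsLinear.homogeneous (W-lin i) (τ a) (δ (suc j))) (cong (τ a *_) (W-δ (suc j) i)))))
        c≡ : c ≡ eigenvalue zero
        c≡ = begin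
          c                                 ≡⟨ trans (sym (*-identityʳ c)) (cong (c *_) (sym u₀≡1)) ⟩
          c * u zero                        ≡⟨ cu zero ⟨
          W (λ k → τ (u k)) zero            ≡⟨ W-u zero ⟩
          eigenvalue zero * 1# + τ a * (eigenvalue (suc j) * 0#)
            ≡⟨ solve 3 (λ e t l → e :* :1 :+ t :* (l :* :0) := e) refl (eigenvalue zero) (τ a) (eigenvalue (suc j)) ⟩
          eigenvalue zero                   ∎

      λ₀ = eigenvalue zero

      λ₀≢0 : λ₀ ≢ 0#
      λ₀≢0 = proj₁ (proj₂ (W-point (δ zero) (δ∈Fq zero) (δ≢0 zero)))

      -- At a = 1 `compare` makes all eigenvalues equal; with this, at general a, it shows that τ
      -- fixes 𝔽_q.
      eigenvalue≡ : ∀ j → eigenvalue j ≡ λ₀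
      eigenvalue≡ zero = refl
      eigenvalue≡ (suc j) = trans (sym (*-identityˡ _)) (trans (cong (_* eigenvalue (suc j)) (sym τ.f-1)) (trans (compare j 1# 1∈Fq) (*-identityʳ _)))

      τ-fixes-Fq : ∀ a → InFq a → τ a ≡ a
      τ-fixes-Fq a a∈Fq = *-cancelˡ λ₀≢0 (trans (*-comm _ _) (trans (cong (τ a *_) (sym (eigenvalue≡ 1F))) (compare zero a a∈Fq)))

      W-scalar : ∀ x i → W x i ≡ λ₀ * x i
      W-scalar x i = begin
        W x i                                               ≡⟨ IsLinear.respects (W-lin i) (λ k → sym (sumF-δ x k)) ⟩
        W (comb x δ) i                                      ≡⟨ IsLinear.at-comb (W-lin i) x δ ⟩
        sumF 5 (λ j → x j * W (δ j) i)
          ≡⟨ sumF-cong {5} (λ j → trans (cong (x j *_) (trans (W-δ j i) (cong (_* δ j i) (eigenvalue≡ j))))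
               (solve 3 (λ x l d → x :* (l :* d) := l :* (x :* d)) refl (x j) λ₀ (δ j i))) ⟩
        sumF 5 (λ j → λ₀ * (x j * δ j i))                   ≡⟨ sumF-*ˡ {5} λ₀ (λ j → x j * δ j i) ⟩
        λ₀ * sumF 5 (λ j → x j * δ j i)                     ≡⟨ cong (λ₀ *_) (sumF-δ x i) ⟩
        λ₀ * x i                                            ∎

      σ-coordinates : ∀ X i → mulMV N (apply σ X) i ≡ λ₀ * τ (mulMV N X i)
      σ-coordinates X i = begin
        mulMV N (apply σ X) i                        ≡⟨ mulMV-cong N (mulMV-cong S (λ j → cong τ (sym (MN X j)))) i ⟩
        mulMV N (apply σ (mulMV M (mulMV N X))) i    ≡⟨ W-apply (mulMV N X) i ⟩
        W (λ j → τ (mulMV N X j)) i                  ≡⟨ W-scalar (λ j → τ (mulMV N X j)) i ⟩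
        λ₀ * τ (mulMV N X i)                         ∎

      -- If τ were the identity, σ would be multiplication by λ₀ and fix every point.
      moved : ∃ λ a → τ a ≢ a
      moved = [ (λ τ≡id → ⊥-elim (σ≢1 (λ X _ → λ₀ , λ₀≢0 , N-injective (λ i → trans (σ-coordinates X i)
                  (trans (cong (λ₀ *_) (τ≡id _)) (sym (IsLinear.homogeneous (mulMV-linear N i) λ₀ X))))))) , id ]′ (agree? τ id)

      frobenius = automorphism-is-Frobenius τ τ.f-+ τ.f-* τ.f-1 τ-fixes-Fq (proj₂ moved)

    stabilizer-exponent : ∃ Exponent
    stabilizer-exponent = proj₁ frobenius , exponent (proj₁ (proj₂ frobenius)) (proj₁ (proj₂ (proj₂ frobenius)))

    moved-element : ∃ λ a → ¬ InFq a
    moved-element = proj₁ moved , λ a∈Fq → proj₂ moved (τ-fixes-Fq _ a∈Fq)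

    iter-coordinates : ∀ k X → ∃ λ c → c ≢ 0# × (∀ i → mulMV N (iter k σ X) i ≡ c * Fr (k ℕ.* proj₁ stabilizer-exponent) (mulMV N X i))
    iter-coordinates zero X = 1# , 1≢0 , λ i → sym (trans (*-identityˡ _) (Fr-id _))
    iter-coordinates (suc k) X = let c , c≢0 , e = iter-coordinates k X in
      λ₀ * τ c , *-≢0 λ₀≢0 (τ.f-≢0 c≢0) , λ i → begin
        mulMV N (apply σ (iter k σ X)) i                          ≡⟨ σ-coordinates (iter k σ X) i ⟩
        λ₀ * τ (mulMV N (iter k σ X) i)                           ≡⟨ cong (λ z → λ₀ * τ z) (e i) ⟩
        λ₀ * τ (c * Fr (k ℕ.* t) (mulMV N X i))                   ≡⟨ cong (λ₀ *_) (τ.f-* c _) ⟩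
        λ₀ * (τ c * τ (Fr (k ℕ.* t) (mulMV N X i)))               ≡⟨ *-assoc _ _ _ ⟨
        λ₀ * τ c * τ (Fr (k ℕ.* t) (mulMV N X i))
          ≡⟨ cong (λ₀ * τ c *_) (trans (proj₂ (proj₂ (proj₂ frobenius)) _) (Fr-∘ t (k ℕ.* t) (mulMV N X i))) ⟩
        λ₀ * τ c * Fr (suc k ℕ.* t) (mulMV N X i)                 ∎
      where
      t = proj₁ stabilizer-exponent

open import Data.Nat using (_^_)

-- Passing from σ to σ²

module Exponents (𝔽 : FiniteField) (q : ℕ) (q-pp : IsPrimePower q) (order≡ : FiniteField.order 𝔽 ≡ q ^ 5) where
  open FieldTheory 𝔽
  open Geometry 𝔽 q
  open LinearAlgebra 𝔽 q
  open Frobenius 𝔽 q q-pp order≡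
  open NormOne 𝔽 q q-pp order≡
  open LinearSets 𝔽 q q-pp order≡
  open Necessity 𝔽 q q-pp order≡

  validS⇒exponent : ∀ {s} → ValidS s → Exponent s
  validS⇒exponent {0} (_ , ())
  validS⇒exponent {1} _ = one
  validS⇒exponent {2} _ = two
  validS⇒exponent {3} _ = three
  validS⇒exponent {4} _ = four
  validS⇒exponent {suc (suc (suc (suc (suc _))))} (s≤s (s≤s (s≤s (s≤s (s≤s ())))) , _)

  -- The residue of 2 t modulo 5, which is the exponent of σ².
  double : ∀ {t} → Exponent t → ℕ
  double one = 2
  double two = 4
  double three = 1
  double four = 3

  double-exponent : ∀ {t} (e : Exponent t) → Exponent (double e)
  double-exponent one = two
  double-exponent two = four
  double-exponent three = one
  double-exponent four = three

  double-Fr : ∀ {t} (e : Exponent t) k x → Fr (k ℕ.* double e) x ≡ Fr ((2 ℕ.* k) ℕ.* t) x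
  double-Fr one k x = cong (λ n → Fr n x) (arith k)
    where
    arith : ∀ k → k ℕ.* 2 ≡ (2 ℕ.* k) ℕ.* 1
    arith = solve-∀
  double-Fr two k x = cong (λ n → Fr n x) (arith k)
    where
    arith : ∀ k → k ℕ.* 4 ≡ (2 ℕ.* k) ℕ.* 2
    arith = solve-∀
  double-Fr three k x = trans (sym (Fr-+5n (k ℕ.* 1) k x)) (cong (λ n → Fr n x) (arith k))
    where
    arith : ∀ k → k ℕ.* 1 ℕ.+ 5 ℕ.* k ≡ (2 ℕ.* k) ℕ.* 3
    arith = solve-∀
  double-Fr four k x = trans (sym (Fr-+5n (k ℕ.* 3) k x)) (cong (λ n → Fr n x) (arith k))
    where
    arith : ∀ k → k ℕ.* 3 ℕ.+ 5 ℕ.* k ≡ (2 ℕ.* k) ℕ.* 4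
    arith = solve-∀

  module _ (f : Vec 5 → Vec 2) (ξ : Vec 5 → K) where

    Shaped-4 : Shaped f ξ 1 → Shaped f ξ 4
    Shaped-4 (a , b , a≢0 , b≢0 , eq) = b , a , b≢0 , a≢0 , λ X fX → trans (+-comm _ _) (eq X fX)

    Shaped-3 : Shaped f ξ 2 → Shaped f ξ 3
    Shaped-3 (a , b , a≢0 , b≢0 , eq) = b , a , b≢0 , a≢0 , λ X fX → trans (+-comm _ _) (eq X fX)

    -- The residues ±t and ±2t exhaust the nonzero classes modulo 5, and `Shaped` is symmetric under
    -- s ↦ 5 - s.
    shaped-for : ∀ {t} (e : Exponent t) → Shaped f ξ 1 ⊎ Shaped f ξ 2 → Shaped f ξ t ⊎ Shaped f ξ (double e)
    shaped-for one = id
    shaped-for two = [ inj₂ ∘ Shaped-4 , inj₁ ]′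
    shaped-for three = [ inj₂ , inj₁ ∘ Shaped-3 ]′
    shaped-for four = [ inj₁ ∘ Shaped-4 , inj₂ ∘ Shaped-3 ]′

  module _ {t} (e : Exponent t) {f : Vec 5 → Vec 2} {ξ : Vec 5 → K} (ξ-lin : IsLinear ξ) where
    open ConjugateVectors e

    Shaped-T : Shaped f ξ t → ∃₂ λ a b → a ≢ 0# × b ≢ 0# ×
      (∀ X → f X ≐ zeroV → a * T 1 (ξ (TV 4 X)) + b * T 4 (ξ (TV 1 X)) ≡ 0#)
    Shaped-T (a , b , a≢0 , b≢0 , eq) = a , b , a≢0 , b≢0 , λ X fX → trans (sym (cong₂ (λ u v → a * u + b * v)
      (trans (Fr-t e _) (cong (T 1) (IsLinear.respects ξ-lin (λ i → Fr-5∸t e (X i)))))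
      (trans (Fr-5∸t e _) (cong (T 4) (IsLinear.respects ξ-lin (λ i → Fr-t e (X i))))))) (eq X fX)

-- Translating the points and lines into coordinates

module Incidence (𝔽 : FiniteField) (q : ℕ) (q-pp : IsPrimePower q) (order≡ : FiniteField.order 𝔽 ≡ q ^ 5) where
  open FieldTheory 𝔽
  open Geometry 𝔽 q hiding (_^_)
  open LinearAlgebra 𝔽 q
  open Coordinates 𝔽 q
  open Transport 𝔽 q
  open Frobenius 𝔽 q q-pp order≡
  open NormOne 𝔽 q q-pp order≡
  open LinearSets 𝔽 q q-pp order≡
  open SubgeometryStabilizer 𝔽 q q-pp order≡
  open Sufficiency 𝔽 q q-pp order≡
  open Necessity 𝔽 q q-pp order≡
  open Exponents 𝔽 q q-pp order≡
  open ≡-Reasoning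

  Independent₃ : Vec 5 → Vec 5 → Vec 5 → Set
  Independent₃ P Q R = ∀ a b c → (∀ i → a * P i + (b * Q i + c * R i) ≡ 0#) → a ≡ 0# × b ≡ 0# × c ≡ 0#

  InSpan₂ : Vec 5 → Vec 5 → Vec 5 → Set
  InSpan₂ P Q X = ∃₂ λ a b → ∀ i → X i ≡ a * P i + b * Q i

  -- Rewriting E on the line AB turns a relation into one between A, A′, B and gives d = 0;
  -- rewriting it on A′B′ gives c = 0. What remains is e E = 0.
  independent-with-meet : ∀ {A A′ B B′ E} → NonZero E → Independent₃ A A′ B → Independent₃ A A′ B′ →
    InSpan₂ A B E → InSpan₂ A′ B′ E → Independent₃ A A′ E
  independent-with-meet {A} {A′} {B} {B′} {E} E≢0 ind ind′ (x , y , E≡) (z , w , E≡′) c d e rel = c≡0 , d≡0 , e≡0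
    where
    first = ind (c + e * x) d (e * y) (λ i → trans
      (solve 8 (λ c e x d y a a′ b → (c :+ e :* x) :* a :+ (d :* a′ :+ e :* y :* b) := c :* a :+ (d :* a′ :+ e :* (x :* a :+ y :* b))) refl
        c e x d y (A i) (A′ i) (B i)) (trans (cong (λ v → c * A i + (d * A′ i + e * v)) (sym (E≡ i))) (rel i)))
    second = ind′ c (d + e * z) (e * w) (λ i → trans
      (solve 8 (λ c e z d w a a′ b → c :* a :+ ((d :+ e :* z) :* a′ :+ e :* w :* b) := c :* a :+ (d :* a′ :+ e :* (z :* a′ :+ w :* b))) refl
        c e z d w (A i) (A′ i) (B′ i)) (trans (cong (λ v → c * A i + (d * A′ i + e * v)) (sym (E≡′ i))) (rel i)))
    c≡0 = proj₁ second
    d≡0 = proj₁ (proj₂ first)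
    e≡0 : e ≡ 0#
    e≡0 with e ≟ 0#
    ... | yes e≡0 = e≡0
    ... | no e≢0 = ⊥-elim (E≢0 (λ i → xy≡0⇒y≡0 e≢0 (trans (solve 3 (λ e a b → e := :0 :* a :+ (:0 :* b :+ e)) refl (e * E i) (A i) (A′ i))
      (trans (cong₂ (λ u v → u * A i + (v * A′ i + e * E i)) (sym c≡0) (sym d≡0)) (rel i)))))

  InSpan₂-swap : ∀ {P Q X} → InSpan₂ P Q X → InSpan₂ Q P X
  InSpan₂-swap (a , b , e) = b , a , λ i → trans (e i) (+-comm _ _)

  InSpan₂-resp : ∀ {P P′ Q Q′ X} → P ≐ P′ → Q ≐ Q′ → InSpan₂ P Q X → InSpan₂ P′ Q′ X
  InSpan₂-resp p r (a , b , e) = a , b , λ i → trans (e i) (cong₂ (λ u v → a * u + b * v) (p i) (r i))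

  Independent₃-resp : ∀ {P P′ Q Q′ R} → P ≐ P′ → Q ≐ Q′ → Independent₃ P Q R → Independent₃ P′ Q′ R
  Independent₃-resp {R = R} p r ind a b c z = ind a b c (λ i → trans (cong₂ (λ u v → a * u + (b * v + c * R i)) (p i) (r i)) (z i))

  module _ (M N : Mat 5) (MN : ∀ v → mulMV M (mulMV N v) ≐ v) (NM : ∀ v → mulMV N (mulMV M v) ≐ v)
    (g : Fin 3 → Vec 5) (g-indep : LinIndep g) (empty : ¬ (∃ λ X → SubgeomPoint M X × InPlane g X))
    (l : Fin 2 → Vec 5) (l-indep : LinIndep l) (disjoint : LineDisjointPlane g l)
    (scattered : MaxScattered (Projection M g l)) (σ : Semilinear 5) (σ∈G : InG M σ) (σ≢1 : NotIdentity σ) where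
    open Invert M N MN NM
    open ProjectionCoordinates M N MN NM g g-indep l l-indep disjoint

    private
      t = proj₁ (stabilizer-exponent M N MN NM σ σ∈G σ≢1)
      t-exp = proj₂ (stabilizer-exponent M N MN NM σ σ∈G σ≢1)
      p₀∉Fq = proj₂ (moved-element M N MN NM σ σ∈G σ≢1)

    open ConjugateVectors t-exp

    private
      module f (i : Fin 2) = IsLinear (f-lin i)

      -- X is the point of PG(4, q⁵) with coordinate vector v with respect to Σ.
      Represents : Vec 5 → Vec 5 → Set
      Represents v X = ∃ λ c → c ≢ 0# × (∀ i → mulMV N X i ≡ c * v i)

      itself : ∀ X → Represents (mulMV N X) X
      itself X = 1# , 1≢0 , λ i → sym (*-identityˡ _)

      iterate : ∀ k X → Represents (TV k (mulMV N X)) (iter k σ X)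
      iterate k X = iter-coordinates M N MN NM σ σ∈G σ≢1 k X

      span-coordinates : ∀ {v w P Q X} → Represents v P → Represents w Q → InSpan (fam2 P Q) X → InSpan₂ v w (mulMV N X)
      span-coordinates {v} {w} {P} {Q} {X} (p , _ , P≡) (r , _ , Q≡) (c , X≡) = c 0F * p , c 1F * r , λ i → begin
        mulMV N X i                                                   ≡⟨ mulMV-cong N X≡ i ⟩
        mulMV N (comb c (fam2 P Q)) i                                 ≡⟨ IsLinear.at-comb (mulMV-linear N i) c (fam2 P Q) ⟩
        c 0F * mulMV N P i + (c 1F * mulMV N Q i + 0#)                ≡⟨ cong₂ (λ x y → c 0F * x + (c 1F * y + 0#)) (P≡ i) (Q≡ i) ⟩
        c 0F * (p * v i) + (c 1F * (r * w i) + 0#)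
          ≡⟨ solve 6 (λ a p v b r w → a :* (p :* v) :+ (b :* (r :* w) :+ :0) := a :* p :* v :+ b :* r :* w) refl (c 0F) p (v i) (c 1F) r (w i) ⟩
        c 0F * p * v i + c 1F * r * w i                               ∎

      coordinates-span : ∀ {v w P Q X} → Represents v P → Represents w Q → InSpan₂ v w (mulMV N X) → InSpan (fam2 P Q) X
      coordinates-span {v} {w} {P} {Q} {X} (p , p≢0 , P≡) (r , r≢0 , Q≡) (a , b , X≡) =
        c , N-injective (λ i → sym (begin
          mulMV N (comb c (fam2 P Q)) i                               ≡⟨ IsLinear.at-comb (mulMV-linear N i) c (fam2 P Q) ⟩
          a * p ⁻¹ * mulMV N P i + (b * r ⁻¹ * mulMV N Q i + 0#)      ≡⟨ cong₂ (λ x y → a * p ⁻¹ * x + (b * r ⁻¹ * y + 0#)) (P≡ i) (Q≡ i) ⟩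
          a * p ⁻¹ * (p * v i) + (b * r ⁻¹ * (r * w i) + 0#)
            ≡⟨ solve 8 (λ a p′ p v b r′ r w → a :* p′ :* (p :* v) :+ (b :* r′ :* (r :* w) :+ :0) := a :* v :* (p′ :* p) :+ b :* w :* (r′ :* r)) refl
                 a (p ⁻¹) p (v i) b (r ⁻¹) r (w i) ⟩
          a * v i * (p ⁻¹ * p) + b * w i * (r ⁻¹ * r)                 ≡⟨ cong₂ (λ x y → a * v i * x + b * w i * y) (⁻¹-inverseˡ p≢0) (⁻¹-inverseˡ r≢0) ⟩
          a * v i * 1# + b * w i * 1#                                 ≡⟨ cong₂ _+_ (*-identityʳ _) (*-identityʳ _) ⟩
          a * v i + b * w i                                           ≡⟨ X≡ i ⟨
          mulMV N X i                                                 ∎))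
        where
        c : Fin 2 → K
        c 0F = a * p ⁻¹
        c 1F = b * r ⁻¹

      independent-coordinates : ∀ {u v w P Q R} → Represents u P → Represents v Q → Represents w R → NonCollinear P Q R → Independent₃ u v w
      independent-coordinates {u} {v} {w} {P} {Q} {R} (p , p≢0 , P≡) (r , r≢0 , Q≡) (s , s≢0 , R≡) ind a b c z =
        xy≡0⇒x≡0 (⁻¹-≢0 p≢0) (d≡0 0F) , xy≡0⇒x≡0 (⁻¹-≢0 r≢0) (d≡0 1F) , xy≡0⇒x≡0 (⁻¹-≢0 s≢0) (d≡0 2F)
        where
        d : Fin 3 → K
        d 0F = a * p ⁻¹
        d 1F = b * r ⁻¹
        d 2F = c * s ⁻¹
        cancel : ∀ a {p} x → p ≢ 0# → a * p ⁻¹ * (p * x) ≡ a * x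
        cancel a {p} x p≢0 = trans (solve 4 (λ a p′ p x → a :* p′ :* (p :* x) := p′ :* p :* (a :* x)) refl a (p ⁻¹) p x)
          (trans (cong (_* (a * x)) (⁻¹-inverseˡ p≢0)) (*-identityˡ _))
        d≡0 : ∀ j → d j ≡ 0#
        d≡0 = ind d (N-injective (λ i → begin
          mulMV N (comb d (fam3 P Q R)) i                             ≡⟨ IsLinear.at-comb (mulMV-linear N i) d (fam3 P Q R) ⟩
          d 0F * mulMV N P i + (d 1F * mulMV N Q i + (d 2F * mulMV N R i + 0#))
            ≡⟨ cong₂ _+_ (trans (cong (d 0F *_) (P≡ i)) (cancel a (u i) p≢0)) (cong₂ _+_ (trans (cong (d 1F *_) (Q≡ i)) (cancel b (v i) r≢0))
                 (trans (+-identityʳ _) (trans (cong (d 2F *_) (R≡ i)) (cancel c (w i) s≢0)))) ⟩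
          a * u i + (b * v i + c * w i)                               ≡⟨ z i ⟩
          0#                                                          ≡⟨ IsLinear.at-0 (mulMV-linear N i) (λ _ → refl) ⟨
          mulMV N zeroV i                                             ∎))

      -- Because k + j = 5, lying in the image of Γ under σ^k means that the j-th conjugate lies in
      -- Γ; the meet becomes a condition on the kernel of f alone.
      module Meet {k j} (k+j≡5 : k ℕ.+ j ≡ 5) {A} (meet : MeetIsPoint g k σ A) where
        Ã : Vec 5
        Ã = mulMV N A

        Ã≢0 : NonZero Ã
        Ã≢0 = N-≢0 (proj₁ (proj₁ meet))

        inΓ : ∀ {X} → InSpan g X → f (mulMV N X) ≐ zeroV
        inΓ {X} (c , e) = Γ⇒f≡0 (mulMV N X) (c , λ i → trans (MN X i) (e i))

        j+k≡5 : j ℕ.+ k ≡ 5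
        j+k≡5 = trans (ℕ.+-comm j k) k+j≡5

        fÃ : f Ã ≐ zeroV
        fÃ = inΓ (proj₂ (proj₁ meet))

        fÃⱼ : f (TV j Ã) ≐ zeroV
        fÃⱼ i = let _ , X , (_ , X∈Γ) , c , c≢0 , A≡ = proj₁ (proj₂ meet)
                    d , d≢0 , X≡ = iterate k X in
          trans (f.respects i {w = T j (c * d) ⊙ mulMV N X} (λ i → begin
            T j (mulMV N A i)                             ≡⟨ cong (T j) (trans (mulMV-cong N A≡ i) (IsLinear.homogeneous (mulMV-linear N i) c (iter k σ X))) ⟩
            T j (c * mulMV N (iter k σ X) i)              ≡⟨ cong (λ z → T j (c * z)) (X≡ i) ⟩
            T j (c * (d * T k (mulMV N X i)))             ≡⟨ cong (T j) (sym (*-assoc _ _ _)) ⟩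
            T j (c * d * T k (mulMV N X i))               ≡⟨ T-* j _ _ ⟩
            T j (c * d) * T j (T k (mulMV N X i))         ≡⟨ cong (T j (c * d) *_) (T-cancel j k j+k≡5 (mulMV N X i)) ⟩
            T j (c * d) * mulMV N X i                     ∎))
          (trans (f.homogeneous i (T j (c * d)) (mulMV N X)) (scale≡0 (T j (c * d)) (inΓ X∈Γ i)))

        unique : ∀ Y → NonZero Y → f Y ≐ zeroV → f (TV j Y) ≐ zeroV → Proportional Y Ã
        unique Y Y≢0 fY fYⱼ =
          -- A point of Γ whose image under σ^k is Y up to a scalar, so that Y lies in both planes.
          let X = mulMV M (TV j Y)
              d , d≢0 , X≡ = iterate k X
              c , c≢0 , MY≡ = proj₂ (proj₂ meet) (mulMV M Y) (M-≢0 Y≢0 , f≡0⇒Γ Y fY)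
                (M-≢0 Y≢0 , X , (M-≢0 (TV-≢0 j Y≢0) , f≡0⇒Γ (TV j Y) fYⱼ) , d ⁻¹ , ⁻¹-≢0 d≢0 , N-injective (λ i → begin
                  mulMV N (mulMV M Y) i                        ≡⟨ NM Y i ⟩
                  Y i                                          ≡⟨ T-cancel k j k+j≡5 (Y i) ⟨
                  T k (TV j Y i)                               ≡⟨ cong (T k) (NM (TV j Y) i) ⟨
                  T k (mulMV N X i)                            ≡⟨ trans (cong (_* T k (mulMV N X i)) (⁻¹-inverseˡ d≢0)) (*-identityˡ _) ⟨
                  d ⁻¹ * d * T k (mulMV N X i)                 ≡⟨ *-assoc _ _ _ ⟩
                  d ⁻¹ * (d * T k (mulMV N X i))               ≡⟨ cong (d ⁻¹ *_) (X≡ i) ⟨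
                  d ⁻¹ * mulMV N (iter k σ X) i                ≡⟨ IsLinear.homogeneous (mulMV-linear N i) (d ⁻¹) (iter k σ X) ⟨
                  mulMV N (d ⁻¹ ⊙ iter k σ X) i                ∎))
          in c , c≢0 , λ i → trans (sym (NM Y i)) (trans (mulMV-cong N MY≡ i) (IsLinear.homogeneous (mulMV-linear N i) c A))

      scattered′ : MaxScattered (LinearSet f)
      scattered′ = MaxScattered-resp projection⇒ ⇒projection scattered

    module _ {A B : Vec 5} (A-meet : MeetIsPoint g 4 σ A) (B-meet : MeetIsPoint g 3 σ B)
      (general : NoThreeCollinear A (iter 1 σ A) B (iter 2 σ B)) {E F : Vec 5}
      (E∈AB : OnLine A B E) (E∈A₁B₂ : OnLine (iter 1 σ A) (iter 2 σ B) E)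
      (F∈AB₂ : OnLine A (iter 2 σ B) F) (F∈A₁B : OnLine (iter 1 σ A) B F) where
      private
        module A = Meet {4} {1} refl A-meet
        module B = Meet {3} {2} refl B-meet

        Ã = A.Ã
        B̃ = B.Ã
        Ẽ = mulMV N E
        F̃ = mulMV N F

        module D = ConjugateVectors (double-exponent t-exp)

        -- σ² turns the roles of A, A₁, B, B₂ into those of B, B₂, A₁, A.
        TV-double : ∀ k (v : Vec 5) → D.TV k v ≐ TV (2 ℕ.* k) v
        TV-double k v i = double-Fr t-exp k (v i)

        A₅ : TV 4 (TV 1 Ã) ≐ Ã
        A₅ i = T-cancel 4 1 refl (Ã i)

        spanE : InSpan₂ Ã B̃ Ẽ
        spanE = span-coordinates (itself A) (itself B) (proj₂ E∈AB)

        spanE′ : InSpan₂ (TV 1 Ã) (TV 2 B̃) Ẽ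
        spanE′ = span-coordinates (iterate 1 A) (iterate 2 B) (proj₂ E∈A₁B₂)

        spanF : InSpan₂ Ã (TV 2 B̃) F̃
        spanF = span-coordinates (itself A) (iterate 2 B) (proj₂ F∈AB₂)

        spanF′ : InSpan₂ (TV 1 Ã) B̃ F̃
        spanF′ = span-coordinates (iterate 1 A) (itself B) (proj₂ F∈A₁B)

        f-span : ∀ {P Q X} → f P ≐ zeroV → f Q ≐ zeroV → InSpan₂ P Q X → f X ≐ zeroV
        f-span {P} {Q} fP fQ (a , b , e) i = trans (f.respects i {w = a ⊙ P ⊕ b ⊙ Q} e) (trans (f.additive i (a ⊙ P) (b ⊙ Q))
          (sum≡0 (trans (f.homogeneous i a P) (scale≡0 a (fP i))) (trans (f.homogeneous i b Q) (scale≡0 b (fQ i)))))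

        indE : Independent₃ Ã (TV 1 Ã) Ẽ
        indE = independent-with-meet (N-≢0 (proj₁ E∈AB))
          (independent-coordinates (itself A) (iterate 1 A) (itself B) (proj₁ general))
          (independent-coordinates (itself A) (iterate 1 A) (iterate 2 B) (proj₁ (proj₂ general))) spanE spanE′

        cycle : ∀ {P Q R} → Independent₃ P Q R → Independent₃ Q R P
        cycle {P} {Q} {R} ind a b c z = proj₁ (proj₂ zeros) , proj₂ (proj₂ zeros) , proj₁ zeros
          where
          zeros = ind c a b (λ i → trans (solve 3 (λ x y z → z :+ (x :+ y) := x :+ (y :+ z)) refl (a * Q i) (b * R i) (c * P i)) (z i))

        -- For σ² the base pair is B, B₂, and the partners on the two lines through F are A₁ and A.
        indF : Independent₃ B̃ (TV 2 B̃) F̃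
        indF = independent-with-meet (N-≢0 (proj₁ F∈AB₂))
          (cycle (independent-coordinates (iterate 1 A) (itself B) (iterate 2 B) (proj₂ (proj₂ (proj₂ general)))))
          (cycle (independent-coordinates (itself A) (itself B) (iterate 2 B) (proj₁ (proj₂ (proj₂ general)))))
          (InSpan₂-swap spanF′) (InSpan₂-swap spanF)

        f-double : ∀ k X → f (TV (2 ℕ.* k) X) ≐ zeroV → f (D.TV k X) ≐ zeroV
        f-double k X z i = trans (f.respects i (TV-double k X)) (z i)

        wrapV : ∀ k (X : Vec 5) → TV (5 ℕ.+ k) X ≐ TV k X
        wrapV k X i = T-5+ k (X i)

      E-sufficient : OnLine (iter 2 σ A) (iter 4 σ A) E → IsLPType (Projection M g l)
      E-sufficient (_ , span) = let α , β , E≡ = span-coordinates (iterate 2 A) (iterate 4 A) span in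
        LPType-resp ⇒projection projection⇒ (sufficient t-exp p₀∉Fq f-lin (f-l 0F) (f-l 1F) scattered′ A.fÃ A.fÃⱼ A.unique
          (f-span A.fÃ B.fÃ spanE) E≡ indE)

      -- The second and fourth images under σ² are B₄ and B₈ = B₃, hence the exchange of the two
      -- spanning points.
      F-sufficient : OnLine (iter 3 σ B) (iter 4 σ B) F → IsLPType (Projection M g l)
      F-sufficient (_ , span) = let α , β , F≡ = InSpan₂-resp {X = F̃} (λ i → sym (TV-double 2 B̃ i)) (λ i → sym (trans (TV-double 4 B̃ i) (wrapV 3 B̃ i)))
                                              (InSpan₂-swap {X = F̃} (span-coordinates (iterate 3 B) (iterate 4 B) span)) in
        LPType-resp ⇒projection projection⇒ (sufficient (double-exponent t-exp) p₀∉Fq f-lin (f-l 0F) (f-l 1F) scattered′ B.fÃ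
          (f-double 1 B̃ B.fÃⱼ) (λ X X≢0 fX fX₂ → B.unique X X≢0 fX (λ i → trans (f.respects i (λ j → sym (TV-double 1 X j))) (fX₂ i)))
          (f-span A.fÃ B.fÃⱼ spanF) F≡ (Independent₃-resp (λ _ → refl) (λ i → sym (TV-double 1 B̃ i)) indF))

      private
        cases : ∀ ξ → IsLinear ξ → (∀ u → (∀ i → InFq (u i)) → NonZero u → ξ u ≢ 0#) → (∀ X → f X ≐ zeroV → ξ X ≡ 0#) →
          Shaped f ξ 1 ⊎ Shaped f ξ 2 → OnLine (iter 2 σ A) (iter 4 σ A) E ⊎ OnLine (iter 3 σ B) (iter 4 σ B) F
        cases ξ ξ-lin ξ-nonzero ξ-vanishes shaped = [ E-case , F-case ]′ (shaped-for f ξ t-exp shaped)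
          where
          E-case : Shaped f ξ t → OnLine (iter 2 σ A) (iter 4 σ A) E ⊎ OnLine (iter 3 σ B) (iter 4 σ B) F
          E-case s = let a , b , a≢0 , b≢0 , eq = Shaped-T t-exp {f} {ξ} ξ-lin s
                         _ , _ , E≡ = spanE
                         _ , _ , E≡′ = spanE′ in
            inj₁ (proj₁ E∈AB , coordinates-span (iterate 2 A) (iterate 4 A)
              (necessary t-exp p₀∉Fq {f} ξ-lin ξ-nonzero ξ-vanishes a≢0 b≢0 eq A.Ã≢0 A.fÃ A.fÃⱼ B.fÃ B.fÃⱼ E≡ E≡′))
          -- For σ² the pair A, B is replaced by B, A₁, and the second image of A₁ is A₅ = A.
          F-case : Shaped f ξ (double t-exp) → OnLine (iter 2 σ A) (iter 4 σ A) E ⊎ OnLine (iter 3 σ B) (iter 4 σ B) F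
          F-case s = let a , b , a≢0 , b≢0 , eq = Shaped-T (double-exponent t-exp) {f} {ξ} ξ-lin s
                         _ , _ , F≡ = InSpan₂-swap {X = F̃} spanF′
                         _ , _ , F≡′ = InSpan₂-resp {X = F̃} (λ i → sym (TV-double 1 B̃ i))
                                         (λ i → sym (trans (TV-double 2 (TV 1 Ã) i) (A₅ i))) (InSpan₂-swap {X = F̃} spanF) in
            inj₂ (proj₁ F∈AB₂ , coordinates-span (iterate 3 B) (iterate 4 B) (InSpan₂-swap {X = F̃} (InSpan₂-resp {X = F̃} (TV-double 2 B̃)
              (λ i → trans (TV-double 4 B̃ i) (wrapV 3 B̃ i))
              (necessary (double-exponent t-exp) p₀∉Fq {f} ξ-lin ξ-nonzero ξ-vanishes a≢0 b≢0 eq {B̃} {TV 1 Ã} B.Ã≢0 B.fÃ (f-double 1 B̃ B.fÃⱼ) A.fÃⱼ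
                (f-double 2 (TV 1 Ã) (λ i → trans (f.respects i A₅) (A.fÃ i))) F≡ F≡′))))

      E-or-F-necessary : IsLPType (Projection M g l) → OnLine (iter 2 σ A) (iter 4 σ A) E ⊎ OnLine (iter 3 σ B) (iter 4 σ B) F
      E-or-F-necessary lp =
        let _ , _ , s-valid , Nδ≢0 , _ , equiv = LPType-resp projection⇒ ⇒projection lp
            ξ , ξ-lin , ξ-nonzero , ξ-vanishes , shaped =
              LP⇒shaped p₀∉Fq f-lin (f-nonzero empty) scattered′ (validS⇒exponent s-valid) Nδ≢0 equiv
        in cases ξ ξ-lin ξ-nonzero ξ-vanishes shaped

theorem2p10 : (𝔽 : FiniteField) (q : ℕ) → IsPrimePower q → FiniteField.order 𝔽 ≡ q ^ 5 →
    let open Geometry 𝔽 q in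
    (M : Mat 5) → Invertible M →
    (g : Fin 3 → Vec 5) → LinIndep g →
    ¬ (∃ λ X → SubgeomPoint M X × InPlane g X) →
    (l : Fin 2 → Vec 5) → LinIndep l → LineDisjointPlane g l →
    MaxScattered (Projection M g l) → ¬ IsPseudoregulusType (Projection M g l) →
    (σ : Semilinear 5) → InG M σ → NotIdentity σ →
    (A B : Vec 5) → MeetIsPoint g 4 σ A → MeetIsPoint g 3 σ B →
    NoThreeCollinear A (iter 1 σ A) B (iter 2 σ B) →
    (E F : Vec 5) →
    OnLine A B E → OnLine (iter 1 σ A) (iter 2 σ B) E →
    OnLine A (iter 2 σ B) F → OnLine (iter 1 σ A) B F →
    IsLPType (Projection M g l) ⇔
    (OnLine (iter 2 σ A) (iter 4 σ A) E ⊎ OnLine (iter 3 σ B) (iter 4 σ B) F)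
theorem2p10 𝔽 q q-pp order≡ M (N , MN , NM) g g-indep empty l l-indep disjoint scattered _ σ σ∈G σ≢1
    A B A-meet B-meet general E F E∈AB E∈A₁B₂ F∈AB₂ F∈A₁B =
  mk⇔ (E-or-F-necessary M N MN NM g g-indep empty l l-indep disjoint scattered σ σ∈G σ≢1 A-meet B-meet general E∈AB E∈A₁B₂ F∈AB₂ F∈A₁B)
    [ E-sufficient M N MN NM g g-indep empty l l-indep disjoint scattered σ σ∈G σ≢1 A-meet B-meet general E∈AB E∈A₁B₂ F∈AB₂ F∈A₁B
    , F-sufficient M N MN NM g g-indep empty l l-indep disjoint scattered σ σ∈G σ≢1 A-meet B-meet general E∈AB E∈A₁B₂ F∈AB₂ F∈A₁B ]′
  where open Incidence 𝔽 q q-pp order≡
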